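{- Let $r\ge 1$ and $k\ge 1$. The number of sequences $(\tau_1,\dots,\tau_r)$ of star transpositions such that $\pi=\tau_1\tau_2\cdots\tau_r$ has exactly $k$ cycles is \[ \sum_{\substack{\mu\vdash n\\ j\in\mu}}\frac{d_\mu\,d_{j_-(\mu)}\,c_{\mu,j}^{\,r}}{n!}\,e_{n-k}(\mathbf{c}_\mu) = [t^k]\sum_{\substack{\mu\vdash n\\ j\in\mu}}\frac{d_\mu\,d_{j_-(\mu)}\,c_{\mu,j}^{\,r}}{n!}\,c_\mu(t), \] where the sums are over all $\mu\vdash n$ and distinct parts $j$ of $\mu$.
   Context: $\mathfrak{S}_n$ is the symmetric group on $\{1,\dots,n\}$ (products read right to left; cycles counted including fixed points). A star transposition is a transposition $(j,n)$ with $1\le j\le n-1$. $d_\nu$ is the number of standard Young tableaux of shape $\nu$; $j_-(\mu)\vdash n-1$ is obtained from $\mu$ by replacing one part $j$ by $j-1$ (deleting it if $j=1$). $c_{\mu,j}:=j-\sum_{i\ge j}m_i(\mu)$, where $m_i(\mu)$ is the multiplicity of $i$ as a part of $\mu$. The content of the cell in row $a$, column $b$ of a Young diagram is $b-a$; $\mathbf{c}_\mu$ is the multiset of the $n$ contents of the cells of the diagram of $\mu$; $e_{m}$ is the $m$-th elementary symmetric polynomial; $c_\mu(t)=\prod_{c\in\mathbf{c}_\mu}(t+c)$ is the content polynomial. -}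

module Defs where

open import Data.Bool using (Bool; true; false; _∧_; not; if_then_else_)
open import Data.Nat as ℕ using (ℕ; zero; suc; pred; _!; _≡ᵇ_; _<ᵇ_; _≤ᵇ_)
open import Data.Nat.Properties using (_!≢0)
open import Data.Fin using (Fin; toℕ; inject₁; fromℕ)
open import Data.Fin.Permutation using (Permutation; transpose; _⟨$⟩ʳ_)
open import Data.List using (List; []; _∷_; [_]; _++_; map; concatMap; filterᵇ;
  length; upTo; allFin; reverse; foldr; zip; concat)
open import Data.Bool.ListAction using (all; any)
open import Data.Nat.ListAction using (sum)
open import Data.Product using (_×_; _,_; proj₁; proj₂)
open import Data.Vec using (Vec; []; _∷_)
open import Data.Integer as ℤ using (ℤ; +_; -[1+_])
open import Data.Rational as ℚ using (ℚ; 0ℚ; 1ℚ)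

-- Permutation side.  Elements of {1,…,n} are encoded as Fin n (i ↦ i-1).
-- Star transposition (j,n), 1 ≤ j ≤ n-1, is indexed by j-1 : Fin (n-1);
-- distinct indices give distinct transpositions.

star : (n : ℕ) → Fin (pred n) → Permutation n n
star zero ()
star (suc m) j = transpose (inject₁ j) (fromℕ m)

starProduct : (n : ℕ) {r : ℕ} → Vec (Fin (pred n)) r → Fin n → Fin n
starProduct n []      x = x
starProduct n (j ∷ v) x = star n j ⟨$⟩ʳ starProduct n v x

iter : {A : Set} → (A → A) → ℕ → A → A
iter f zero    x = x
iter f (suc t) x = f (iter f t x)

isOrbitMin : (n : ℕ) → (Fin n → Fin n) → Fin n → Bool
isOrbitMin n f i = all (λ t → toℕ i ≤ᵇ toℕ (iter f t i)) (upTo n)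

-- number of cycles (fixed points included) = number of orbits
--   = number of orbit-minima
numCycles : (n : ℕ) → (Fin n → Fin n) → ℕ
numCycles n f = length (filterᵇ (isOrbitMin n f) (allFin n))

allVecs : (m r : ℕ) → List (Vec (Fin m) r)
allVecs m zero    = [ [] ]
allVecs m (suc r) = concatMap (λ j → map (j ∷_) (allVecs m r)) (allFin m)

starCount : (n r k : ℕ) → ℕ
starCount n r k =
  length (filterᵇ (λ v → numCycles n (starProduct n v) ≡ᵇ k) (allVecs (pred n) r))

weaklyDecreasing : List ℕ → Bool
weaklyDecreasing []           = true
weaklyDecreasing (x ∷ [])     = true
weaklyDecreasing (x ∷ y ∷ xs) = (y ≤ᵇ x) ∧ weaklyDecreasing (y ∷ xs)

isPartitionOf : ℕ → List ℕ → Bool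
isPartitionOf n μ = weaklyDecreasing μ ∧ all (λ x → 0 <ᵇ x) μ ∧ (sum μ ≡ᵇ n)

listsOfLength : ℕ → List ℕ → List (List ℕ)
listsOfLength zero    vals = [ [] ]
listsOfLength (suc L) vals =
  concatMap (λ x → map (x ∷_) (listsOfLength L vals)) vals

-- every partition of n has at most n parts, each in {1,…,n}
partitions : ℕ → List (List ℕ)
partitions n = filterᵇ (isPartitionOf n)
  (concatMap (λ L → listsOfLength L (map suc (upTo n))) (upTo (suc n)))

distinctParts : List ℕ → List ℕ
distinctParts μ = filterᵇ (λ j → any (j ≡ᵇ_) μ) (map suc (upTo (sum μ)))

-- Standard Young tableaux.  A filling of shape μ is a list of rows,
-- row a having μ_a entries.  Entries are taken in {0,…,N-1} (N = |μ|),
-- i.e. the labels 1..N shifted by one.  A filling is standard iff its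
-- entries are pairwise distinct (hence a bijection onto {0,…,N-1}),
-- rows increase left to right and columns increase top to bottom.

fillings : List ℕ → ℕ → List (List (List ℕ))
fillings []       N = [ [] ]
fillings (l ∷ ls) N =
  concatMap (λ row → map (row ∷_) (fillings ls N)) (listsOfLength l (upTo N))

strictlyIncreasing : List ℕ → Bool
strictlyIncreasing []           = true
strictlyIncreasing (x ∷ [])     = true
strictlyIncreasing (x ∷ y ∷ xs) = (x <ᵇ y) ∧ strictlyIncreasing (y ∷ xs)

columnsIncreasing : List (List ℕ) → Bool
columnsIncreasing []             = true
columnsIncreasing (R ∷ [])       = true
columnsIncreasing (R ∷ R′ ∷ Rs)  =
  all (λ p → proj₁ p <ᵇ proj₂ p) (zip R R′) ∧ columnsIncreasing (R′ ∷ Rs)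

noDuplicates : List ℕ → Bool
noDuplicates []       = true
noDuplicates (x ∷ xs) = not (any (x ≡ᵇ_) xs) ∧ noDuplicates xs

isStandard : List (List ℕ) → Bool
isStandard F = noDuplicates (concat F) ∧ all strictlyIncreasing F ∧ columnsIncreasing F

numSYT : List ℕ → ℕ
numSYT μ = length (filterᵇ isStandard (fillings μ (sum μ)))

-- j₋(μ): replace one part j by j-1 (the last occurrence, so the result is
-- again weakly decreasing), deleting it if it becomes 0.

replaceFirst : ℕ → List ℕ → List ℕ
replaceFirst j []       = []
replaceFirst j (x ∷ xs) = if x ≡ᵇ j then pred x ∷ xs else x ∷ replaceFirst j xs

jMinus : List ℕ → ℕ → List ℕ
jMinus μ j = filterᵇ (λ x → not (x ≡ᵇ 0)) (reverse (replaceFirst j (reverse μ)))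

mult : ℕ → List ℕ → ℕ
mult i μ = length (filterᵇ (i ≡ᵇ_) μ)

-- c_{μ,j} = j - Σ_{i ≥ j} m_i(μ)   (parts are ≤ |μ|, so i ranges over j..|μ|)
cμj : List ℕ → ℕ → ℤ
cμj μ j = + j ℤ.- + sum (map (λ i → mult i μ) (filterᵇ (j ≤ᵇ_) (upTo (suc (sum μ)))))

contentsFrom : ℕ → List ℕ → List ℤ
contentsFrom a []       = []
contentsFrom a (l ∷ ls) = map (λ b → + b ℤ.- + a) (upTo l) ++ contentsFrom (suc a) ls

contents : List ℕ → List ℤ
contents μ = contentsFrom 0 μ

esym : ℕ → List ℤ → ℤ
esym zero    []       = + 1
esym (suc m) []       = + 0
esym zero    (x ∷ xs) = + 1
esym (suc m) (x ∷ xs) = esym (suc m) xs ℤ.+ x ℤ.* esym m xs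

esymℤ : ℤ → List ℤ → ℤ
esymℤ (+ m)    xs = esym m xs
esymℤ -[1+ m ] xs = + 0

-- Polynomials in t with rational coefficients, as coefficient lists
-- (constant term first).

Poly : Set
Poly = List ℚ

addP : Poly → Poly → Poly
addP []       q        = q
addP (a ∷ p)  []       = a ∷ p
addP (a ∷ p)  (b ∷ q)  = (a ℚ.+ b) ∷ addP p q

scaleP : ℚ → Poly → Poly
scaleP c p = map (c ℚ.*_) p

mulLinear : ℚ → Poly → Poly
mulLinear c p = addP (0ℚ ∷ p) (scaleP c p)

coeff : ℕ → Poly → ℚ
coeff k       []      = 0ℚ
coeff zero    (a ∷ p) = a
coeff (suc k) (a ∷ p) = coeff k p

toℚ : ℤ → ℚ
toℚ z = z ℚ./ 1

contentPoly : List ℕ → Poly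
contentPoly μ = foldr (λ c p → mulLinear (toℚ c) p) [ 1ℚ ] (contents μ)

sumℚ : List ℚ → ℚ
sumℚ = foldr ℚ._+_ 0ℚ

partitionPartPairs : ℕ → List (List ℕ × ℕ)
partitionPartPairs n = concatMap (λ μ → map (μ ,_) (distinctParts μ)) (partitions n)

weight : (n r : ℕ) → List ℕ × ℕ → ℚ
weight n r (μ , j) =
  ((+ (numSYT μ ℕ.* numSYT (jMinus μ j)) ℤ.* (cμj μ j ℤ.^ r)) ℚ./ (n !)) {{n !≢0}}

sumElementary : (n r k : ℕ) → ℚ
sumElementary n r k =
  sumℚ (map (λ p → weight n r p ℚ.* toℚ (esymℤ (+ n ℤ.- + k) (contents (proj₁ p))))
            (partitionPartPairs n))

sumContentPoly : (n r k : ℕ) → ℚ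
sumContentPoly n r k =
  coeff k (foldr addP [] (map (λ p → scaleP (weight n r p) (contentPoly (proj₁ p)))
                              (partitionPartPairs n)))

{-# OPTIONS --safe #-}

-- For t = N the generating function of the factorizations by number of cycles is τ(Jₙʳ), where
-- Jₙ = Σ (j n) and τ is the trace π ↦ N^(cycles of π).  The conditional expectation of 1/(z - Jₙ₊₁)
-- onto the group algebra of Sₙ satisfies 1 + Gₙ₊₁ = (1 + Gₙ)/(1 - (z - Jₙ)⁻²), so that τ of any
-- polynomial in the Jucys–Murphy elements reduces to fewer of them.  On the side of Young diagrams with
-- N rows, bᵢ = λᵢ - i and Vandermonde product Δ(b), partial fractions give
-- Σᵢ Δ(b + eᵢ)/(z - bᵢ) = Δ(b) (∏ᵢ (1 + 1/(z - bᵢ)) - 1), and the right-hand side obeys the same recursion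
-- when a cell is added.  Hence τ(f(J₁, …, Jₙ)) is the sum of Δ(b)/Δ(b(∅)) f(contents) over growing
-- sequences of diagrams.  The same identity with steps -eᵢ shows Δ(b)/Δ(b(∅)) = d_μ c_μ(N)/n!, and both
-- sides are polynomials in N that agree for all N ≥ n.
module Submission where

open import Defs
open import Data.Nat using (ℕ; _≤_)
open import Data.Integer using (+_)
open import Data.Rational using (ℚ; _/_)
open import Data.Product using (_×_)
open import Relation.Binary.PropositionalEquality using (_≡_)
open import Data.Bool using (Bool; true; false; T; T?; _∧_; not; if_then_else_)
open import Data.Bool.ListAction using (all; any; and)
open import Data.Bool.Properties using (T-∧)
open import Data.Empty using (⊥; ⊥-elim)
open import Data.Fin as Fin using (Fin; toℕ; fromℕ<; inject₁; fromℕ)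
import Data.Fin.Permutation.Components as Components
import Data.Fin.Properties as Finₚ
open import Data.Integer as ℤ using (ℤ; _+_; _*_; -_; _-_; _^_)
import Data.Integer.Properties as ℤₚ
open import Data.Integer.Tactic.RingSolver using (solve-∀)
open import Data.List using (List; []; _∷_; [_]; _++_; _∷ʳ_; map; concat; concatMap; filterᵇ; foldr; length; reverse; replicate; upTo; applyUpTo; allFin; tabulate; zip)
import Data.List.Properties as Listₚ
open import Data.List.Membership.Propositional using (_∈_; find; lose)
open import Data.List.Membership.Propositional.Properties using (∈-map⁻; ∈-map⁺; ∈-concatMap⁻; ∈-concatMap⁺; ∈-filter⁻; ∈-filter⁺; ∈-++⁺ˡ; ∈-++⁺ʳ; ∈-++⁻; ∈-upTo⁻; ∈-upTo⁺)
open import Data.List.Membership.Propositional.Properties.WithK using (unique∧set⇒bag)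
open import Data.List.Relation.Binary.BagAndSetEquality using (∼bag⇒↭)
import Data.List.Relation.Binary.Permutation.Propositional as Bag
open import Data.List.Relation.Unary.All as All using (All; []; _∷_)
import Data.List.Relation.Unary.All.Properties as Allₚ
open import Data.List.Relation.Unary.AllPairs using ([]; _∷_)
open import Data.List.Relation.Unary.Any using (here; there)
import Data.List.Relation.Unary.Any.Properties as Anyₚ
open import Data.List.Relation.Unary.Unique.Propositional using (Unique)
import Data.List.Relation.Unary.Unique.Propositional.Properties as Uniqueₚ
open import Data.Nat as ℕ using (zero; suc; pred; _<_; z≤n; s≤s; _≤ᵇ_; _<ᵇ_; _≡ᵇ_; _!)
import Data.Nat.DivMod as ℕ
open import Data.Nat.ListAction using (sum)
import Data.Nat.Properties as ℕₚ
open import Data.Product using (_,_; proj₁; proj₂; ∃)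
open import Data.Rational as ℚ using (0ℚ; 1ℚ)
import Data.Rational.Properties as ℚₚ
open import Data.Rational.Unnormalised using (mkℚᵘ; *≡*)
import Data.Rational.Unnormalised.Properties as ℚᵘₚ
open import Data.Sum using (_⊎_; inj₁; inj₂)
open import Data.Unit using (⊤; tt)
open import Data.Vec using (Vec; []; _∷_)
open import Function using (_∘_; id; Equivalence)
open import Function.Bundles using (mk⇔)
open import Relation.Binary.Definitions using (tri<; tri≈; tri>)
open import Relation.Binary.PropositionalEquality using (_≢_; refl; sym; trans; cong; cong₂; subst; subst₂; module ≡-Reasoning)
open import Relation.Nullary using (¬_; yes; no)
open ≡-Reasoning


-- The trace N^(cycles) does the work that characters of the symmetric group would do: its values on
-- words in the Jucys-Murphy elements suffice for the count, and no representation has to be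
-- constructed. What must be bridged is that the algebra treats all N rows alike while the
-- combinatorics allows only steps between diagrams. This works because b is strictly decreasing on
-- diagrams and an illegal unit step makes two neighbouring entries equal, where Δ vanishes. N ≥ n
-- is imposed so that every diagram with n cells fits into N rows. Series in 1/z are kept as
-- sequences of coefficients, and the denominators Δ(b(∅)) and n! are carried as factors, so that
-- all identities up to the last section hold between integers. The first factor is cancelled once
-- for each N; the second becomes the denominator of the weights.

-- Finite sums of integers

∑ : {A : Set} → List A → (A → ℤ) → ℤ
∑ []       f = + 0
∑ (x ∷ xs) f = f x + ∑ xs f

∑< : ℕ → (ℕ → ℤ) → ℤ
∑< zero    f = + 0
∑< (suc n) f = ∑< n f + f n

interchange : ∀ a b c d → (a + b) + (c + d) ≡ (a + c) + (b + d)
interchange = solve-∀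

module _ {A : Set} where

  ∑-cong∈ : (xs : List A) {f g : A → ℤ} → (∀ x → x ∈ xs → f x ≡ g x) → ∑ xs f ≡ ∑ xs g
  ∑-cong∈ []       e = refl
  ∑-cong∈ (x ∷ xs) e = cong₂ _+_ (e x (here refl)) (∑-cong∈ xs (λ y → e y ∘ there))

  ∑-cong : (xs : List A) {f g : A → ℤ} → (∀ x → f x ≡ g x) → ∑ xs f ≡ ∑ xs g
  ∑-cong xs e = ∑-cong∈ xs (λ x _ → e x)

  ∑-zero : (xs : List A) → ∑ xs (λ _ → + 0) ≡ + 0
  ∑-zero []       = refl
  ∑-zero (x ∷ xs) = trans (ℤₚ.+-identityˡ _) (∑-zero xs)

  ∑-++ : (xs ys : List A) (f : A → ℤ) → ∑ (xs ++ ys) f ≡ ∑ xs f + ∑ ys f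
  ∑-++ []       ys f = sym (ℤₚ.+-identityˡ _)
  ∑-++ (x ∷ xs) ys f = trans (cong (_+_ (f x)) (∑-++ xs ys f)) (sym (ℤₚ.+-assoc (f x) _ _))

  ∑-+ : (xs : List A) (f g : A → ℤ) → ∑ xs (λ x → f x + g x) ≡ ∑ xs f + ∑ xs g
  ∑-+ []       f g = refl
  ∑-+ (x ∷ xs) f g = trans (cong (_+_ (f x + g x)) (∑-+ xs f g)) (interchange (f x) (g x) (∑ xs f) (∑ xs g))

  ∑-* : (k : ℤ) (xs : List A) (f : A → ℤ) → ∑ xs (λ x → k * f x) ≡ k * ∑ xs f
  ∑-* k []       f = sym (ℤₚ.*-zeroʳ k)
  ∑-* k (x ∷ xs) f = trans (cong (_+_ (k * f x)) (∑-* k xs f)) (sym (ℤₚ.*-distribˡ-+ k (f x) (∑ xs f)))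

  ∑-map : {B : Set} (h : B → A) (xs : List B) (f : A → ℤ) → ∑ (map h xs) f ≡ ∑ xs (f ∘ h)
  ∑-map h []       f = refl
  ∑-map h (x ∷ xs) f = cong (_+_ (f (h x))) (∑-map h xs f)

  ∑-concatMap : {B : Set} (h : B → List A) (xs : List B) (f : A → ℤ) →
                ∑ (concatMap h xs) f ≡ ∑ xs (λ x → ∑ (h x) f)
  ∑-concatMap h []       f = refl
  ∑-concatMap h (x ∷ xs) f =
    trans (∑-++ (h x) (concatMap h xs) f) (cong (_+_ (∑ (h x) f)) (∑-concatMap h xs f))

∑-comm : {A B : Set} (xs : List A) (ys : List B) (f : A → B → ℤ) →
         ∑ xs (λ x → ∑ ys (f x)) ≡ ∑ ys (λ y → ∑ xs (λ x → f x y))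
∑-comm []       ys f = sym (∑-zero ys)
∑-comm (x ∷ xs) ys f =
  trans (cong (_+_ (∑ ys (f x))) (∑-comm xs ys f)) (sym (∑-+ ys (f x) (λ y → ∑ xs (λ x′ → f x′ y))))

∑<-cong : (n : ℕ) {f g : ℕ → ℤ} → (∀ i → i < n → f i ≡ g i) → ∑< n f ≡ ∑< n g
∑<-cong zero    e = refl
∑<-cong (suc n) e =
  cong₂ _+_ (∑<-cong n (λ i i<n → e i (ℕₚ.m<n⇒m<1+n i<n))) (e n (ℕₚ.n<1+n n))

∑<-+ : (n : ℕ) (f g : ℕ → ℤ) → ∑< n (λ x → f x + g x) ≡ ∑< n f + ∑< n g
∑<-+ zero    f g = refl
∑<-+ (suc n) f g = trans (cong (_+ (f n + g n)) (∑<-+ n f g)) (interchange (∑< n f) (∑< n g) (f n) (g n))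

∑<-zero : (n : ℕ) → ∑< n (λ _ → + 0) ≡ + 0
∑<-zero zero    = refl
∑<-zero (suc n) = trans (ℤₚ.+-identityʳ _) (∑<-zero n)

∑<-* : (k : ℤ) (n : ℕ) (f : ℕ → ℤ) → ∑< n (λ x → k * f x) ≡ k * ∑< n f
∑<-* k zero    f = sym (ℤₚ.*-zeroʳ k)
∑<-* k (suc n) f = trans (cong (_+ k * f n) (∑<-* k n f)) (sym (ℤₚ.*-distribˡ-+ k (∑< n f) (f n)))

∑<-∑ : {A : Set} (n : ℕ) (xs : List A) (f : ℕ → A → ℤ) →
       ∑< n (λ i → ∑ xs (f i)) ≡ ∑ xs (λ x → ∑< n (λ i → f i x))
∑<-∑ zero    xs f = sym (∑-zero xs)
∑<-∑ (suc n) xs f = trans (cong (_+ ∑ xs (f n)) (∑<-∑ n xs f)) (sym (∑-+ xs _ (f n)))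

∑<-comm : (m n : ℕ) (f : ℕ → ℕ → ℤ) →
          ∑< m (λ i → ∑< n (f i)) ≡ ∑< n (λ j → ∑< m (λ i → f i j))
∑<-comm zero    n f = sym (∑<-zero n)
∑<-comm (suc m) n f = trans (cong (_+ ∑< n (f m)) (∑<-comm m n f)) (sym (∑<-+ n _ (f m)))

-- Transpositions of natural numbers

Inj : (ℕ → ℕ) → Set
Inj f = ∀ {x y} → f x ≡ f y → x ≡ y

abstract

  swap : ℕ → ℕ → ℕ → ℕ
  swap i j x with x ℕ.≟ i | x ℕ.≟ j
  ... | yes _ | _     = j
  ... | no  _ | yes _ = i
  ... | no  _ | no  _ = x

  swap-l : ∀ i j → swap i j i ≡ j
  swap-l i j with i ℕ.≟ i
  ... | yes _ = refl
  ... | no ¬p = ⊥-elim (¬p refl)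

  swap-r : ∀ i j → swap i j j ≡ i
  swap-r i j with j ℕ.≟ i | j ℕ.≟ j
  ... | yes p | _     = p
  ... | no  _ | yes _ = refl
  ... | no  _ | no ¬p = ⊥-elim (¬p refl)

  swap-o : ∀ i j {x} → x ≢ i → x ≢ j → swap i j x ≡ x
  swap-o i j {x} x≢i x≢j with x ℕ.≟ i | x ℕ.≟ j
  ... | yes p | _     = ⊥-elim (x≢i p)
  ... | no  _ | yes p = ⊥-elim (x≢j p)
  ... | no  _ | no  _ = refl

  swap-involutive : ∀ i j x → swap i j (swap i j x) ≡ x
  swap-involutive i j x with x ℕ.≟ i | x ℕ.≟ j
  ... | yes p | _     = trans (swap-r i j) (sym p)
  ... | no  _ | yes p = trans (swap-l i j) (sym p)
  ... | no  p | no  q = swap-o i j p q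

  swap-inj : ∀ i j → Inj (swap i j)
  swap-inj i j {x} {y} e =
    trans (sym (swap-involutive i j x)) (trans (cong (swap i j) e) (swap-involutive i j y))

  swap-conj : (τ : ℕ → ℕ) → Inj τ → ∀ i j x → τ (swap i j x) ≡ swap (τ i) (τ j) (τ x)
  swap-conj τ inj i j x with x ℕ.≟ i | x ℕ.≟ j
  ... | yes refl | _        = sym (swap-l (τ i) (τ j))
  ... | no  _    | yes refl = sym (swap-r (τ i) (τ j))
  ... | no  p    | no  q    = sym (swap-o _ _ (p ∘ inj) (q ∘ inj))

  swap-< : ∀ {i j m x} → i < m → j < m → x < m → swap i j x < m
  swap-< {i} {j} {m} {x} i<m j<m x<m with x ℕ.≟ i | x ℕ.≟ j
  ... | yes _ | _     = j<m
  ... | no  _ | yes _ = i<m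
  ... | no  _ | no  _ = x<m

swap-≥ : ∀ {i j m x} → i < m → j < m → m ≤ x → swap i j x ≡ x
swap-≥ i<m j<m m≤x = swap-o _ _ (ℕₚ.>⇒≢ (ℕₚ.<-≤-trans i<m m≤x)) (ℕₚ.>⇒≢ (ℕₚ.<-≤-trans j<m m≤x))

-- The exceptional values stand on opposite sides, so that nothing is subtracted. In `∑<-swap` this
-- moves the last summand to place j.
∑<-replace : ∀ m j (g h : ℕ → ℤ) → j < m → (∀ i → i < m → i ≢ j → g i ≡ h i) →
             ∑< m g + h j ≡ ∑< m h + g j
∑<-replace (suc m) j g h j<1+m e with j ℕ.≟ m
... | yes refl = trans (cong (λ z → z + g m + h m)
                          (∑<-cong m (λ i i<m → e i (ℕₚ.m<n⇒m<1+n i<m) (ℕₚ.<⇒≢ i<m))))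
                       (lem (∑< m h) (g m) (h m))
  where
  lem : ∀ a b c → a + b + c ≡ a + c + b
  lem = solve-∀
... | no j≢m = begin
  ∑< m g + g m + h j ≡⟨ lem (∑< m g) (g m) (h j) ⟩
  ∑< m g + h j + g m ≡⟨ cong₂ _+_ (∑<-replace m j g h j<m (λ i i<m → e i (ℕₚ.m<n⇒m<1+n i<m)))
                                  (e m (ℕₚ.n<1+n m) (j≢m ∘ sym)) ⟩
  ∑< m h + g j + h m ≡⟨ lem (∑< m h) (g j) (h m) ⟩
  ∑< m h + h m + g j ∎
  where
  j<m = ℕₚ.≤∧≢⇒< (ℕₚ.≤-pred j<1+m) j≢m
  lem : ∀ a b c → a + b + c ≡ a + c + b
  lem = solve-∀

∑<-swap : ∀ n j k (h : ℕ → ℤ) → j < k → k < n → ∑< n (h ∘ swap j k) ≡ ∑< n h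
∑<-swap (suc n) j k h j<k k<1+n with k ℕ.≟ n
... | yes refl = begin
  ∑< n (h ∘ swap j n) + h (swap j n n) ≡⟨ cong (λ z → ∑< n (h ∘ swap j n) + h z) (swap-r j n) ⟩
  ∑< n (h ∘ swap j n) + h j
    ≡⟨ ∑<-replace n j (h ∘ swap j n) h j<k
         (λ i i<n i≢j → cong h (swap-o j n i≢j (ℕₚ.<⇒≢ i<n))) ⟩
  ∑< n h + h (swap j n j) ≡⟨ cong (λ z → ∑< n h + h z) (swap-l j n) ⟩
  ∑< n h + h n ∎
... | no k≢n = cong₂ _+_ (∑<-swap n j k h j<k k<n)
    (cong h (swap-≥ (ℕₚ.<-trans j<k k<n) k<n ℕₚ.≤-refl))
  where k<n = ℕₚ.≤∧≢⇒< (ℕₚ.≤-pred k<1+n) k≢n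

-- Jucys–Murphy operators on functions of permutations

-- Group elements are bare functions on ℕ, so that all symmetric groups share one type and the
-- inclusions between them are identities.
Φ : Set
Φ = (ℕ → ℕ) → ℤ

infix 4 _≐_
_≐_ : Φ → Φ → Set
φ ≐ ψ = ∀ f → φ f ≡ ψ f

infixl 6 _⊹_
_⊹_ : Φ → Φ → Φ
(φ ⊹ ψ) f = φ f + ψ f

-- Permutations that agree at every point need not be equal as functions; every rewriting of a
-- product inside a functional rests on this property.
Ext : Φ → Set
Ext φ = ∀ {f g} → (∀ x → f x ≡ g x) → φ f ≡ φ g

translate : (ℕ → ℕ) → Φ → Φ
translate τ φ f = φ (λ x → f (τ x))

-- Right multiplication by the sum of the transpositions (j y), j < n; X n n is the Jucys–Murphy element.
X : ℕ → ℕ → Φ → Φ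
X n y φ f = ∑< n (λ j → translate (swap j y) φ f)

X-cong : ∀ n y {φ ψ} → φ ≐ ψ → X n y φ ≐ X n y ψ
X-cong n y e f = ∑<-cong n (λ j _ → e _)

X-⊹ : ∀ n y φ ψ → X n y (φ ⊹ ψ) ≐ X n y φ ⊹ X n y ψ
X-⊹ n y φ ψ f = ∑<-+ n _ _

X-ext : ∀ n y {φ} → Ext φ → Ext (X n y φ)
X-ext n y e p = ∑<-cong n (λ j _ → e (λ x → p _))

translate-ext : ∀ τ {φ} → Ext φ → Ext (translate τ φ)
translate-ext τ e p = e (λ x → p _)

-- Conjugation by (j k) fixes y and permutes the transpositions (i y) with i < n among themselves.
X-translate : ∀ n y j k {φ} → Ext φ → j < k → k < n → n ≤ y →
              translate (swap j k) (X n y φ) ≐ X n y (translate (swap j k) φ)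
X-translate n y j k {φ} e j<k k<n n≤y f = begin
  ∑< n (λ i → φ (λ x → f (τ (swap i y x))))
    ≡⟨ ∑<-cong n (λ i _ → e (λ x → cong f (trans (swap-conj τ (swap-inj j k) i y x)
         (cong (λ z → swap (τ i) z (τ x)) τy)))) ⟩
  ∑< n (λ i → φ (λ x → f (swap (τ i) y (τ x))))
    ≡⟨ ∑<-swap n j k (λ i → φ (λ x → f (swap i y (τ x)))) j<k k<n ⟩
  ∑< n (λ i → φ (λ x → f (swap i y (τ x)))) ∎
  where
  τ = swap j k
  τy : τ y ≡ y
  τy = swap-≥ (ℕₚ.<-trans j<k k<n) k<n n≤y

-- Each transposition of the first sum permutes the points below n, and such permutations commute
-- with the full sum of the (j y). For i = k and n = y this is the commutation of two Jucys-Murphy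
-- elements.
X-comm : ∀ i k n y {φ} → Ext φ → i ≤ k → k < n → n ≤ y →
         X i k (X n y φ) ≐ X n y (X i k φ)
X-comm i k n y {φ} e i≤k k<n n≤y f = begin
  ∑< i (λ j → translate (swap j k) (X n y φ) f)
    ≡⟨ ∑<-cong i (λ j j<i → X-translate n y j k e (ℕₚ.<-≤-trans j<i i≤k) k<n n≤y f) ⟩
  ∑< i (λ j → X n y (translate (swap j k) φ) f)
    ≡⟨ ∑<-comm i n _ ⟩
  X n y (X i k φ) f ∎

pow : (Φ → Φ) → ℕ → Φ → Φ
pow T zero    φ = φ
pow T (suc r) φ = T (pow T r φ)

-- Everything below follows from Y = Z + s, s x = Z s, s² = 1 and x Y = Y x.
module Powers (n m : ℕ) (n<m : n < m) where

  s x Y Z : Φ → Φ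
  s = translate (swap n m)
  x = X n n
  Y = X (suc n) m
  Z = X n m

  Y-ext : ∀ {φ} → Ext φ → Ext (Y φ)
  Y-ext = X-ext (suc n) m

  Y^-ext : ∀ r {φ} → Ext φ → Ext (pow Y r φ)
  Y^-ext zero    e = e
  Y^-ext (suc r) e = Y-ext (Y^-ext r e)

  Y^-cong : ∀ r {φ ψ} → φ ≐ ψ → pow Y r φ ≐ pow Y r ψ
  Y^-cong zero    e = e
  Y^-cong (suc r) e = X-cong (suc n) m (Y^-cong r e)

  Y^-⊹ : ∀ r φ ψ → pow Y r (φ ⊹ ψ) ≐ pow Y r φ ⊹ pow Y r ψ
  Y^-⊹ zero    φ ψ f = refl
  Y^-⊹ (suc r) φ ψ f = trans (X-cong (suc n) m (Y^-⊹ r φ ψ) f) (X-⊹ (suc n) m (pow Y r φ) (pow Y r ψ) f)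

  pow-shift : ∀ (T : Φ → Φ) r φ → pow T (suc r) φ ≡ pow T r (T φ)
  pow-shift T zero    φ = refl
  pow-shift T (suc r) φ = cong T (pow-shift T r φ)

  xY : ∀ {φ} → Ext φ → x (Y φ) ≐ Y (x φ)
  xY e = X-comm n n (suc n) m e ℕₚ.≤-refl (ℕₚ.n<1+n n) n<m

  xY^ : ∀ r {φ} → Ext φ → x (pow Y r φ) ≐ pow Y r (x φ)
  xY^ zero    e f = refl
  xY^ (suc r) e f = trans (xY (Y^-ext r e) f) (X-cong (suc n) m (xY^ r e) f)

  ss : ∀ {φ} → Ext φ → s (s φ) ≐ φ
  ss e f = e (λ y → cong f (swap-involutive n m y))

  private
    σ = swap n m

    σ-fix : ∀ j → j < n → σ j ≡ j
    σ-fix j j<n = swap-o n m (ℕₚ.<⇒≢ j<n) (ℕₚ.<⇒≢ (ℕₚ.<-trans j<n n<m))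

  sx : ∀ {φ} → Ext φ → s (x φ) ≐ Z (s φ)
  sx {φ} e f = ∑<-cong n (λ j j<n → e (λ y → cong f (begin
    σ (swap j n y)               ≡⟨ swap-conj σ (swap-inj n m) j n y ⟩
    swap (σ j) (σ n) (σ y)       ≡⟨ cong₂ (λ a b → swap a b (σ y)) (σ-fix j j<n) (swap-l n m) ⟩
    swap j m (σ y) ∎)))

  xs : ∀ {φ} → Ext φ → x (s φ) ≐ s (Z φ)
  xs {φ} e f = ∑<-cong n (λ j j<n → e (λ y → cong f (begin
    swap j n (σ y)               ≡⟨ cong₂ (λ a b → swap a b (σ y)) (sym (σ-fix j j<n)) (sym (swap-r n m)) ⟩
    swap (σ j) (σ m) (σ y)       ≡⟨ swap-conj σ (swap-inj n m) j m y ⟨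
    σ (swap j m y) ∎)))

  Ys : ∀ {φ} → Ext φ → Y (s φ) ≐ s (x φ) ⊹ φ
  Ys e f = cong₂ _+_ (sym (sx e f)) (ss e f)

  -- The sum of xⁱ Yʳ⁻¹⁻ⁱ over i < r.
  ω : ℕ → Φ → Φ
  ω zero    φ f = + 0
  ω (suc r) φ   = x (ω r φ) ⊹ pow Y r φ

  ωx : ∀ r {φ} → Ext φ → ω r (x φ) ≐ x (ω r φ)
  ωx zero    e f = sym (∑<-zero n)
  ωx (suc r) {φ} e f = begin
    x (ω r (x φ)) f + pow Y r (x φ) f     ≡⟨ cong₂ _+_ (X-cong n n (ωx r e) f) (sym (xY^ r e f)) ⟩
    x (x (ω r φ)) f + x (pow Y r φ) f     ≡⟨ X-⊹ n n (x (ω r φ)) (pow Y r φ) f ⟨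
    x (x (ω r φ) ⊹ pow Y r φ) f ∎

  -- Iteration of Y s = s x + 1: each Y that passes s becomes x, and the unit terms collect as `ω`.
  Y^s : ∀ r {φ} → Ext φ → pow Y r (s φ) ≐ s (pow x r φ) ⊹ ω r φ
  Y^s zero    e f = sym (ℤₚ.+-identityʳ _)
  Y^s (suc r) {φ} e f = begin
    pow Y (suc r) (s φ) f                      ≡⟨ cong (λ z → z f) (pow-shift Y r (s φ)) ⟩
    pow Y r (Y (s φ)) f                        ≡⟨ Y^-cong r (Ys e) f ⟩
    pow Y r (s (x φ) ⊹ φ) f                    ≡⟨ Y^-⊹ r _ _ f ⟩
    pow Y r (s (x φ)) f + pow Y r φ f          ≡⟨ cong (_+ pow Y r φ f) (Y^s r (X-ext n n e) f) ⟩
    s (pow x r (x φ)) f + ω r (x φ) f + pow Y r φ f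
      ≡⟨ cong₂ (λ a b → a + b + pow Y r φ f)
           (cong (λ z → z _) (sym (pow-shift x r φ))) (ωx r e f) ⟩
    s (pow x (suc r) φ) f + x (ω r φ) f + pow Y r φ f ≡⟨ ℤₚ.+-assoc (s (pow x (suc r) φ) f) _ _ ⟩
    s (pow x (suc r) φ) f + ω (suc r) φ f ∎

  -- The sum of xⁱ Yʳ⁻¹⁻ⁱ s over i < r.
  ς : ℕ → Φ → Φ
  ς zero    φ f = + 0
  ς (suc r) φ   = x (ς r φ) ⊹ pow Y r (s φ)

  ςZ : ∀ r {φ} → Ext φ → ς r (Z φ) ≐ x (ς r φ)
  ςZ zero    e f = sym (∑<-zero n)
  ςZ (suc r) {φ} e f = begin
    x (ς r (Z φ)) f + pow Y r (s (Z φ)) f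
      ≡⟨ cong₂ _+_ (X-cong n n (ςZ r e) f)
           (trans (Y^-cong r (λ g → sym (xs e g)) f) (sym (xY^ r (translate-ext σ e) f))) ⟩
    x (x (ς r φ)) f + x (pow Y r (s φ)) f ≡⟨ X-⊹ n n (x (ς r φ)) (pow Y r (s φ)) f ⟨
    x (ς (suc r) φ) f ∎

  -- The telescoping sum Yʳ - Zʳ = Σ Yʳ⁻¹⁻ⁱ s Zⁱ, in which s Zⁱ = xⁱ s and x commutes with Y.
  Y^≐ : ∀ r {φ} → Ext φ → pow Y r φ ≐ pow Z r φ ⊹ ς r φ
  Y^≐ zero    e f = sym (ℤₚ.+-identityʳ _)
  Y^≐ (suc r) {φ} e f = begin
    pow Y (suc r) φ f                          ≡⟨ cong (λ z → z f) (pow-shift Y r φ) ⟩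
    pow Y r (Z φ ⊹ s φ) f                      ≡⟨ Y^-⊹ r _ _ f ⟩
    pow Y r (Z φ) f + pow Y r (s φ) f          ≡⟨ cong (_+ pow Y r (s φ) f) (Y^≐ r (X-ext n m e) f) ⟩
    pow Z r (Z φ) f + ς r (Z φ) f + pow Y r (s φ) f
      ≡⟨ cong₂ (λ a b → a + b + pow Y r (s φ) f)
           (cong (λ z → z f) (sym (pow-shift Z r φ))) (ςZ r e f) ⟩
    pow Z (suc r) φ f + x (ς r φ) f + pow Y r (s φ) f ≡⟨ ℤₚ.+-assoc (pow Z (suc r) φ f) _ _ ⟩
    pow Z (suc r) φ f + ς (suc r) φ f ∎

-- Boolean tests and the counting of cycles by orbit minima

T-ext : ∀ {a b} → (T a → T b) → (T b → T a) → a ≡ b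
T-ext {true}  {true}  f g = refl
T-ext {true}  {false} f g = ⊥-elim (f tt)
T-ext {false} {true}  f g = ⊥-elim (g tt)
T-ext {false} {false} f g = refl

filterᵇ-cong∈ : {A : Set} {p q : A → Bool} (xs : List A) → (∀ x → x ∈ xs → p x ≡ q x) →
                filterᵇ p xs ≡ filterᵇ q xs
filterᵇ-cong∈ []       e = refl
filterᵇ-cong∈ {p = p} {q} (x ∷ xs) e with p x | q x | e x (here refl) | filterᵇ-cong∈ xs (λ y → e y ∘ there)
... | true  | true  | refl | ih = cong (x ∷_) ih
... | false | false | refl | ih = ih

length-filterᵇ-++ : {A : Set} (p : A → Bool) (xs ys : List A) →
                    length (filterᵇ p (xs ++ ys)) ≡ length (filterᵇ p xs) ℕ.+ length (filterᵇ p ys)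
length-filterᵇ-++ p xs ys = trans (cong length (Listₚ.filter-++ _ xs ys)) (Listₚ.length-++ (filterᵇ p xs))

all-upTo⁻ : ∀ n {p : ℕ → Bool} → T (all p (upTo n)) → ∀ {i} → i < n → T (p i)
all-upTo⁻ n {p} h i<n = Allₚ.applyUpTo⁻ id n (Allₚ.all⁺ p (upTo n) h) i<n

all-upTo⁺ : ∀ n {p : ℕ → Bool} → (∀ {i} → i < n → T (p i)) → T (all p (upTo n))
all-upTo⁺ n {p} h = Allₚ.all⁻ p (Allₚ.applyUpTo⁺₁ id n h)

record Perm (m : ℕ) (f : ℕ → ℕ) : Set where
  field
    inj : Inj f
    fix : ∀ x → m ≤ x → f x ≡ x

  -- If y = f x were at least m, then f y = y = f x, so injectivity would give x = y.
  stable : ∀ {x} → x < m → f x < m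
  stable {x} x<m = ℕₚ.≰⇒> λ m≤fx →
    ℕₚ.<⇒≱ x<m (subst (m ≤_) (inj (fix (f x) m≤fx)) m≤fx)

open Perm

perm-id : ∀ {m} → Perm m (λ x → x)
perm-id .inj e   = e
perm-id .fix x _ = refl

perm-swap : ∀ {m f j k} → Perm m f → j < m → k < m → Perm m (λ x → f (swap j k x))
perm-swap {j = j} {k} p j<m k<m .inj e = swap-inj j k (p .inj e)
perm-swap p j<m k<m .fix x m≤x rewrite swap-≥ j<m k<m m≤x = p .fix x m≤x

perm-suc : ∀ {m f} → Perm m f → Perm (suc m) f
perm-suc p .inj = p .inj
perm-suc p .fix x m<x = p .fix x (ℕₚ.<⇒≤ m<x)

iter-< : ∀ {m f} → Perm m f → ∀ t {i} → i < m → iter f t i < m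
iter-< p zero    i<m = i<m
iter-< p (suc t) i<m = stable p (iter-< p t i<m)

iter-+ : ∀ (f : ℕ → ℕ) a b x → iter f (a ℕ.+ b) x ≡ iter f a (iter f b x)
iter-+ f zero    b x = refl
iter-+ f (suc a) b x = cong f (iter-+ f a b x)

iter-cancel : ∀ {f} → Inj f → ∀ a {x y} → iter f a x ≡ iter f a y → x ≡ y
iter-cancel i zero    e = e
iter-cancel i (suc a) e = iter-cancel i a (i e)

iter-period : ∀ (f : ℕ → ℕ) p x → iter f p x ≡ x → ∀ k → iter f (k ℕ.* p) x ≡ x
iter-period f p x e zero    = refl
iter-period f p x e (suc k) =
  trans (iter-+ f p (k ℕ.* p) x) (trans (cong (iter f p) (iter-period f p x e k)) e)

-- The test for an orbit minimum inspects m iterates only, so these must exhaust the orbit. Two of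
-- the first m + 1 iterates coincide, cancellation yields a period p ≤ m, and t is reduced modulo p.
iter-bounded : ∀ {m f i} → Perm m f → i < m → ∀ t → ∃ λ t′ → t′ < m × iter f t i ≡ iter f t′ i
iter-bounded {m} {f} {i} pf i<m t
  with Finₚ.pigeonhole (ℕₚ.n<1+n m) (λ k → fromℕ< (iter-< pf (toℕ k) i<m))
... | a , b , a<b , e = go (toℕ b ℕ.∸ toℕ a) (ℕₚ.m<n⇒0<n∸m a<b)
        (ℕₚ.≤-trans (ℕₚ.m∸n≤m (toℕ b) (toℕ a)) (ℕₚ.≤-pred (Finₚ.toℕ<n b)))
        (iter-cancel (pf .inj) (toℕ a) (begin
          iter f (toℕ a) (iter f (toℕ b ℕ.∸ toℕ a) i) ≡⟨ iter-+ f (toℕ a) _ i ⟨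
          iter f (toℕ a ℕ.+ (toℕ b ℕ.∸ toℕ a)) i      ≡⟨ cong (λ z → iter f z i) (ℕₚ.m+[n∸m]≡n (ℕₚ.<⇒≤ a<b)) ⟩
          iter f (toℕ b) i                            ≡⟨ Finₚ.toℕ-fromℕ< _ ⟨
          toℕ (fromℕ< (iter-< pf (toℕ b) i<m))        ≡⟨ cong toℕ (sym e) ⟩
          toℕ (fromℕ< (iter-< pf (toℕ a) i<m))        ≡⟨ Finₚ.toℕ-fromℕ< _ ⟩
          iter f (toℕ a) i ∎))
  where
  go : ∀ p → 0 < p → p ≤ m → iter f p i ≡ i → ∃ λ t′ → t′ < m × iter f t i ≡ iter f t′ i
  go p@(suc _) _ p≤m e = t ℕ.% p , ℕₚ.<-≤-trans (ℕ.m%n<n t p) p≤m , (begin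
    iter f t i ≡⟨ cong (λ z → iter f z i) (ℕ.m≡m%n+[m/n]*n t p) ⟩
    iter f (t ℕ.% p ℕ.+ (t ℕ./ p) ℕ.* p) i ≡⟨ iter-+ f (t ℕ.% p) _ i ⟩
    iter f (t ℕ.% p) (iter f ((t ℕ./ p) ℕ.* p) i) ≡⟨ cong (iter f (t ℕ.% p)) (iter-period f p i e (t ℕ./ p)) ⟩
    iter f (t ℕ.% p) i ∎)

orbitMin : ℕ → (ℕ → ℕ) → ℕ → Bool
orbitMin m f i = all (λ t → i ≤ᵇ iter f t i) (upTo m)

orbitMin⁻ : ∀ {m f i} → Perm m f → i < m → T (orbitMin m f i) → ∀ t → i ≤ iter f t i
orbitMin⁻ {m} {f} {i} p i<m h t with iter-bounded p i<m t
... | t′ , t′<m , e = subst (i ≤_) (sym e) (ℕₚ.≤ᵇ⇒≤ i _ (all-upTo⁻ m h t′<m))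

orbitMin⁺ : ∀ {m f i} → (∀ t → i ≤ iter f t i) → T (orbitMin m f i)
orbitMin⁺ {m} h = all-upTo⁺ m (λ {t} _ → ℕₚ.≤⇒≤ᵇ (h t))

cyc : ℕ → (ℕ → ℕ) → ℕ
cyc m f = length (filterᵇ (orbitMin m f) (upTo m))

iter-cong : ∀ {f g : ℕ → ℕ} → (∀ x → f x ≡ g x) → ∀ t x → iter f t x ≡ iter g t x
iter-cong e zero    x = refl
iter-cong {f} e (suc t) x = trans (cong f (iter-cong e t x)) (e _)

cyc-ext : ∀ m {f g} → (∀ x → f x ≡ g x) → cyc m f ≡ cyc m g
cyc-ext m {f} {g} e = cong length (filterᵇ-cong∈ (upTo m) λ i _ →
  T-ext (λ h → all-upTo⁺ m (λ {t} t<m → subst (λ z → T (i ≤ᵇ z)) (iter-cong e t i) (all-upTo⁻ m h t<m)))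
        (λ h → all-upTo⁺ m (λ {t} t<m → subst (λ z → T (i ≤ᵇ z)) (sym (iter-cong e t i)) (all-upTo⁻ m h t<m))))

cyc-≤ : ∀ m f → cyc m f ≤ m
cyc-≤ m f = ℕₚ.≤-trans (Listₚ.length-filter _ (upTo m)) (ℕₚ.≤-reflexive (Listₚ.length-upTo m))

private
  indicator : Bool → ℕ
  indicator b = if b then 1 else 0

  cyc-split : ∀ m f g → (∀ i → i < m → orbitMin (suc m) f i ≡ orbitMin m g i) →
              cyc (suc m) f ≡ cyc m g ℕ.+ indicator (orbitMin (suc m) f m)
  cyc-split m f g e = begin
    length (filterᵇ q (upTo (suc m)))               ≡⟨ cong (length ∘ filterᵇ q) (Listₚ.upTo-∷ʳ m) ⟨
    length (filterᵇ q (upTo m ++ [ m ]))            ≡⟨ length-filterᵇ-++ q (upTo m) [ m ] ⟩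
    length (filterᵇ q (upTo m)) ℕ.+ length (filterᵇ q [ m ])
      ≡⟨ cong₂ ℕ._+_ (cong length (filterᵇ-cong∈ (upTo m) (λ i i∈ → e i (∈-upTo⁻ i∈)))) (last m) ⟩
    cyc m g ℕ.+ indicator (q m) ∎
    where
    q = orbitMin (suc m) f
    last : ∀ x → length (filterᵇ q [ x ]) ≡ indicator (q x)
    last x with q x
    ... | true  = refl
    ... | false = refl

-- The point m forms a cycle of its own. This is the origin of the factor N in the base case of `P`.
cyc-fixed : ∀ {m g} → Perm m g → cyc (suc m) g ≡ suc (cyc m g)
cyc-fixed {m} {g} p = begin
  cyc (suc m) g                                     ≡⟨ cyc-split m g g agree ⟩
  cyc m g ℕ.+ indicator (orbitMin (suc m) g m)
    ≡⟨ cong (λ b → cyc m g ℕ.+ indicator b)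
         (T-ext (λ _ → tt) (λ _ → orbitMin⁺ {suc m} (λ t → ℕₚ.≤-reflexive (sym (fixed t))))) ⟩
  cyc m g ℕ.+ 1                                     ≡⟨ ℕₚ.+-comm (cyc m g) 1 ⟩
  suc (cyc m g) ∎
  where
  fixed : ∀ t → iter g t m ≡ m
  fixed zero    = refl
  fixed (suc t) = trans (cong g (fixed t)) (p .fix m ℕₚ.≤-refl)
  agree : ∀ i → i < m → orbitMin (suc m) g i ≡ orbitMin m g i
  agree i i<m = T-ext (orbitMin⁺ {m} ∘ orbitMin⁻ (perm-suc p) (ℕₚ.m<n⇒m<1+n i<m))
                      (orbitMin⁺ {suc m} ∘ orbitMin⁻ p i<m)

-- m is inserted after j in its cycle, and being maximal does not affect the orbit minima.
cyc-insert : ∀ {m g j} → Perm m g → j < m → cyc (suc m) (λ x → g (swap j m x)) ≡ cyc m g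
cyc-insert {m} {g} {j} p j<m = begin
  cyc (suc m) f                                     ≡⟨ cyc-split m f g agree ⟩
  cyc m g ℕ.+ indicator (orbitMin (suc m) f m)
    ≡⟨ cong (λ b → cyc m g ℕ.+ indicator b) (T-ext not-min ⊥-elim) ⟩
  cyc m g ℕ.+ 0                                     ≡⟨ ℕₚ.+-identityʳ _ ⟩
  cyc m g ∎
  where
  f : ℕ → ℕ
  f x = g (swap j m x)
  pf : Perm (suc m) f
  pf = perm-swap (perm-suc p) (ℕₚ.m<n⇒m<1+n j<m) (ℕₚ.n<1+n m)
  fm : f m ≡ g j
  fm = cong g (swap-r j m)
  fj : f j ≡ m
  fj = trans (cong g (swap-l j m)) (p .fix m ℕₚ.≤-refl)
  fo : ∀ {x} → x ≢ j → x ≢ m → f x ≡ g x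
  fo x≢j x≢m = cong g (swap-o j m x≢j x≢m)
  not-min : T (orbitMin (suc m) f m) → ⊥
  not-min h = ℕₚ.<⇒≱ (stable p j<m)
    (subst (m ≤_) fm (orbitMin⁻ pf (ℕₚ.n<1+n m) h 1))
  g-in-f : ∀ {i} → i < m → ∀ t → ∃ λ t′ → iter g t i ≡ iter f t′ i
  g-in-f i<m zero = 0 , refl
  g-in-f {i} i<m (suc t) with g-in-f i<m t
  ... | t′ , e with iter f t′ i ℕ.≟ j
  -- From j the orbit of `f` reaches `g j` only by way of m, which costs one more step.
  ...   | yes q = suc (suc t′) , (begin
            g (iter g t i)         ≡⟨ cong g (trans e q) ⟩
            g j                    ≡⟨ fm ⟨
            f m                    ≡⟨ cong f fj ⟨
            f (f j)                ≡⟨ cong (f ∘ f) q ⟨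
            f (f (iter f t′ i)) ∎)
  ...   | no q = suc t′ , trans (cong g e)
            (sym (fo q (λ eq → ℕₚ.<⇒≢ (iter-< p t i<m) (trans e eq))))
  -- The first alternative is the moment at which the orbit visits m; it remembers that j is on the
  -- orbit of `g`, so that the next step can return there.
  f-in-g : ∀ {i} → i < m → ∀ t →
           (iter f t i ≡ m × ∃ λ t′ → j ≡ iter g t′ i) ⊎ (∃ λ t′ → iter f t i ≡ iter g t′ i)
  f-in-g i<m zero = inj₂ (0 , refl)
  f-in-g {i} i<m (suc t) with f-in-g i<m t
  ... | inj₁ (e , t′ , e′) = inj₂ (suc t′ , trans (cong f e) (trans fm (cong g e′)))
  ... | inj₂ (t′ , e) with iter f t i ℕ.≟ j
  ...   | yes q = inj₁ (trans (cong f q) fj , t′ , trans (sym q) e)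
  ...   | no q  = inj₂ (suc t′ , trans (fo q (λ eq → ℕₚ.<⇒≢ (iter-< p t′ i<m) (trans (sym e) eq)))
                                       (cong g e))
  agree : ∀ i → i < m → orbitMin (suc m) f i ≡ orbitMin m g i
  agree i i<m = T-ext
    (λ h → orbitMin⁺ {m} λ t → let t′ , e = g-in-f i<m t in
       subst (i ≤_) (sym e) (orbitMin⁻ pf (ℕₚ.m<n⇒m<1+n i<m) h t′))
    (λ h → orbitMin⁺ {suc m} λ t → bound h t (f-in-g i<m t))
    where
    bound : T (orbitMin m g i) → ∀ t →
            (iter f t i ≡ m × ∃ λ t′ → j ≡ iter g t′ i) ⊎ (∃ λ t′ → iter f t i ≡ iter g t′ i) →
            i ≤ iter f t i
    bound h t (inj₁ (e , _))  = subst (i ≤_) (sym e) (ℕₚ.<⇒≤ i<m)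
    bound h t (inj₂ (t′ , e)) = subst (i ≤_) (sym e) (orbitMin⁻ p i<m h t′)

-- Words in the Jucys-Murphy elements and conditional expectation

χ : ℕ → ℕ → Φ
χ N m f = (+ N) ^ cyc m f

χ-ext : ∀ N m → Ext (χ N m)
χ-ext N m e = cong ((+ N) ^_) (cyc-ext m e)

-- A word lists the indices of a product of Jucys–Murphy elements.
Word : Set
Word = List ℕ

Pol : Set
Pol = List (ℤ × Word)

opW : Word → Φ → Φ
opW []      φ = φ
opW (i ∷ w) φ = X i i (opW w φ)

opP : Pol → Φ → Φ
opP p φ f = ∑ p (λ (k , w) → k * opW w φ f)

valW : (ℕ → ℤ) → Word → ℤ
valW c []      = + 1
valW c (i ∷ w) = c i * valW c w

valP : (ℕ → ℤ) → Pol → ℤ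
valP c p = ∑ p (λ (k , w) → k * valW c w)

times : ℕ → Pol → Pol
times n = map (λ (k , w) → (k , n ∷ w))

opP-times : ∀ n p φ f → opP (times n p) φ f ≡ X n n (opP p φ) f
opP-times n p φ f = begin
  ∑ (times n p) (λ (k , w) → k * opW w φ f)         ≡⟨ ∑-map _ p _ ⟩
  ∑ p (λ (k , w) → k * X n n (opW w φ) f)           ≡⟨ ∑-cong p (λ (k , w) → ∑<-* k n _) ⟨
  ∑ p (λ (k , w) → ∑< n (λ j → k * translate (swap j n) (opW w φ) f))
                                                    ≡⟨ ∑<-∑ n p _ ⟨
  X n n (opP p φ) f ∎

valP-times : ∀ n p c → valP c (times n p) ≡ c n * valP c p
valP-times n p c = begin
  ∑ (times n p) (λ (k , w) → k * valW c w)   ≡⟨ ∑-map _ p _ ⟩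
  ∑ p (λ (k , w) → k * (c n * valW c w))     ≡⟨ ∑-cong p (λ (k , w) → lem k (c n) (valW c w)) ⟩
  ∑ p (λ (k , w) → c n * (k * valW c w))     ≡⟨ ∑-* (c n) p _ ⟩
  c n * valP c p ∎
  where
  lem : ∀ a b d → a * (b * d) ≡ b * (a * d)
  lem = solve-∀

-- The conditional expectations of ς r, Yʳ s and Yʳ from Powers, where ζ is that of Zʳ.
sig bet alp : ℕ → (ℕ → Pol) → ℕ → Pol
sig n ζ zero    = []
sig n ζ (suc r) = times n (sig n ζ r) ++ bet n ζ r
bet n ζ zero    = [ + 1 , [] ]
bet n ζ (suc r) = times n (bet n ζ r) ++ alp n ζ r
alp n ζ r = ζ r ++ sig n ζ r

-- The conditional expectation of the powers of X n m, for the trace N ^ cyc.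
P : ℕ → ℕ → ℕ → Pol
P N zero    zero    = [ + N , [] ]
P N zero    (suc r) = []
P N (suc n)         = alp n (P N n)

perm-swap′ : ∀ {m f j n} → Perm m f → j < n → n < m → Perm m (λ x → f (swap j n x))
perm-swap′ p j<n n<m = perm-swap p (ℕₚ.<-trans j<n n<m) n<m

X-cong-perm : ∀ {m n φ ψ g} → (∀ {h} → Perm m h → φ h ≡ ψ h) → n < m → Perm m g →
              X n n φ g ≡ X n n ψ g
X-cong-perm {n = n} e n<m p = ∑<-cong n (λ j j<n → e (perm-swap′ p j<n n<m))

-- The transpositions (j n) belong to Sₘ and are moved past (l m), after which (l m) merely inserts
-- m into a cycle. The move replaces l by its image under (j n), hence the statement for every l <
-- m. With l = n it says that the expectation of s xʳ is xʳ.
pow-χ-insert : ∀ N {m n l g} r → Perm m g → l < m → n < m →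
               pow (X n n) r (χ N (suc m)) (λ x → g (swap l m x)) ≡ pow (X n n) r (χ N m) g
pow-χ-insert N zero    p l<m n<m = cong ((+ N) ^_) (cyc-insert p l<m)
pow-χ-insert N {m} {n} {l} {g} (suc r) p l<m n<m = ∑<-cong n λ j j<n → begin
  pow (X n n) r (χ N (suc m)) (λ x → g (swap l m (swap j n x)))
    ≡⟨ pow-ext r (λ x → cong g (move j j<n x)) ⟩
  pow (X n n) r (χ N (suc m)) (λ x → g (swap j n (swap (swap j n l) m x)))
    ≡⟨ pow-χ-insert N r (perm-swap′ p j<n n<m) (swap-< (ℕₚ.<-trans j<n n<m) n<m l<m) n<m ⟩
  pow (X n n) r (χ N m) (λ x → g (swap j n x)) ∎
  where
  pow-ext : ∀ r → Ext (pow (X n n) r (χ N (suc m)))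
  pow-ext zero    = χ-ext N (suc m)
  pow-ext (suc r) = X-ext n n (pow-ext r)
  move : ∀ j → j < n → ∀ x → swap l m (swap j n x) ≡ swap j n (swap (swap j n l) m x)
  move j j<n x = sym (begin
    τ (swap (τ l) m x)          ≡⟨ swap-conj τ (swap-inj j n) (τ l) m x ⟩
    swap (τ (τ l)) (τ m) (τ x)
      ≡⟨ cong₂ (λ a b → swap a b (τ x)) (swap-involutive j n l)
           (swap-≥ (ℕₚ.<-trans j<n n<m) n<m ℕₚ.≤-refl) ⟩
    swap l m (τ x) ∎)
    where τ = swap j n

module _ (N n m : ℕ) (n<m : n < m) (ζ : ℕ → Pol)
  (ih : ∀ r {g} → Perm m g → pow (X n m) r (χ N (suc m)) g ≡ opP (ζ r) (χ N m) g) where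

  open Powers n m n<m

  private
    χ⁺ = χ N (suc m)
    e⁺ = χ-ext N (suc m)

  mutual

    ς-χ : ∀ r {g} → Perm m g → ς r χ⁺ g ≡ opP (sig n ζ r) (χ N m) g
    ς-χ zero    p = refl
    ς-χ (suc r) {g} p = sym (begin
      opP (times n (sig n ζ r) ++ bet n ζ r) (χ N m) g ≡⟨ ∑-++ (times n (sig n ζ r)) _ _ ⟩
      opP (times n (sig n ζ r)) (χ N m) g + opP (bet n ζ r) (χ N m) g
        ≡⟨ cong₂ _+_ (trans (opP-times n (sig n ζ r) (χ N m) g)
                            (X-cong-perm (sym ∘ ς-χ r) n<m p))
                     (sym (Y^s-χ r p)) ⟩
      x (ς r χ⁺) g + pow Y r (s χ⁺) g ∎)

    Y^s-χ : ∀ r {g} → Perm m g → pow Y r (s χ⁺) g ≡ opP (bet n ζ r) (χ N m) g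
    Y^s-χ zero    {g} p = begin
      χ⁺ (λ y → g (swap n m y))           ≡⟨ cong ((+ N) ^_) (cyc-insert p n<m) ⟩
      χ N m g                             ≡⟨ lem (χ N m g) ⟩
      + 1 * χ N m g + + 0 ∎
      where
      lem : ∀ a → a ≡ + 1 * a + + 0
      lem = solve-∀
    Y^s-χ (suc r) {g} p = sym (begin
      opP (times n (bet n ζ r) ++ alp n ζ r) (χ N m) g ≡⟨ ∑-++ (times n (bet n ζ r)) _ _ ⟩
      opP (times n (bet n ζ r)) (χ N m) g + opP (alp n ζ r) (χ N m) g
        ≡⟨ cong₂ _+_ (trans (opP-times n (bet n ζ r) (χ N m) g)
                            (X-cong-perm (sym ∘ Y^s-χ r) n<m p))
                     (sym (Y^-χ r p)) ⟩
      x (pow Y r (s χ⁺)) g + pow Y r χ⁺ g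
        ≡⟨ cong (_+ pow Y r χ⁺ g) (trans (X-cong n n (Y^s r e⁺) g) (X-⊹ n n (s (pow x r χ⁺)) (ω r χ⁺) g)) ⟩
      x (s (pow x r χ⁺)) g + x (ω r χ⁺) g + pow Y r χ⁺ g
        -- As operators x s xʳ and s xʳ⁺¹ differ, but the expectation removes s from both and leaves
        -- xʳ⁺¹ in either case.
        ≡⟨ cong (λ z → z + x (ω r χ⁺) g + pow Y r χ⁺ g)
             (trans (X-cong-perm (λ q → pow-χ-insert N r q n<m n<m) n<m p)
                    (sym (pow-χ-insert N (suc r) p n<m n<m))) ⟩
      s (pow x (suc r) χ⁺) g + x (ω r χ⁺) g + pow Y r χ⁺ g
        ≡⟨ ℤₚ.+-assoc (s (pow x (suc r) χ⁺) g) _ _ ⟩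
      s (pow x (suc r) χ⁺) g + ω (suc r) χ⁺ g
        ≡⟨ Y^s (suc r) e⁺ g ⟨
      pow Y (suc r) (s χ⁺) g ∎)

    -- In series in 1/z let G, A, B, S belong to Zʳ, Yʳ, Yʳ s and `ς r`. The three recursions read A
    -- = G + S, (z - x) B = 1 + A and (z - x) S = B, whence (1 + A)(1 - (z - x)⁻²) = 1 + G.
    Y^-χ : ∀ r {g} → Perm m g → pow Y r χ⁺ g ≡ opP (alp n ζ r) (χ N m) g
    Y^-χ r {g} p = begin
      pow Y r χ⁺ g                        ≡⟨ Y^≐ r e⁺ g ⟩
      pow Z r χ⁺ g + ς r χ⁺ g             ≡⟨ cong₂ _+_ (ih r p) (ς-χ r p) ⟩
      opP (ζ r) (χ N m) g + opP (sig n ζ r) (χ N m) g ≡⟨ ∑-++ (ζ r) _ _ ⟨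
      opP (alp n ζ r) (χ N m) g ∎

-- The induction raises n with m fixed: `X n m` is the Jucys-Murphy element of a copy of the
-- symmetric group on the points below n together with m. At n = 0 the sum is empty, and only its
-- zeroth power survives.
pow-χ : ∀ N n m → n ≤ m → ∀ r {g} → Perm m g →
        pow (X n m) r (χ N (suc m)) g ≡ opP (P N n r) (χ N m) g
pow-χ N zero    m n≤m zero    {g} p = trans (cong ((+ N) ^_) (cyc-fixed p)) (sym (ℤₚ.+-identityʳ _))
pow-χ N zero    m n≤m (suc r) p = refl
pow-χ N (suc n) m n<m = Y^-χ N n m n<m (P N n) (pow-χ N n m (ℕₚ.<⇒≤ n<m))

-- Splitting off the largest Jucys-Murphy element of a word

Below : ℕ → Word → Set
Below m = All (_< m)

count : ℕ → Word → ℕ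
count m []      = 0
count m (i ∷ w) with i ℕ.≟ m
... | yes _ = suc (count m w)
... | no  _ = count m w

rest : ℕ → Word → Word
rest m []      = []
rest m (i ∷ w) with i ℕ.≟ m
... | yes _ = rest m w
... | no  _ = i ∷ rest m w

rest-below : ∀ m w → Below (suc m) w → Below m (rest m w)
rest-below m []      []         = []
rest-below m (i ∷ w) (i< ∷ w<) with i ℕ.≟ m
... | yes _  = rest-below m w w<
... | no i≢m = ℕₚ.≤∧≢⇒< (ℕₚ.≤-pred i<) i≢m ∷ rest-below m w w<

valW-rest : ∀ m w c → valW c w ≡ valW c (rest m w) * c m ^ count m w
valW-rest m []      c = refl
valW-rest m (i ∷ w) c with i ℕ.≟ m
... | yes refl = trans (cong (c m *_) (valW-rest m w c)) (lem (c m) (valW c (rest m w)) (c m ^ count m w))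
  where
  lem : ∀ a b d → a * (b * d) ≡ b * (a * d)
  lem = solve-∀
... | no _ = trans (cong (c i *_) (valW-rest m w c)) (sym (ℤₚ.*-assoc (c i) (valW c (rest m w)) (c m ^ count m w)))

valW-++ : ∀ c u w → valW c (u ++ w) ≡ valW c u * valW c w
valW-++ c []      w = sym (ℤₚ.*-identityˡ _)
valW-++ c (i ∷ u) w = trans (cong (c i *_) (valW-++ c u w)) (sym (ℤₚ.*-assoc (c i) _ _))

valW-cong : ∀ {m c d} w → Below m w → (∀ i → i < m → c i ≡ d i) → valW c w ≡ valW d w
valW-cong []      []         e = refl
valW-cong (i ∷ w) (i< ∷ w<) e = cong₂ _*_ (e i i<) (valW-cong w w< e)

opW-ext : ∀ w {φ} → Ext φ → Ext (opW w φ)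
opW-ext []      e = e
opW-ext (i ∷ w) e = X-ext i i (opW-ext w e)

opW-J : ∀ m w {φ} → Below m w → Ext φ → X m m (opW w φ) ≐ opW w (X m m φ)
opW-J m []      []         e f = refl
opW-J m (i ∷ w) (i< ∷ w<) e f =
  trans (sym (X-comm i i m m (opW-ext w e) ℕₚ.≤-refl i< ℕₚ.≤-refl f)) (X-cong i i (opW-J m w w< e) f)

J^-ext : ∀ m r {φ} → Ext φ → Ext (pow (X m m) r φ)
J^-ext m zero    e = e
J^-ext m (suc r) e = X-ext m m (J^-ext m r e)

-- Commutation collects all factors of index m next to φ, which is where the expectation can act on
-- them.
opW-rest : ∀ m w {φ} → Below (suc m) w → Ext φ →
           opW w φ ≐ opW (rest m w) (pow (X m m) (count m w) φ)
opW-rest m []      []        e f = refl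
opW-rest m (i ∷ w) (i< ∷ w<) e f with i ℕ.≟ m
... | yes refl = trans (X-cong m m (opW-rest m w w< e) f)
                       (opW-J m (rest m w) (rest-below m w w<) (J^-ext m (count m w) e) f)
... | no _     = X-cong i i (opW-rest m w w< e) f

opW-cong-perm : ∀ {m} w {φ ψ} → Below m w → (∀ {g} → Perm m g → φ g ≡ ψ g) →
                ∀ {g} → Perm m g → opW w φ g ≡ opW w ψ g
opW-cong-perm []      []         e p = e p
opW-cong-perm (i ∷ w) (i< ∷ w<) e p = X-cong-perm (opW-cong-perm w w< e) i< p

opW-opP : ∀ u p φ f → opW u (opP p φ) f ≡ ∑ p (λ (k , w) → k * opW (u ++ w) φ f)
opW-opP []      p φ f = refl
opW-opP (i ∷ u) p φ f = begin
  X i i (opW u (opP p φ)) f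
    ≡⟨ X-cong i i (opW-opP u p φ) f ⟩
  ∑< i (λ j → ∑ p (λ (k , w) → k * translate (swap j i) (opW (u ++ w) φ) f))
    ≡⟨ ∑<-∑ i p _ ⟩
  ∑ p (λ (k , w) → ∑< i (λ j → k * translate (swap j i) (opW (u ++ w) φ) f))
    ≡⟨ ∑-cong p (λ (k , w) → ∑<-* k i _) ⟩
  ∑ p (λ (k , w) → k * opW (i ∷ u ++ w) φ f) ∎

-- The rest of the word has indices below m, so starting from the identity it evaluates its argument
-- on Sₘ only, as `pow-χ` demands.
opW-reduce : ∀ N m w → Below (suc m) w →
             opW w (χ N (suc m)) id ≡
             ∑ (P N m (count m w)) (λ (k , v) → k * opW (rest m w ++ v) (χ N m) id)
opW-reduce N m w w< = begin
  opW w (χ N (suc m)) id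
    ≡⟨ opW-rest m w w< (χ-ext N (suc m)) id ⟩
  opW (rest m w) (pow (X m m) (count m w) (χ N (suc m))) id
    ≡⟨ opW-cong-perm (rest m w) (rest-below m w w<) (pow-χ N m m ℕₚ.≤-refl (count m w)) perm-id ⟩
  opW (rest m w) (opP (P N m (count m w)) (χ N m)) id
    ≡⟨ opW-opP (rest m w) (P N m (count m w)) (χ N m) id ⟩
  _ ∎

BelowP : ℕ → Pol → Set
BelowP m = All (λ (k , w) → Below m w)

times-below : ∀ {m n p} → n < m → BelowP m p → BelowP m (times n p)
times-below n<m = Allₚ.map⁺ ∘ All.map (n<m ∷_)

mutual

  sig-below : ∀ {n ζ} → (∀ r → BelowP (suc n) (ζ r)) → ∀ r → BelowP (suc n) (sig n ζ r)
  sig-below h zero    = []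
  sig-below h (suc r) = Allₚ.++⁺ (times-below (ℕₚ.n<1+n _) (sig-below h r)) (bet-below h r)

  bet-below : ∀ {n ζ} → (∀ r → BelowP (suc n) (ζ r)) → ∀ r → BelowP (suc n) (bet n ζ r)
  bet-below h zero    = [] ∷ []
  bet-below h (suc r) = Allₚ.++⁺ (times-below (ℕₚ.n<1+n _) (bet-below h r)) (alp-below h r)

  alp-below : ∀ {n ζ} → (∀ r → BelowP (suc n) (ζ r)) → ∀ r → BelowP (suc n) (alp n ζ r)
  alp-below h r = Allₚ.++⁺ (h r) (sig-below h r)

P-below : ∀ N n r → BelowP n (P N n r)
P-below N zero    zero    = [] ∷ []
P-below N zero    (suc r) = []
P-below N (suc n) = alp-below (λ r → All.map (All.map ℕₚ.m<n⇒m<1+n) (P-below N n r))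

-- Vandermonde products under unit steps

q : ℤ → List ℤ → ℤ
q x []       = + 1
q x (y ∷ ys) = (x - y) * q x ys

Δ : List ℤ → ℤ
Δ []       = + 1
Δ (x ∷ xs) = q x xs * Δ xs

-- (b , l , o): the entry b, the list with b replaced by b + h, and the list with b omitted
Bump : Set
Bump = ℤ × List ℤ × List ℤ

consBump : ℤ → Bump → Bump
consBump x (b , l , o) = (b , x ∷ l , x ∷ o)

bumps : ℤ → List ℤ → List Bump
bumps h []       = []
bumps h (x ∷ xs) = (x , x + h ∷ xs , xs) ∷ map (consBump x) (bumps h xs)

q-omit : ∀ h xs {b l o} → (b , l , o) ∈ bumps h xs → ∀ x → q x xs ≡ (x - b) * q x o
q-omit h (y ∷ ys) (here refl) x = refl
q-omit h (y ∷ ys) (there p)   x with ∈-map⁻ (consBump y) p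
... | (b , l , o) , p′ , refl = trans (cong ((x - y) *_) (q-omit h ys p′ x)) (lem (x - y) (x - b) (q x o))
  where
  lem : ∀ a b d → a * (b * d) ≡ b * (a * d)
  lem = solve-∀

q-bump : ∀ h xs {b l o} → (b , l , o) ∈ bumps h xs → ∀ x → q x l ≡ q x xs - h * q x o
q-bump h (y ∷ ys) (here refl) x = lem x y h (q x ys)
  where
  lem : ∀ x y h u → (x - (y + h)) * u ≡ (x - y) * u - h * u
  lem = solve-∀
q-bump h (y ∷ ys) (there p)   x with ∈-map⁻ (consBump y) p
... | (b , l , o) , p′ , refl = trans (cong ((x - y) *_) (q-bump h ys p′ x)) (lem (x - y) (q x ys) h (q x o))
  where
  lem : ∀ a u h v → a * (u - h * v) ≡ a * u - h * (a * v)
  lem = solve-∀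

∑q : ℤ → ℤ → List ℤ → ℤ
∑q h x xs = ∑ (bumps h xs) (λ (b , l , o) → q x o * Δ l)

-- The discrete derivative of q, by (x − y) qᵢ(x) qᵢ(y) = q(x) qᵢ(y) − qᵢ(x) q(y).
∑q-difference : ∀ h xs x → h * ∑q h x xs ≡ Δ xs * (q (x + h) xs - q x xs)
∑q-difference h []       x = ℤₚ.*-zeroʳ h
∑q-difference h (y ∷ ys) x = begin
  h * (q x ys * (q (y + h) ys * Δ ys) + ∑ (map (consBump y) (bumps h ys)) (λ (b , l , o) → q x o * Δ l))
    ≡⟨ cong (λ z → h * (q x ys * (q (y + h) ys * Δ ys) + z)) tail ⟩
  h * (q x ys * (q (y + h) ys * Δ ys) + (((x - y) + h) * q y ys * ∑q h x ys + (- h * q x ys) * ∑q h y ys))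
    ≡⟨ lem₁ h (q x ys) (q (y + h) ys) (Δ ys) (x - y) (q y ys) (∑q h x ys) (∑q h y ys) ⟩
  h * (q x ys * (q (y + h) ys * Δ ys)) + (((x - y) + h) * q y ys * (h * ∑q h x ys) + (- h * q x ys) * (h * ∑q h y ys))
    ≡⟨ cong₂ (λ a b → h * (q x ys * (q (y + h) ys * Δ ys)) + (((x - y) + h) * q y ys * a + (- h * q x ys) * b))
         (∑q-difference h ys x) (∑q-difference h ys y) ⟩
  h * (q x ys * (q (y + h) ys * Δ ys))
    + (((x - y) + h) * q y ys * (Δ ys * (q (x + h) ys - q x ys)) + (- h * q x ys) * (Δ ys * (q (y + h) ys - q y ys)))
    ≡⟨ lem₂ h x y (q x ys) (q (y + h) ys) (Δ ys) (q y ys) (q (x + h) ys) ⟩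
  q y ys * Δ ys * ((x + h - y) * q (x + h) ys - (x - y) * q x ys) ∎
  where
  lem₁ : ∀ h a b d e f u v → h * (a * (b * d) + ((e + h) * f * u + (- h * a) * v))
         ≡ h * (a * (b * d)) + ((e + h) * f * (h * u) + (- h * a) * (h * v))
  lem₁ = solve-∀
  lem₂ : ∀ h x y a b d f g → h * (a * (b * d))
           + (((x - y) + h) * f * (d * (g - a)) + (- h * a) * (d * (b - f)))
         ≡ f * d * ((x + h - y) * g - (x - y) * a)
  lem₂ = solve-∀
  lem₃ : ∀ x y h b u v d → (x - y) * u * (((y - b) * v - h * v) * d)
         ≡ ((x - y) + h) * ((y - b) * v) * (u * d) + (- h * ((x - b) * u)) * (v * d)
  lem₃ = solve-∀
  tail : ∑ (map (consBump y) (bumps h ys)) (λ (b , l , o) → q x o * Δ l) ≡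
         ((x - y) + h) * q y ys * ∑q h x ys + (- h * q x ys) * ∑q h y ys
  tail = begin
    ∑ (map (consBump y) (bumps h ys)) (λ (b , l , o) → q x o * Δ l)
      ≡⟨ ∑-map (consBump y) (bumps h ys) _ ⟩
    ∑ (bumps h ys) (λ (b , l , o) → (x - y) * q x o * (q y l * Δ l))
      ≡⟨ ∑-cong∈ (bumps h ys) (λ (b , l , o) i → trans
           (cong (λ z → (x - y) * q x o * (z * Δ l)) (trans (q-bump h ys i y) (cong (_- h * q y o) (q-omit h ys i y))))
           (trans (lem₃ x y h b (q x o) (q y o) (Δ l))
             (sym (cong₂ (λ u v → ((x - y) + h) * u * (q x o * Δ l) + (- h * v) * (q y o * Δ l))
                     (q-omit h ys i y) (q-omit h ys i x))))) ⟩
    ∑ (bumps h ys) (λ (b , l , o) → ((x - y) + h) * q y ys * (q x o * Δ l) + (- h * q x ys) * (q y o * Δ l))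
      ≡⟨ ∑-+ (bumps h ys) (λ (b , l , o) → ((x - y) + h) * q y ys * (q x o * Δ l)) _ ⟩
    _ ≡⟨ cong₂ _+_ (∑-* (((x - y) + h) * q y ys) (bumps h ys) _) (∑-* (- h * q x ys) (bumps h ys) _) ⟩
    ((x - y) + h) * q y ys * ∑q h x ys + (- h * q x ys) * ∑q h y ys ∎

-- M h xs r is the coefficient of z^(-r-1) in h⁻¹ (∏ (1 + h / (z - x)) - 1).

τ : ℤ → ℤ → (ℕ → ℤ) → ℕ → ℤ
τ h x m zero    = + 1
τ h x m (suc r) = x * τ h x m r + h * m r

-- If G is the series with coefficients m, then τ collects those of (1 + hG)/(z - x), which is
-- exactly what a further factor 1 + h/(z - x) adds to G.
grow : ℤ → ℤ → (ℕ → ℤ) → ℕ → ℤ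
grow h x m r = m r + τ h x m r

M : ℤ → List ℤ → ℕ → ℤ
M h []       r = + 0
M h (x ∷ xs) r = grow h x (M h xs) r

-- Partial fractions in a form without division, valid also when entries coincide. A step in the
-- tail changes q(x) by -h times the product over the other entries; `C` sums these corrections, and
-- the contribution of the head x minus h C satisfies the recursion of τ, starting from the discrete
-- derivative of q.
∑-bumps : ∀ h xs r → ∑ (bumps h xs) (λ (b , l , o) → b ^ r * Δ l) ≡ Δ xs * M h xs r
∑-bumps h []       r = refl
∑-bumps h (x ∷ xs) r = begin
  x ^ r * (q (x + h) xs * Δ xs) + ∑ (map (consBump x) (bumps h xs)) (λ (b , l , o) → b ^ r * Δ l)
    ≡⟨ cong (_+_ (x ^ r * (q (x + h) xs * Δ xs))) tail ⟩
  x ^ r * (q (x + h) xs * Δ xs) + (q x xs * (Δ xs * M h xs r) + - h * C r)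
    ≡⟨ lem₁ (x ^ r * (q (x + h) xs * Δ xs)) (q x xs) (Δ xs) (M h xs r) h (C r) ⟩
  q x xs * Δ xs * M h xs r + (x ^ r * (q (x + h) xs * Δ xs) - h * C r)
    ≡⟨ cong (_+_ (q x xs * Δ xs * M h xs r)) (claim r) ⟩
  q x xs * Δ xs * M h xs r + q x xs * Δ xs * τ h x (M h xs) r
    ≡⟨ ℤₚ.*-distribˡ-+ (q x xs * Δ xs) (M h xs r) (τ h x (M h xs) r) ⟨
  q x xs * Δ xs * (M h xs r + τ h x (M h xs) r) ∎
  where
  C : ℕ → ℤ
  C r = ∑ (bumps h xs) (λ (b , l , o) → b ^ r * (q x o * Δ l))

  lem₁ : ∀ a b d m h c → a + (b * (d * m) + - h * c) ≡ b * d * m + (a - h * c)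
  lem₁ = solve-∀
  lem₂ : ∀ p a h u d → p * ((a - h * u) * d) ≡ a * (p * d) + - h * (p * (u * d))
  lem₂ = solve-∀
  lem₃ : ∀ x b p u d → b * p * (u * d) ≡ x * (p * (u * d)) + - (+ 1) * ((x - b) * u * (p * d))
  lem₃ = solve-∀
  lem₄ : ∀ d g a → + 1 * (g * d) - d * (g - a) ≡ a * d * + 1
  lem₄ = solve-∀
  lem₅ : ∀ x p g d h c a m → x * p * (g * d) - h * (x * c + - (+ 1) * (a * (d * m)))
         ≡ x * (p * (g * d) - h * c) + a * d * (h * m)
  lem₅ = solve-∀
  lem₆ : ∀ x a d t h m → x * (a * d * t) + a * d * (h * m) ≡ a * d * (x * t + h * m)
  lem₆ = solve-∀

  tail : ∑ (map (consBump x) (bumps h xs)) (λ (b , l , o) → b ^ r * Δ l) ≡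
         q x xs * (Δ xs * M h xs r) + - h * C r
  tail = begin
    ∑ (map (consBump x) (bumps h xs)) (λ (b , l , o) → b ^ r * Δ l)
      ≡⟨ ∑-map (consBump x) (bumps h xs) _ ⟩
    ∑ (bumps h xs) (λ (b , l , o) → b ^ r * (q x l * Δ l))
      ≡⟨ ∑-cong∈ (bumps h xs) (λ (b , l , o) i → trans
           (cong (λ z → b ^ r * (z * Δ l)) (q-bump h xs i x)) (lem₂ (b ^ r) (q x xs) h (q x o) (Δ l))) ⟩
    ∑ (bumps h xs) (λ (b , l , o) → q x xs * (b ^ r * Δ l) + - h * (b ^ r * (q x o * Δ l)))
      ≡⟨ ∑-+ (bumps h xs) (λ (b , l , o) → q x xs * (b ^ r * Δ l)) _ ⟩
    _ ≡⟨ cong₂ _+_ (∑-* (q x xs) (bumps h xs) _) (∑-* (- h) (bumps h xs) _) ⟩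
    q x xs * ∑ (bumps h xs) (λ (b , l , o) → b ^ r * Δ l) + - h * C r
      ≡⟨ cong (λ z → q x xs * z + - h * C r) (∑-bumps h xs r) ⟩
    q x xs * (Δ xs * M h xs r) + - h * C r ∎

  -- One factor b is written as x - (x - b), and x - b restores the factor that q(x) omits.
  C-suc : ∀ r → C (suc r) ≡ x * C r + - (+ 1) * (q x xs * (Δ xs * M h xs r))
  C-suc r = begin
    ∑ (bumps h xs) (λ (b , l , o) → b * b ^ r * (q x o * Δ l))
      ≡⟨ ∑-cong∈ (bumps h xs) (λ (b , l , o) i → trans (lem₃ x b (b ^ r) (q x o) (Δ l))
           (cong (λ z → x * (b ^ r * (q x o * Δ l)) + - (+ 1) * (z * (b ^ r * Δ l))) (sym (q-omit h xs i x)))) ⟩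
    ∑ (bumps h xs) (λ (b , l , o) → x * (b ^ r * (q x o * Δ l)) + - (+ 1) * (q x xs * (b ^ r * Δ l)))
      ≡⟨ ∑-+ (bumps h xs) (λ (b , l , o) → x * (b ^ r * (q x o * Δ l))) _ ⟩
    _ ≡⟨ cong₂ _+_ (∑-* x (bumps h xs) _)
          (trans (∑-* (- (+ 1)) (bumps h xs) _)
                 (cong (- (+ 1) *_) (trans (∑-* (q x xs) (bumps h xs) _) (cong (q x xs *_) (∑-bumps h xs r))))) ⟩
    x * C r + - (+ 1) * (q x xs * (Δ xs * M h xs r)) ∎

  C-zero : h * C 0 ≡ Δ xs * (q (x + h) xs - q x xs)
  C-zero = trans (cong (h *_) (∑-cong (bumps h xs) (λ (b , l , o) → ℤₚ.*-identityˡ _))) (∑q-difference h xs x)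

  claim : ∀ r → x ^ r * (q (x + h) xs * Δ xs) - h * C r ≡ q x xs * Δ xs * τ h x (M h xs) r
  claim zero    = trans (cong (λ z → + 1 * (q (x + h) xs * Δ xs) - z) C-zero)
                        (lem₄ (Δ xs) (q (x + h) xs) (q x xs))
  claim (suc r) = begin
    x * x ^ r * (q (x + h) xs * Δ xs) - h * C (suc r)
      ≡⟨ cong (λ z → x * x ^ r * (q (x + h) xs * Δ xs) - h * z) (C-suc r) ⟩
    x * x ^ r * (q (x + h) xs * Δ xs) - h * (x * C r + - (+ 1) * (q x xs * (Δ xs * M h xs r)))
      ≡⟨ lem₅ x (x ^ r) (q (x + h) xs) (Δ xs) h (C r) (q x xs) (M h xs r) ⟩
    x * (x ^ r * (q (x + h) xs * Δ xs) - h * C r) + q x xs * Δ xs * (h * M h xs r)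
      ≡⟨ cong (λ z → x * z + q x xs * Δ xs * (h * M h xs r)) (claim r) ⟩
    x * (q x xs * Δ xs * τ h x (M h xs) r) + q x xs * Δ xs * (h * M h xs r)
      ≡⟨ lem₆ x (q x xs) (Δ xs) (τ h x (M h xs) r) h (M h xs r) ⟩
    q x xs * Δ xs * τ h x (M h xs) (suc r) ∎

τ-cong : ∀ h x {m m′} → (∀ r → m r ≡ m′ r) → ∀ r → τ h x m r ≡ τ h x m′ r
τ-cong h x e zero    = refl
τ-cong h x e (suc r) = cong₂ (λ a b → x * a + h * b) (τ-cong h x e r) (e r)

-- This is (x - y)/((z - x)(z - y)) = 1/(z - x) - 1/(z - y), multiplied by h(1 + hG).
τ-grow : ∀ h x y m r → (x - y) * (τ h x (grow h y m) r - τ h x m r) ≡ h * (τ h x m r - τ h y m r)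
τ-grow h x y m zero    = lem h (x - y)
  where
  lem : ∀ h a → a * (+ 1 - + 1) ≡ h * (+ 1 - + 1)
  lem = solve-∀
τ-grow h x y m (suc r) = begin
  (x - y) * (x * a + h * (m r + b) - (x * c + h * m r)) ≡⟨ lem₁ x y h a b c (m r) ⟩
  x * ((x - y) * (a - c)) + (x - y) * (h * b)           ≡⟨ cong (λ z → x * z + (x - y) * (h * b)) (τ-grow h x y m r) ⟩
  x * (h * (c - b)) + (x - y) * (h * b)                 ≡⟨ lem₂ x y h b c (m r) ⟩
  h * (x * c + h * m r - (y * b + h * m r)) ∎
  where
  a = τ h x (grow h y m) r
  b = τ h y m r
  c = τ h x m r
  lem₁ : ∀ x y h a b c m → (x - y) * (x * a + h * (m + b) - (x * c + h * m))
         ≡ x * ((x - y) * (a - c)) + (x - y) * (h * b)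
  lem₁ = solve-∀
  lem₂ : ∀ x y h b c m → x * (h * (c - b)) + (x - y) * (h * b) ≡ h * (x * c + h * m - (y * b + h * m))
  lem₂ = solve-∀

-- Both differences are coefficients of h(1 + hG)/((z - x)(z - y)). As x and y may be equal, the
-- factor x - y of `τ-grow` is never cancelled but absorbed in the induction by x = y + (x - y).
τ-grow-symmetric : ∀ h x y m r → τ h x (grow h y m) r - τ h x m r ≡ τ h y (grow h x m) r - τ h y m r
τ-grow-symmetric h x y m zero    = refl
τ-grow-symmetric h x y m (suc r) = begin
  x * a + h * (m r + b) - (x * c + h * m r)      ≡⟨ lem₁ x y h a b c (m r) ⟩
  y * (a - c) + (x - y) * (a - c) + h * b        ≡⟨ cong₂ (λ u v → y * u + v + h * b) (τ-grow-symmetric h x y m r) (τ-grow h x y m r) ⟩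
  y * (d - b) + h * (c - b) + h * b              ≡⟨ lem₂ y h b c d (m r) ⟩
  y * d + h * (m r + c) - (y * b + h * m r) ∎
  where
  a = τ h x (grow h y m) r
  b = τ h y m r
  c = τ h x m r
  d = τ h y (grow h x m) r
  lem₁ : ∀ x y h a b c m → x * a + h * (m + b) - (x * c + h * m) ≡ y * (a - c) + (x - y) * (a - c) + h * b
  lem₁ = solve-∀
  lem₂ : ∀ y h b c d m → y * (d - b) + h * (c - b) + h * b ≡ y * d + h * (m + c) - (y * b + h * m)
  lem₂ = solve-∀

grow-comm : ∀ h x y m r → grow h x (grow h y m) r ≡ grow h y (grow h x m) r
grow-comm h x y m r = begin
  m r + b + a                 ≡⟨ lem (m r) a b c ⟩
  m r + b + c + (a - c)       ≡⟨ cong (_+_ (m r + b + c)) (τ-grow-symmetric h x y m r) ⟩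
  m r + b + c + (d - b)       ≡⟨ lem′ (m r) b c d ⟩
  m r + c + d ∎
  where
  a = τ h x (grow h y m) r
  b = τ h y m r
  c = τ h x m r
  d = τ h y (grow h x m) r
  lem : ∀ m a b c → m + b + a ≡ m + b + c + (a - c)
  lem = solve-∀
  lem′ : ∀ m b c d → m + b + c + (d - b) ≡ m + c + d
  lem′ = solve-∀

grow-cong : ∀ h x {m m′} → (∀ r → m r ≡ m′ r) → ∀ r → grow h x m r ≡ grow h x m′ r
grow-cong h x e r = cong₂ _+_ (e r) (τ-cong h x e r)

-- The product behind `M` is symmetric in its factors, so that any entry can be made the outermost
-- one.
M-omit : ∀ h k xs {b l o} → (b , l , o) ∈ bumps k xs → ∀ r → M h xs r ≡ grow h b (M h o) r
M-omit h k (y ∷ ys) (here refl) r = refl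
M-omit h k (y ∷ ys) (there p)   r with ∈-map⁻ (consBump y) p
... | (b , l , o) , p′ , refl = trans (grow-cong h y (M-omit h k ys p′) r) (grow-comm h y b (M h o) r)

M-bump : ∀ h k xs {b l o} → (b , l , o) ∈ bumps k xs → ∀ r → M h l r ≡ grow h (b + k) (M h o) r
M-bump h k (y ∷ ys) (here refl) r = refl
M-bump h k (y ∷ ys) (there p)   r with ∈-map⁻ (consBump y) p
... | (b , l , o) , p′ , refl = trans (grow-cong h y (M-bump h k ys p′) r) (grow-comm h y (b + k) (M h o) r)

-- The moments change under a unit step by the recursion that defines P.
module _ (n : ℕ) (c : ℕ → ℤ) (ζ : ℕ → Pol) (m : ℕ → ℤ)
  (ih : ∀ r → valP c (ζ r) ≡ grow (+ 1) (c n) m r) where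

  private
    t  = τ (+ 1) (c n) m
    t⁺ = τ (+ 1) (c n + + 1) m

  mutual

    -- With x = `c n` and G the series of m, `t` and `t⁺` belong to (1 + G)/(z - x) and (1 + G)/(z -
    -- x - 1). Their difference is the latter divided by z - x, in accordance with the recursion of
    -- `sig`.
    sig-val : ∀ r → valP c (sig n ζ r) ≡ t⁺ r - t r
    sig-val zero    = refl
    sig-val (suc r) = begin
      valP c (times n (sig n ζ r) ++ bet n ζ r)    ≡⟨ ∑-++ (times n (sig n ζ r)) _ _ ⟩
      valP c (times n (sig n ζ r)) + valP c (bet n ζ r)
        ≡⟨ cong₂ _+_ (trans (valP-times n (sig n ζ r) c) (cong (c n *_) (sig-val r))) (bet-val r) ⟩
      c n * (t⁺ r - t r) + t⁺ r                    ≡⟨ lem (c n) (t⁺ r) (t r) (m r) ⟩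
      (c n + + 1) * t⁺ r + + 1 * m r - (c n * t r + + 1 * m r) ∎
      where
      lem : ∀ x a b m → x * (a - b) + a ≡ (x + + 1) * a + + 1 * m - (x * b + + 1 * m)
      lem = solve-∀

    bet-val : ∀ r → valP c (bet n ζ r) ≡ t⁺ r
    bet-val zero    = refl
    bet-val (suc r) = begin
      valP c (times n (bet n ζ r) ++ alp n ζ r)    ≡⟨ ∑-++ (times n (bet n ζ r)) _ _ ⟩
      valP c (times n (bet n ζ r)) + valP c (alp n ζ r)
        ≡⟨ cong₂ _+_ (trans (valP-times n (bet n ζ r) c) (cong (c n *_) (bet-val r))) (alp-val r) ⟩
      c n * t⁺ r + (m r + t⁺ r)                    ≡⟨ lem (c n) (t⁺ r) (m r) ⟩
      (c n + + 1) * t⁺ r + + 1 * m r ∎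
      where
      lem : ∀ x a m → x * a + (m + a) ≡ (x + + 1) * a + + 1 * m
      lem = solve-∀

    alp-val : ∀ r → valP c (alp n ζ r) ≡ grow (+ 1) (c n + + 1) m r
    alp-val r = begin
      valP c (ζ r ++ sig n ζ r)                    ≡⟨ ∑-++ (ζ r) _ _ ⟩
      valP c (ζ r) + valP c (sig n ζ r)            ≡⟨ cong₂ _+_ (ih r) (sig-val r) ⟩
      m r + t r + (t⁺ r - t r)                     ≡⟨ lem (m r) (t r) (t⁺ r) ⟩
      m r + t⁺ r ∎
      where
      lem : ∀ a b d → a + b + (d - b) ≡ a + d
      lem = solve-∀

P-step : ∀ N n c xs {l o} → (∀ r → valP c (P N n r) ≡ M (+ 1) xs r) →
         (c n , l , o) ∈ bumps (+ 1) xs → ∀ r → valP c (P N (suc n) r) ≡ M (+ 1) l r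
P-step N n c xs {l} {o} ih p r =
  trans (alp-val n c (P N n) (M (+ 1) o) (λ r → trans (ih r) (M-omit (+ 1) (+ 1) xs p r)) r)
        (sym (M-bump (+ 1) (+ 1) xs p r))

-- Diagrams as vectors with N entries, and the addition of a cell

T-∧⁻ : ∀ {a b} → T (a ∧ b) → T a × T b
T-∧⁻ = Equivalence.to T-∧

T-∧⁺ : ∀ {a b} → T a → T b → T (a ∧ b)
T-∧⁺ x y = Equivalence.from T-∧ (x , y)

rowContent : ℕ → ℕ → ℤ
rowContent a x = + x - + a

-- Shapes are padded by empty rows. Each entry is also the content of the cell that a step in its
-- row would add, which is why moments of b are moments of contents.
bvec : ℕ → ℕ → List ℕ → List ℤ
bvec zero    a xs       = []
bvec (suc N) a []       = rowContent a 0 ∷ bvec N (suc a) []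
bvec (suc N) a (x ∷ xs) = rowContent a x ∷ bvec N (suc a) xs

rowContent-suc : ∀ a x → rowContent a x + + 1 ≡ rowContent a (suc x)
rowContent-suc a x = trans (lem (+ x) (+ a) (+ 1)) (cong (_- + a) (sym (ℤₚ.pos-+ 1 x)))
  where
  lem : ∀ x a h → x - a + h ≡ h + x - a
  lem = solve-∀

rowContent-diag : ∀ a x → rowContent (suc a) (suc x) ≡ rowContent a x
rowContent-diag a x = trans (cong₂ (λ u v → u - v) (ℤₚ.pos-+ 1 x) (ℤₚ.pos-+ 1 a)) (lem (+ 1) (+ x) (+ a))
  where
  lem : ∀ h x a → h + x - (h + a) ≡ x - a
  lem = solve-∀

-- Neighbours suffice: the vector of a diagram is strictly decreasing, and one unit step can reach
-- only the adjacent entry.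
data Collision : List ℤ → Set where
  here  : ∀ {x y l} → x ≡ y → Collision (x ∷ y ∷ l)
  there : ∀ {x l} → Collision l → Collision (x ∷ l)

Δ-collision : ∀ {l} → Collision l → Δ l ≡ + 0
Δ-collision {x ∷ y ∷ l} (here refl) = lem x (q x l) (q x l * Δ l)
  where
  lem : ∀ x u v → (x - x) * u * v ≡ + 0
  lem = solve-∀
Δ-collision {x ∷ l} (there c) = trans (cong (q x l *_) (Δ-collision c)) (ℤₚ.*-zeroʳ (q x l))

Step : Set
Step = ℤ × List ℕ

consStep : ℕ → Step → Step
consStep x (c , l) = (c , x ∷ l)

ups : ℕ → List ℕ → List Step
ups a []       = [ rowContent a 0 , 1 ∷ [] ]
ups a (x ∷ xs) = (rowContent a x , suc x ∷ xs) ∷ map (consStep x) (ups (suc a) xs)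

addable : List ℕ → List Step
addable l = filterᵇ (weaklyDecreasing ∘ proj₂) (ups 0 l)

∑-filterᵇ : {A : Set} (p : A → Bool) (xs : List A) (f : A → ℤ) →
            (∀ x → x ∈ xs → ¬ T (p x) → f x ≡ + 0) → ∑ (filterᵇ p xs) f ≡ ∑ xs f
∑-filterᵇ p []       f h = refl
∑-filterᵇ p (x ∷ xs) f h with p x | h x (here refl) | ∑-filterᵇ p xs f (λ y → h y ∘ there)
... | true  | _  | ih = cong (_+_ (f x)) ih
... | false | h₀ | ih = trans ih (trans (sym (ℤₚ.+-identityˡ _)) (cong (_+ ∑ xs f) (sym (h₀ λ ()))))

Vanishes : (ℤ → List ℤ → ℤ) → Set
Vanishes F = ∀ b l → Collision l → F b l ≡ + 0

-- Only the first of the empty rows can grow; a step in a later one meets the entry above it.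
bump-empty-collision : ∀ N a {b l o} → (b , l , o) ∈ bumps (+ 1) (bvec N (suc a) []) →
                       Collision (rowContent a 0 ∷ l)
bump-empty-collision (suc N) a (here refl) =
  here (trans (sym (rowContent-diag a 0)) (sym (rowContent-suc (suc a) 0)))
bump-empty-collision (suc N) a (there p) with ∈-map⁻ (consBump _) p
... | _ , p′ , refl = there (bump-empty-collision N (suc a) p′)

-- The bound on the length leaves an empty row for a new part, and the steps in the rows below it
-- vanish. The summand is arbitrary so that the induction can prefix the rows already passed.
∑-ups : ∀ N a l → length l < N → (F : ℤ → List ℤ → ℤ) → Vanishes F →
        ∑ (bumps (+ 1) (bvec N a l)) (λ (b , l′ , o) → F b l′) ≡ ∑ (ups a l) (λ (c , μ) → F c (bvec N a μ))
∑-ups (suc N) a [] _ F van = cong₂ _+_ (cong (λ z → F (rowContent a 0) (z ∷ bvec N (suc a) [])) (rowContent-suc a 0)) (begin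
  ∑ (map (consBump (rowContent a 0)) (bumps (+ 1) (bvec N (suc a) []))) (λ (b , l′ , o) → F b l′)
    ≡⟨ ∑-map (consBump _) (bumps (+ 1) (bvec N (suc a) [])) _ ⟩
  ∑ (bumps (+ 1) (bvec N (suc a) [])) (λ (b , l′ , o) → F b (rowContent a 0 ∷ l′))
    ≡⟨ ∑-cong∈ (bumps (+ 1) (bvec N (suc a) [])) (λ (b , l′ , o) i → van b _ (bump-empty-collision N a i)) ⟩
  ∑ (bumps (+ 1) (bvec N (suc a) [])) (λ _ → + 0)
    ≡⟨ ∑-zero (bumps (+ 1) (bvec N (suc a) [])) ⟩
  + 0 ∎)
∑-ups (suc N) a (x ∷ xs) (s≤s len) F van =
  cong₂ _+_ (cong (λ z → F (rowContent a x) (z ∷ bvec N (suc a) xs)) (rowContent-suc a x)) (begin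
  ∑ (map (consBump (rowContent a x)) (bumps (+ 1) (bvec N (suc a) xs))) (λ (b , l′ , o) → F b l′)
    ≡⟨ ∑-map (consBump _) (bumps (+ 1) (bvec N (suc a) xs)) _ ⟩
  ∑ (bumps (+ 1) (bvec N (suc a) xs)) (λ (b , l′ , o) → F b (rowContent a x ∷ l′))
    ≡⟨ ∑-ups N (suc a) xs len (λ b l → F b (rowContent a x ∷ l)) (λ b l → van b _ ∘ there) ⟩
  ∑ (ups (suc a) xs) (λ (c , μ) → F c (rowContent a x ∷ bvec N (suc a) μ))
    ≡⟨ ∑-map (consStep x) (ups (suc a) xs) _ ⟨
  ∑ (map (consStep x) (ups (suc a) xs)) (λ (c , μ) → F c (bvec (suc N) a μ)) ∎)

wd-tail : ∀ {x} xs → T (weaklyDecreasing (x ∷ xs)) → T (weaklyDecreasing xs)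
wd-tail []       _ = tt
wd-tail (y ∷ ys) h = proj₂ (T-∧⁻ h)

wd-head : ∀ {x y} ys → T (weaklyDecreasing (x ∷ y ∷ ys)) → y ≤ x
wd-head ys h = ℕₚ.≤ᵇ⇒≤ _ _ (proj₁ (T-∧⁻ h))

wd-cons : ∀ {x y} ys → y ≤ x → T (weaklyDecreasing (y ∷ ys)) → T (weaklyDecreasing (x ∷ y ∷ ys))
wd-cons ys y≤x h = T-∧⁺ (ℕₚ.≤⇒≤ᵇ y≤x) h

-- The order breaks only if the row was as long as the one above; lengthened by a cell, it has the
-- same entry of b as that row.
ups-collision : ∀ N a l {c μ} → length l < N → T (weaklyDecreasing l) → (c , μ) ∈ ups a l →
                ¬ T (weaklyDecreasing μ) → Collision (bvec N a μ)
ups-collision N a [] len wd (here refl) ¬wd = ⊥-elim (¬wd tt)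
ups-collision N a (x ∷ []) len wd (here refl) ¬wd = ⊥-elim (¬wd tt)
ups-collision N a (x ∷ y ∷ ys) len wd (here refl) ¬wd =
  ⊥-elim (¬wd (wd-cons ys (ℕₚ.m≤n⇒m≤1+n (wd-head ys wd)) (wd-tail (y ∷ ys) wd)))
ups-collision (suc N) a (x ∷ xs) (s≤s len) wd (there p) ¬wd with ∈-map⁻ (consStep x) p
ups-collision (suc (suc N)) a (x ∷ []) (s≤s len) wd (there p) ¬wd | _ , here refl , refl with 1 ℕ.≤? x
... | yes 1≤x = ⊥-elim (¬wd (wd-cons [] 1≤x tt))
... | no 1≰x rewrite ℕₚ.n<1⇒n≡0 (ℕₚ.≰⇒> 1≰x) = here (sym (rowContent-diag a 0))
ups-collision (suc (suc N)) a (x ∷ y ∷ ys) (s≤s len) wd (there p) ¬wd | _ , here refl , refl with suc y ℕ.≤? x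
... | yes y<x = ⊥-elim (¬wd (wd-cons ys y<x (bump-wd ys (wd-tail (y ∷ ys) wd))))
  where
  bump-wd : ∀ {y} ys → T (weaklyDecreasing (y ∷ ys)) → T (weaklyDecreasing (suc y ∷ ys))
  bump-wd []       _ = tt
  bump-wd (z ∷ zs) h = wd-cons zs (ℕₚ.m≤n⇒m≤1+n (wd-head zs h)) (wd-tail (z ∷ zs) h)
... | no y≮x rewrite ℕₚ.≤-antisym (wd-head ys wd) (ℕₚ.≮⇒≥ y≮x) = here (sym (rowContent-diag a x))
ups-collision (suc N) a (x ∷ y ∷ ys) (s≤s len) wd (there p) ¬wd | (c , μ) , there p′ , refl
  with ∈-map⁻ (consStep y) p′
... | (c , μ′) , p″ , refl = there (ups-collision N (suc a) (y ∷ ys) len (wd-tail (y ∷ ys) wd) (there p′)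
        (λ h → ¬wd (wd-cons μ′ (wd-head ys wd) h)))

∑-addable : ∀ N l r → length l < N → T (weaklyDecreasing l) →
            ∑ (addable l) (λ (c , μ) → c ^ r * Δ (bvec N 0 μ)) ≡ Δ (bvec N 0 l) * M (+ 1) (bvec N 0 l) r
∑-addable N l r len wd = begin
  ∑ (addable l) (λ (c , μ) → c ^ r * Δ (bvec N 0 μ))
    ≡⟨ ∑-filterᵇ _ (ups 0 l) _ (λ (c , μ) i ¬wd → vanish c _ (ups-collision N 0 l len wd i ¬wd)) ⟩
  ∑ (ups 0 l) (λ (c , μ) → c ^ r * Δ (bvec N 0 μ))
    ≡⟨ ∑-ups N 0 l len (λ b v → b ^ r * Δ v) vanish ⟨
  ∑ (bumps (+ 1) (bvec N 0 l)) (λ (b , v , o) → b ^ r * Δ v)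
    ≡⟨ ∑-bumps (+ 1) (bvec N 0 l) r ⟩
  Δ (bvec N 0 l) * M (+ 1) (bvec N 0 l) r ∎
  where
  vanish : Vanishes (λ b v → b ^ r * Δ v)
  vanish b v c = trans (cong (b ^ r *_) (Δ-collision c)) (ℤₚ.*-zeroʳ (b ^ r))

ups-bump : ∀ N a l {c μ} → length l < N → (c , μ) ∈ ups a l →
           ∃ λ o → (c , bvec N a μ , o) ∈ bumps (+ 1) (bvec N a l)
ups-bump (suc N) a []       len (here refl) = 
  _ , here (cong (λ z → rowContent a 0 , z ∷ bvec N (suc a) [] , bvec N (suc a) []) (sym (rowContent-suc a 0)))
ups-bump (suc N) a (x ∷ xs) len (here refl) = 
  _ , here (cong (λ z → rowContent a x , z ∷ bvec N (suc a) xs , bvec N (suc a) xs) (sym (rowContent-suc a x)))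
ups-bump (suc N) a (x ∷ xs) (s≤s len) (there p) with ∈-map⁻ (consStep x) p
... | _ , p′ , refl with ups-bump N (suc a) xs len p′
... | o , i = _ , there (∈-map⁺ (consBump (rowContent a x)) i)

-- The product of (z + i + 1)/(z + i) over a ≤ i < a + N telescopes to 1 + N/(z + a). For a = 0 this
-- agrees with the base case of `P`.
M-empty : ∀ N a r → M (+ 1) (bvec N a []) r ≡ + N * rowContent a 0 ^ r
M-empty zero    a r = refl
M-empty (suc N) a r = begin
  M (+ 1) v r + τ (+ 1) x (M (+ 1) v) r      ≡⟨ cong₂ _+_ (M-empty N (suc a) r) (τ-val r) ⟩
  + N * y ^ r + ((+ 1 + + N) * x ^ r - + N * y ^ r) ≡⟨ lem (+ N * y ^ r) ((+ 1 + + N) * x ^ r) ⟩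
  (+ 1 + + N) * x ^ r                        ≡⟨ cong (_* x ^ r) (sym (ℤₚ.pos-+ 1 N)) ⟩
  + suc N * x ^ r ∎
  where
  v = bvec N (suc a) []
  x = rowContent a 0
  y = rowContent (suc a) 0
  x≡ : x ≡ y + + 1
  x≡ = trans (sym (rowContent-diag a 0)) (sym (rowContent-suc (suc a) 0))
  lem : ∀ a b → a + (b - a) ≡ b
  lem = solve-∀
  lem₀ : ∀ n → + 1 ≡ (+ 1 + n) * + 1 - n * + 1
  lem₀ = solve-∀
  lem₁ : ∀ y n p s → (y + + 1) * ((+ 1 + n) * p - n * s) + + 1 * (n * s)
         ≡ (+ 1 + n) * ((y + + 1) * p) - n * (y * s)
  lem₁ = solve-∀
  τ-val : ∀ r → τ (+ 1) x (M (+ 1) v) r ≡ (+ 1 + + N) * x ^ r - + N * y ^ r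
  τ-val zero    = lem₀ (+ N)
  τ-val (suc r) = begin
    x * τ (+ 1) x (M (+ 1) v) r + + 1 * M (+ 1) v r
      ≡⟨ cong₂ (λ s t → x * s + + 1 * t) (τ-val r) (M-empty N (suc a) r) ⟩
    x * ((+ 1 + + N) * x ^ r - + N * y ^ r) + + 1 * (+ N * y ^ r)
      ≡⟨ cong (λ z → z * ((+ 1 + + N) * x ^ r - + N * y ^ r) + + 1 * (+ N * y ^ r)) x≡ ⟩
    (y + + 1) * ((+ 1 + + N) * x ^ r - + N * y ^ r) + + 1 * (+ N * y ^ r)
      ≡⟨ lem₁ y (+ N) (x ^ r) (y ^ r) ⟩
    (+ 1 + + N) * ((y + + 1) * x ^ r) - + N * (y * y ^ r)
      ≡⟨ cong (λ z → (+ 1 + + N) * (z * x ^ r) - + N * (y * y ^ r)) x≡ ⟨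
    (+ 1 + + N) * (x * x ^ r) - + N * (y * y ^ r) ∎

-- Paths in Young's lattice from the empty partition, with the contents of the added cells

State : Set
State = (ℕ → ℤ) × List ℕ

set : (ℕ → ℤ) → ℕ → ℤ → ℕ → ℤ
set c m k i with i ℕ.≟ m
... | yes _ = k
... | no  _ = c i

set-eq : ∀ c m k → set c m k m ≡ k
set-eq c m k with m ℕ.≟ m
... | yes _ = refl
... | no ¬p = ⊥-elim (¬p refl)

set-< : ∀ c m k i → i < m → set c m k i ≡ c i
set-< c m k i i<m with i ℕ.≟ m
... | yes p = ⊥-elim (ℕₚ.<⇒≢ i<m p)
... | no  _ = refl

extend : ℕ → State → List State
extend m (c , l) = map (λ (k , μ) → (set c m k , μ)) (addable l)

paths : ℕ → List State
paths zero    = [ (λ _ → + 0) , [] ]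
paths (suc m) = concatMap (extend m) (paths m)

ups-length : ∀ a l {c μ} → (c , μ) ∈ ups a l → length μ ≤ suc (length l)
ups-length a []       (here refl) = s≤s z≤n
ups-length a (x ∷ xs) (here refl) = ℕₚ.n≤1+n _
ups-length a (x ∷ xs) (there p) with ∈-map⁻ (consStep x) p
... | _ , p′ , refl = s≤s (ups-length (suc a) xs p′)

valP-cong : ∀ {m c d} p → BelowP m p → (∀ i → i < m → c i ≡ d i) → valP c p ≡ valP d p
valP-cong []            []         e = refl
valP-cong ((k , w) ∷ p) (w< ∷ p<) e = cong₂ _+_ (cong (k *_) (valW-cong w w< e)) (valP-cong p p< e)

-- The field `moments` is where the two sides meet: the conditional expectation, evaluated at the
-- contents along the path, gives the moments of the weights Δ(μ)/Δ(l) with which the next cell is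
-- added.
record PathInv (N m : ℕ) (s : State) : Set where
  field
    len     : length (proj₂ s) ≤ m
    wd      : T (weaklyDecreasing (proj₂ s))
    moments : ∀ r → valP (proj₁ s) (P N m r) ≡ M (+ 1) (bvec N 0 (proj₂ s)) r

open PathInv

pathInv : ∀ N m → m ≤ N → ∀ {s} → s ∈ paths m → PathInv N m s
pathInv N zero    _ (here refl) .len = z≤n
pathInv N zero    _ (here refl) .wd  = tt
pathInv N zero    _ (here refl) .moments zero    = begin
  + N * + 1 + + 0                  ≡⟨ ℤₚ.+-identityʳ _ ⟩
  + N * + 1                        ≡⟨ M-empty N 0 0 ⟨
  M (+ 1) (bvec N 0 []) 0 ∎
pathInv N zero    _ (here refl) .moments (suc r) = sym (trans (M-empty N 0 (suc r)) (ℤₚ.*-zeroʳ (+ N)))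
pathInv N (suc m) m<N s∈ with find (∈-concatMap⁻ (extend m) {xs = paths m} s∈)
... | (c , l) , cl∈ , s∈′ with ∈-map⁻ (λ (k , μ) → (set c m k , μ)) s∈′
... | (k , μ) , kμ∈ , refl with ∈-filter⁻ _ {xs = ups 0 l} kμ∈ | pathInv N m (ℕₚ.<⇒≤ m<N) cl∈
... | up , wdμ | inv = record
  { len     = ℕₚ.≤-trans (ups-length 0 l up) (s≤s (inv .len))
  ; wd      = wdμ
  ; moments = λ r → P-step N m (set c m k) (bvec N 0 l)
      (λ r → trans (valP-cong (P N m r) (P-below N m r) (set-< c m k)) (inv .moments r))
      (subst (λ z → (z , bvec N 0 μ , proj₁ bump) ∈ bumps (+ 1) (bvec N 0 l)) (sym (set-eq c m k)) (proj₂ bump)) r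
  }
  where
  bump = ups-bump N 0 l (ℕₚ.≤-<-trans (inv .len) m<N) up

-- The joint spectral measure of the Jucys–Murphy elements under the trace χ.
opW-paths : ∀ N m → m ≤ N → ∀ w → Below m w →
            Δ (bvec N 0 []) * opW w (χ N m) id ≡ ∑ (paths m) (λ (c , l) → valW c w * Δ (bvec N 0 l))
opW-paths N zero    _   []      []        = lem (Δ (bvec N 0 []))
  where
  lem : ∀ a → a * + 1 ≡ + 1 * a + + 0
  lem = solve-∀
opW-paths N (suc m) m<N w w< = begin
  Δ₀ * opW w (χ N (suc m)) id
    ≡⟨ cong (Δ₀ *_) (opW-reduce N m w w<) ⟩
  Δ₀ * ∑ p (λ (k , v) → k * opW (u ++ v) (χ N m) id)
    ≡⟨ ∑-* Δ₀ p _ ⟨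
  ∑ p (λ (k , v) → Δ₀ * (k * opW (u ++ v) (χ N m) id))
    ≡⟨ ∑-cong∈ p (λ (k , v) i → begin
         Δ₀ * (k * opW (u ++ v) (χ N m) id)  ≡⟨ lem₁ Δ₀ k _ ⟩
         k * (Δ₀ * opW (u ++ v) (χ N m) id)
           ≡⟨ cong (k *_) (opW-paths N m (ℕₚ.<⇒≤ m<N) (u ++ v)
                (Allₚ.++⁺ (rest-below m w w<) (All.lookup (P-below N m e) i))) ⟩
         k * ∑ (paths m) (λ (c , l) → valW c (u ++ v) * Δ (bvec N 0 l)) ≡⟨ ∑-* k (paths m) _ ⟨
         ∑ (paths m) (λ (c , l) → k * (valW c (u ++ v) * Δ (bvec N 0 l))) ∎) ⟩
  ∑ p (λ (k , v) → ∑ (paths m) (λ (c , l) → k * (valW c (u ++ v) * Δ (bvec N 0 l))))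
    ≡⟨ ∑-comm p (paths m) _ ⟩
  ∑ (paths m) (λ (c , l) → ∑ p (λ (k , v) → k * (valW c (u ++ v) * Δ (bvec N 0 l))))
    ≡⟨ ∑-cong∈ (paths m) (λ (c , l) i → step c l (pathInv N m (ℕₚ.<⇒≤ m<N) i)) ⟩
  ∑ (paths m) (λ s → ∑ (extend m s) (λ (c , l) → valW c w * Δ (bvec N 0 l)))
    ≡⟨ ∑-concatMap (extend m) (paths m) _ ⟨
  ∑ (paths (suc m)) (λ (c , l) → valW c w * Δ (bvec N 0 l)) ∎
  where
  Δ₀ = Δ (bvec N 0 [])
  e = count m w
  u = rest m w
  p = P N m e
  lem₁ : ∀ a b c → a * (b * c) ≡ b * (a * c)
  lem₁ = solve-∀
  lem₂ : ∀ k a b d → k * (a * b * d) ≡ a * d * (k * b)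
  lem₂ = solve-∀
  lem₃ : ∀ a d k → a * k * d ≡ a * (k * d)
  lem₃ = solve-∀
  step : ∀ c l → PathInv N m (c , l) →
         ∑ p (λ (k , v) → k * (valW c (u ++ v) * Δ (bvec N 0 l))) ≡
         ∑ (extend m (c , l)) (λ (c , l) → valW c w * Δ (bvec N 0 l))
  step c l inv = begin
    ∑ p (λ (k , v) → k * (valW c (u ++ v) * Δ (bvec N 0 l)))
      ≡⟨ ∑-cong p (λ (k , v) → trans (cong (λ z → k * (z * Δ (bvec N 0 l))) (valW-++ c u v))
                                     (lem₂ k (valW c u) (valW c v) (Δ (bvec N 0 l)))) ⟩
    ∑ p (λ (k , v) → valW c u * Δ (bvec N 0 l) * (k * valW c v))
      ≡⟨ ∑-* (valW c u * Δ (bvec N 0 l)) p _ ⟩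
    valW c u * Δ (bvec N 0 l) * valP c p
      ≡⟨ cong (valW c u * Δ (bvec N 0 l) *_) (inv .moments e) ⟩
    valW c u * Δ (bvec N 0 l) * M (+ 1) (bvec N 0 l) e
      ≡⟨ ℤₚ.*-assoc (valW c u) (Δ (bvec N 0 l)) (M (+ 1) (bvec N 0 l) e) ⟩
    valW c u * (Δ (bvec N 0 l) * M (+ 1) (bvec N 0 l) e)
      ≡⟨ cong (valW c u *_) (∑-addable N l e (ℕₚ.≤-<-trans (inv .len) m<N) (inv .wd)) ⟨
    valW c u * ∑ (addable l) (λ (k , μ) → k ^ e * Δ (bvec N 0 μ))
      ≡⟨ ∑-* (valW c u) (addable l) _ ⟨
    ∑ (addable l) (λ (k , μ) → valW c u * (k ^ e * Δ (bvec N 0 μ)))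
      ≡⟨ ∑-cong (addable l) (λ (k , μ) → begin
           valW c u * (k ^ e * Δ (bvec N 0 μ)) ≡⟨ lem₃ (valW c u) (Δ (bvec N 0 μ)) (k ^ e) ⟨
           valW c u * k ^ e * Δ (bvec N 0 μ)
             ≡⟨ cong₂ (λ a b → a * b ^ e * Δ (bvec N 0 μ))
                  (valW-cong u (rest-below m w w<) (set-< c m k)) (set-eq c m k) ⟨
           valW (set c m k) u * set c m k m ^ e * Δ (bvec N 0 μ)
             ≡⟨ cong (_* Δ (bvec N 0 μ)) (valW-rest m w (set c m k)) ⟨
           valW (set c m k) w * Δ (bvec N 0 μ) ∎) ⟩
    ∑ (addable l) (λ (k , μ) → valW (set c m k) w * Δ (bvec N 0 μ))
      ≡⟨ ∑-map (λ (k , μ) → (set c m k , μ)) (addable l) _ ⟨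
    ∑ (extend m (c , l)) (λ (c , l) → valW c w * Δ (bvec N 0 l)) ∎

-- The last step stays explicit because it alone carries the content that enters Jₘʳ; the earlier
-- contents can then be forgotten, and paths be counted by their ends.
J^-paths : ∀ N m r → m < N →
           Δ (bvec N 0 []) * pow (X m m) r (χ N (suc m)) id ≡
           ∑ (paths m) (λ (_ , l) → ∑ (addable l) (λ (k , μ) → k ^ r * Δ (bvec N 0 μ)))
J^-paths N m r m<N = begin
  Δ (bvec N 0 []) * pow (X m m) r (χ N (suc m)) id
    ≡⟨ cong (λ z → Δ (bvec N 0 []) * z id) (opW-replicate r) ⟩
  Δ (bvec N 0 []) * opW (replicate r m) (χ N (suc m)) id
    ≡⟨ opW-paths N (suc m) m<N (replicate r m) (Allₚ.replicate⁺ r (ℕₚ.n<1+n m)) ⟩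
  ∑ (paths (suc m)) (λ (c , l) → valW c (replicate r m) * Δ (bvec N 0 l))
    ≡⟨ ∑-concatMap (extend m) (paths m) _ ⟩
  ∑ (paths m) (λ s → ∑ (extend m s) (λ (c , l) → valW c (replicate r m) * Δ (bvec N 0 l)))
    ≡⟨ ∑-cong (paths m) (λ (c , l) → trans
         (∑-map (λ (k , μ) → (set c m k , μ)) (addable l) _)
         (∑-cong (addable l) (λ (k , μ) → cong (_* Δ (bvec N 0 μ))
           (trans (valW-replicate r (set c m k)) (cong (_^ r) (set-eq c m k)))))) ⟩
  ∑ (paths m) (λ (_ , l) → ∑ (addable l) (λ (k , μ) → k ^ r * Δ (bvec N 0 μ))) ∎
  where
  opW-replicate : ∀ r {φ} → pow (X m m) r φ ≡ opW (replicate r m) φ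
  opW-replicate zero    = refl
  opW-replicate (suc r) = cong (X m m) (opW-replicate r)
  valW-replicate : ∀ r c → valW c (replicate r m) ≡ c m ^ r
  valW-replicate zero    c = refl
  valW-replicate (suc r) c = cong (c m *_) (valW-replicate r c)

-- The removal of a cell

Part : List ℕ → Set
Part l = T (weaklyDecreasing l) × All (0 <_) l

part-tail : ∀ {x xs} → Part (x ∷ xs) → Part xs
part-tail {xs = xs} (wd , _ ∷ pos) = wd-tail xs wd , pos

-- Cov a c l μ: μ is l with one cell of content c added, rows being counted from a.
data Cov : ℕ → ℤ → List ℕ → List ℕ → Set where
  new   : ∀ {a} → Cov a (rowContent a 0) [] (1 ∷ [])
  here  : ∀ {a x xs} → Cov a (rowContent a x) (x ∷ xs) (suc x ∷ xs)
  there : ∀ {a c x l μ} → Cov (suc a) c l μ → Cov a c (x ∷ l) (x ∷ μ)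

corner : ℕ → ℕ → ℕ → List ℕ → List Step
corner a x y ys = if y ≤ᵇ x then [ rowContent a x , x ∷ y ∷ ys ] else []

-- A part 1 can disappear only from the last row: elsewhere the row below is nonempty, and `corner`
-- rejects the removal.
rem : ℕ → List ℕ → List Step
rem a []                = []
rem a (zero ∷ xs)       = []
rem a (suc x ∷ y ∷ ys)  = corner a x y ys ++ map (consStep (suc x)) (rem (suc a) (y ∷ ys))
rem a (1 ∷ [])          = [ rowContent a 0 , [] ]
rem a (suc (suc x) ∷ []) = [ rowContent a (suc x) , suc x ∷ [] ]

ups⇒cov : ∀ a l {c μ} → (c , μ) ∈ ups a l → Cov a c l μ
ups⇒cov a []       (here refl) = new
ups⇒cov a (x ∷ xs) (here refl) = here
ups⇒cov a (x ∷ xs) (there p) with ∈-map⁻ (consStep x) p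
... | _ , p′ , refl = there (ups⇒cov (suc a) xs p′)

cov⇒ups : ∀ {a c l μ} → Cov a c l μ → (c , μ) ∈ ups a l
cov⇒ups new        = here refl
cov⇒ups here       = here refl
cov⇒ups (there {x = x} p) = there (∈-map⁺ (consStep x) (cov⇒ups p))

cov-head : ∀ {a c x xs y ys} → Cov a c (x ∷ xs) (y ∷ ys) → x ≤ y
cov-head here      = ℕₚ.n≤1+n _
cov-head (there p) = ℕₚ.≤-refl

cov-pos : ∀ {a c l μ} → Cov a c l μ → All (0 <_) l → All (0 <_) μ
cov-pos new       _          = s≤s z≤n ∷ []
cov-pos here      (_ ∷ pos)  = s≤s z≤n ∷ pos
cov-pos (there p) (x ∷ pos)  = x ∷ cov-pos p pos

cov-sum : ∀ {a c l μ} → Cov a c l μ → sum μ ≡ suc (sum l)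
cov-sum new       = refl
cov-sum here      = refl
cov-sum (there {x = x} p) = trans (cong (x ℕ.+_) (cov-sum p)) (ℕₚ.+-suc x _)

cov-length : ∀ {a c l μ} → Cov a c l μ → length l ≤ length μ
cov-length new       = z≤n
cov-length here      = ℕₚ.≤-refl
cov-length (there p) = s≤s (cov-length p)

∈-corner : ∀ a x y ys {s} → s ∈ corner a x y ys → s ≡ (rowContent a x , x ∷ y ∷ ys) × T (y ≤ᵇ x)
∈-corner a x y ys p with y ≤ᵇ x
∈-corner a x y ys (here e) | true = e , tt

rem⇒cov : ∀ a μ {c l} → Part μ → (c , l) ∈ rem a μ → Cov a c l μ × Part l
rem⇒cov a (1 ∷ [])           _  (here refl) = new , tt , []
rem⇒cov a (suc (suc x) ∷ []) _  (here refl) = here , tt , s≤s z≤n ∷ []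
rem⇒cov a (suc x ∷ y ∷ ys) pt@(wd , _ ∷ 0<y ∷ pos) p with ∈-++⁻ (corner a x y ys) p
... | inj₁ p₁ with ∈-corner a x y ys p₁
...   | refl , y≤x = here , wd-cons ys (ℕₚ.≤ᵇ⇒≤ y x y≤x) (wd-tail (y ∷ ys) wd)
                   , ℕₚ.<-≤-trans 0<y (ℕₚ.≤ᵇ⇒≤ y x y≤x) ∷ 0<y ∷ pos
rem⇒cov a (suc x ∷ y ∷ ys) pt@(wd , 0<x ∷ 0<y ∷ pos) p | inj₂ p₂ with ∈-map⁻ (consStep (suc x)) p₂
... | (c , l) , p′ , refl with rem⇒cov (suc a) (y ∷ ys) (part-tail pt) p′
...   | cov , wdl , posl = there cov , wd′ l cov wdl , 0<x ∷ posl
  where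
  wd′ : ∀ l → Cov (suc a) c l (y ∷ ys) → T (weaklyDecreasing l) → T (weaklyDecreasing (suc x ∷ l))
  wd′ []       _   _  = tt
  wd′ (z ∷ zs) cov h  = wd-cons zs (ℕₚ.≤-trans (cov-head cov) (wd-head ys wd)) h

corner-∈ : ∀ a x y ys → y ≤ x → (rowContent a x , x ∷ y ∷ ys) ∈ corner a x y ys
corner-∈ a x y ys y≤x with y ≤ᵇ x | ℕₚ.≤⇒≤ᵇ y≤x
... | true | _ = here refl

cov⇒rem : ∀ {a c l μ} → Cov a c l μ → Part l → Part μ → (c , l) ∈ rem a μ
cov⇒rem new _ _ = here refl
cov⇒rem {a} (here {x = x} {y ∷ ys}) (wd , _) _ = ∈-++⁺ˡ (corner-∈ a x y ys (wd-head ys wd))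
cov⇒rem (here {x = suc x} {[]}) _ _ = here refl
cov⇒rem (here {x = zero} {[]}) (_ , () ∷ _) _
cov⇒rem {a} {μ = suc x ∷ y ∷ ys} (there p) pl pμ =
  ∈-++⁺ʳ (corner a x y ys) (∈-map⁺ (consStep (suc x)) (cov⇒rem p (part-tail pl) (part-tail pμ)))
cov⇒rem {μ = zero ∷ y ∷ ys} (there p) pl (_ , () ∷ _)

rowContent-pred : ∀ a x → rowContent a (suc x) - + 1 ≡ rowContent a x
rowContent-pred a x = trans (cong (_- + 1) (sym (rowContent-suc a x))) (lem (rowContent a x))
  where
  lem : ∀ u → u + + 1 - + 1 ≡ u
  lem = solve-∀

rowContent-pred′ : ∀ a x → rowContent a x - + 1 ≡ rowContent (suc a) x
rowContent-pred′ a x = trans (cong (_- + 1) (sym (rowContent-diag a x))) (rowContent-pred (suc a) x)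

-- A step down from b removes the last cell of a row, and that cell has content b - 1.
∑bumps⁻ : ℕ → ℕ → List ℕ → (ℤ → List ℤ → ℤ) → ℤ
∑bumps⁻ N a μ H = ∑ (bumps (- (+ 1)) (bvec N a μ)) (λ (b , v , o) → H (b - + 1) v)

-- An empty row that is lowered collides with the empty row below. The last row has none below it;
-- its step would remove a fictitious cell of content -(a + N), where H is required to vanish.
∑bumps⁻-empty : ∀ N a H → Vanishes H → (∀ c v → c + + (a ℕ.+ N) ≡ + 0 → H c v ≡ + 0) →
                ∑bumps⁻ N a [] H ≡ + 0
∑bumps⁻-empty zero          a H van bot = refl
∑bumps⁻-empty (suc zero)    a H van bot = trans (ℤₚ.+-identityʳ _) (bot _ _ (begin
  rowContent a 0 - + 1 + + (a ℕ.+ 1)   ≡⟨ cong (_+_ (rowContent a 0 - + 1)) (ℤₚ.pos-+ a 1) ⟩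
  + 0 - + a - + 1 + (+ a + + 1)        ≡⟨ lem (+ a) ⟩
  + 0 ∎))
  where
  lem : ∀ a → + 0 - a - + 1 + (a + + 1) ≡ + 0
  lem = solve-∀
∑bumps⁻-empty (suc (suc N)) a H van bot = trans
  (cong₂ _+_ (van _ _ (here (rowContent-pred′ a 0)))
    (trans (∑-map (consBump (rowContent a 0)) (bumps (- (+ 1)) (bvec (suc N) (suc a) [])) (λ (b , v , o) → H (b - + 1) v))
           (∑bumps⁻-empty (suc N) (suc a) (λ c v → H c (rowContent a 0 ∷ v)) (λ c v → van c _ ∘ there)
             (λ c v e → bot c _ (trans (cong (λ z → c + + z) (ℕₚ.+-suc a (suc N))) e)))))
  (ℤₚ.+-identityˡ (+ 0))

∑-rem : ∀ N a μ → length μ ≤ N → Part μ → ∀ H → Vanishes H →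
        (∀ c v → c + + (a ℕ.+ N) ≡ + 0 → H c v ≡ + 0) →
        ∑bumps⁻ N a μ H ≡ ∑ (rem a μ) (λ (c , l) → H c (bvec N a l))
∑-rem N a [] len pt H van bot = ∑bumps⁻-empty N a H van bot
∑-rem (suc N) a (zero ∷ xs) len (_ , () ∷ _) H van bot
∑-rem (suc N) a (suc x ∷ []) len pt H van bot = trans
  (cong₂ _+_ (cong (λ z → H z (z ∷ bvec N (suc a) [])) (rowContent-pred a x))
    (trans (∑-map (consBump (rowContent a (suc x))) (bumps (- (+ 1)) (bvec N (suc a) [])) (λ (b , v , o) → H (b - + 1) v))
      (∑bumps⁻-empty N (suc a) (λ c v → H c (rowContent a (suc x) ∷ v)) (λ c v → van c _ ∘ there)
        (λ c v e → bot c _ (trans (cong (λ z → c + + z) (ℕₚ.+-suc a N)) e)))))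
  (case x)
  where
  case : ∀ x → H (rowContent a x) (rowContent a x ∷ bvec N (suc a) []) + + 0 ≡
               ∑ (rem a (suc x ∷ [])) (λ (c , l) → H c (bvec (suc N) a l))
  case zero    = refl
  case (suc x) = refl
∑-rem (suc (suc N)) a (suc x ∷ y ∷ ys) (s≤s len) pt@(wd , _) H van bot = begin
  H (rowContent a (suc x) - + 1) ((rowContent a (suc x) - + 1) ∷ v)
    + ∑ (map (consBump (rowContent a (suc x))) (bumps (- (+ 1)) v)) (λ (b , v , o) → H (b - + 1) v)
    ≡⟨ cong₂ _+_ (trans (cong (λ z → H z (z ∷ v)) (rowContent-pred a x)) head)
         (trans (∑-map (consBump (rowContent a (suc x))) (bumps (- (+ 1)) v) (λ (b , v , o) → H (b - + 1) v))
           (trans (∑-rem (suc N) (suc a) (y ∷ ys) len (part-tail pt)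
                    (λ c v → H c (rowContent a (suc x) ∷ v)) (λ c v → van c _ ∘ there)
                    (λ c v e → bot c _ (trans (cong (λ z → c + + z) (ℕₚ.+-suc a (suc N))) e)))
                  (sym (∑-map (consStep (suc x)) (rem (suc a) (y ∷ ys)) _)))) ⟩
  ∑ (corner a x y ys) f + ∑ (map (consStep (suc x)) (rem (suc a) (y ∷ ys))) f
    ≡⟨ ∑-++ (corner a x y ys) _ f ⟨
  ∑ (rem a (suc x ∷ y ∷ ys)) f ∎
  where
  v = bvec (suc N) (suc a) (y ∷ ys)
  f : Step → ℤ
  f (c , l) = H c (bvec (suc (suc N)) a l)
  head : H (rowContent a x) (rowContent a x ∷ v) ≡ ∑ (corner a x y ys) f
  head with y ≤ᵇ x in eq
  ... | true  = sym (ℤₚ.+-identityʳ _)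
  ... | false = van _ _ (here (trans (sym (rowContent-diag a x)) (cong (rowContent (suc a))
          (ℕₚ.≤-antisym (ℕₚ.≰⇒> (λ y≤x → subst T eq (ℕₚ.≤⇒≤ᵇ y≤x))) (wd-head ys wd)))))

length-bvec : ∀ N a μ → length (bvec N a μ) ≡ N
length-bvec zero    a μ       = refl
length-bvec (suc N) a []      = cong suc (length-bvec N (suc a) [])
length-bvec (suc N) a (x ∷ μ) = cong suc (length-bvec N (suc a) μ)

M-zero : ∀ h xs → M h xs 0 ≡ + length xs
M-zero h []       = refl
M-zero h (x ∷ xs) = trans (cong (_+ + 1) (M-zero h xs)) (cong +_ (ℕₚ.+-comm (length xs) 1))

-- The coefficient of z⁻² is Σ bᵢ - N(N - 1)/2, and Σ bᵢ itself contains another -N(N - 1)/2 from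
-- the row indices.
M-one : ∀ N a μ → length μ ≤ N → M (- (+ 1)) (bvec N a μ) 1 ≡ + sum μ - + N * (+ N - + 1) - + N * + a
M-one zero    a []      _ = refl
M-one (suc N) a []      _ = trans
  (cong₂ (λ u v → u + (rowContent a 0 * + 1 + - (+ 1) * v)) (M-one N (suc a) [] z≤n)
         (trans (M-zero (- (+ 1)) (bvec N (suc a) [])) (cong +_ (length-bvec N (suc a) []))))
  (trans (cong (λ z → + 0 - + N * (+ N - + 1) - + N * z + (rowContent a 0 * + 1 + - (+ 1) * + N)) (ℤₚ.pos-+ 1 a))
  (trans (lem (+ N) (+ a)) (cong (λ z → + 0 - z * (z - + 1) - z * + a) (sym (ℤₚ.pos-+ 1 N)))))
  where
  lem : ∀ n a → + 0 - n * (n - + 1) - n * (+ 1 + a) + ((+ 0 - a) * + 1 + - (+ 1) * n)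
        ≡ + 0 - (+ 1 + n) * (+ 1 + n - + 1) - (+ 1 + n) * a
  lem = solve-∀
M-one (suc N) a (x ∷ μ) (s≤s len) = trans
  (cong₂ (λ u v → u + (rowContent a x * + 1 + - (+ 1) * v)) (M-one N (suc a) μ len)
         (trans (M-zero (- (+ 1)) (bvec N (suc a) μ)) (cong +_ (length-bvec N (suc a) μ))))
  (trans (cong (λ z → + sum μ - + N * (+ N - + 1) - + N * z + (rowContent a x * + 1 + - (+ 1) * + N)) (ℤₚ.pos-+ 1 a))
  (trans (lem (+ N) (+ a) (+ x) (+ sum μ))
    (cong₂ (λ s z → s - z * (z - + 1) - z * + a) (sym (ℤₚ.pos-+ x (sum μ))) (sym (ℤₚ.pos-+ 1 N)))))
  where
  lem : ∀ n a x s → s - n * (n - + 1) - n * (+ 1 + a) + ((x - a) * + 1 + - (+ 1) * n)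
        ≡ x + s - (+ 1 + n) * (+ 1 + n - + 1) - (+ 1 + n) * a
  lem = solve-∀

-- For a removed cell N + c is (N - 1) + b, so the zeroth and the first moment for h = -1 combine,
-- and the terms in N cancel. The weight N + c kills the fictitious cell of content -N and is also
-- the factor that the cell contributes to the content product.
Δ-rem : ∀ N μ → length μ ≤ N → Part μ →
        ∑ (rem 0 μ) (λ (c , l) → (+ N + c) * Δ (bvec N 0 l)) ≡ + sum μ * Δ (bvec N 0 μ)
Δ-rem N μ len pt = begin
  ∑ (rem 0 μ) (λ (c , l) → (+ N + c) * Δ (bvec N 0 l))
    ≡⟨ ∑-rem N 0 μ len pt (λ c v → (+ N + c) * Δ v)
         (λ c v col → trans (cong ((+ N + c) *_) (Δ-collision col)) (ℤₚ.*-zeroʳ (+ N + c)))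
         (λ c v e → trans (cong (_* Δ v) (trans (ℤₚ.+-comm (+ N) c) e)) (ℤₚ.*-zeroˡ (Δ v))) ⟨
  ∑ bs (λ (b , v , o) → (+ N + (b - + 1)) * Δ v)
    ≡⟨ ∑-cong bs (λ (b , v , o) → lem (+ N) b (Δ v)) ⟩
  ∑ bs (λ (b , v , o) → (+ N - + 1) * (b ^ 0 * Δ v) + b ^ 1 * Δ v)
    ≡⟨ ∑-+ bs (λ (b , v , o) → (+ N - + 1) * (b ^ 0 * Δ v)) _ ⟩
  _ ≡⟨ cong₂ _+_ (trans (∑-* (+ N - + 1) bs _) (cong ((+ N - + 1) *_) (∑-bumps (- (+ 1)) w 0)))
                 (∑-bumps (- (+ 1)) w 1) ⟩
  (+ N - + 1) * (Δ w * M (- (+ 1)) w 0) + Δ w * M (- (+ 1)) w 1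
    ≡⟨ cong₂ (λ u v → (+ N - + 1) * (Δ w * u) + Δ w * v)
         (trans (M-zero (- (+ 1)) w) (cong +_ (length-bvec N 0 μ))) (M-one N 0 μ len) ⟩
  (+ N - + 1) * (Δ w * + N) + Δ w * (+ sum μ - + N * (+ N - + 1) - + N * + 0)
    ≡⟨ lem′ (+ N) (Δ w) (+ sum μ) ⟩
  + sum μ * Δ w ∎
  where
  w = bvec N 0 μ
  bs = bumps (- (+ 1)) w
  lem : ∀ n b d → (n + (b - + 1)) * d ≡ (n - + 1) * (+ 1 * d) + b * + 1 * d
  lem = solve-∀
  lem′ : ∀ n d s → (n - + 1) * (d * n) + d * (s - n * (n - + 1) - n * + 0) ≡ s * d
  lem′ = solve-∀

contentProduct : ℤ → List ℤ → ℤ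
contentProduct t []       = + 1
contentProduct t (c ∷ cs) = (t + c) * contentProduct t cs

contentProduct-++ : ∀ t cs ds → contentProduct t (cs ++ ds) ≡ contentProduct t cs * contentProduct t ds
contentProduct-++ t []       ds = sym (ℤₚ.*-identityˡ _)
contentProduct-++ t (c ∷ cs) ds =
  trans (cong ((t + c) *_) (contentProduct-++ t cs ds)) (sym (ℤₚ.*-assoc (t + c) _ _))

cov-contentProduct : ∀ {a c l μ} t → Cov a c l μ →
  contentProduct t (contentsFrom a μ) ≡ (t + c) * contentProduct t (contentsFrom a l)
cov-contentProduct t new = refl
cov-contentProduct {a} t (here {x = x} {xs}) = begin
  contentProduct t (map f (upTo (suc x)) ++ ds)
    ≡⟨ cong (λ z → contentProduct t (map f z ++ ds)) (Listₚ.upTo-∷ʳ x) ⟨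
  contentProduct t (map f (upTo x ++ [ x ]) ++ ds)
    ≡⟨ cong (λ z → contentProduct t (z ++ ds)) (Listₚ.map-++ f (upTo x) [ x ]) ⟩
  contentProduct t ((map f (upTo x) ++ [ f x ]) ++ ds)
    ≡⟨ contentProduct-++ t (map f (upTo x) ++ [ f x ]) ds ⟩
  contentProduct t (map f (upTo x) ++ [ f x ]) * contentProduct t ds
    ≡⟨ cong (_* contentProduct t ds) (contentProduct-++ t (map f (upTo x)) [ f x ]) ⟩
  contentProduct t (map f (upTo x)) * ((t + f x) * + 1) * contentProduct t ds
    ≡⟨ lem (contentProduct t (map f (upTo x))) (t + f x) (contentProduct t ds) ⟩
  (t + f x) * (contentProduct t (map f (upTo x)) * contentProduct t ds)
    ≡⟨ cong ((t + f x) *_) (contentProduct-++ t (map f (upTo x)) ds) ⟨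
  (t + f x) * contentProduct t (map f (upTo x) ++ ds) ∎
  where
  f : ℕ → ℤ
  f = rowContent a
  ds = contentsFrom (suc a) xs
  lem : ∀ p u d → p * (u * + 1) * d ≡ u * (p * d)
  lem = solve-∀
cov-contentProduct {a} {c} t (there {x = x} {l} {μ} p) = begin
  contentProduct t (row ++ contentsFrom (suc a) μ)  ≡⟨ contentProduct-++ t row _ ⟩
  contentProduct t row * contentProduct t (contentsFrom (suc a) μ)
    ≡⟨ cong (contentProduct t row *_) (cov-contentProduct t p) ⟩
  contentProduct t row * ((t + c) * contentProduct t (contentsFrom (suc a) l))
    ≡⟨ lem (contentProduct t row) (t + c) _ ⟩
  (t + c) * (contentProduct t row * contentProduct t (contentsFrom (suc a) l))
    ≡⟨ cong ((t + c) *_) (contentProduct-++ t row _) ⟨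
  (t + c) * contentProduct t (row ++ contentsFrom (suc a) l) ∎
  where
  row = map (rowContent a) (upTo x)
  lem : ∀ p u d → p * (u * d) ≡ u * (p * d)
  lem = solve-∀

-- Standard fillings: the largest entry sits in a corner

ind : Bool → ℤ
ind true  = + 1
ind false = + 0

ind-∧ : ∀ a b → ind (a ∧ b) ≡ ind a * ind b
ind-∧ true  b = sym (ℤₚ.*-identityˡ (ind b))
ind-∧ false b = refl

¬T⇒false : ∀ {b} → ¬ T b → b ≡ false
¬T⇒false {true}  h = ⊥-elim (h tt)
¬T⇒false {false} h = refl

length-filterᵇ : {A : Set} (p : A → Bool) (xs : List A) → + length (filterᵇ p xs) ≡ ∑ xs (ind ∘ p)
length-filterᵇ p []       = refl
length-filterᵇ p (x ∷ xs) with p x | length-filterᵇ p xs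
... | true  | ih = trans (ℤₚ.pos-+ 1 (length (filterᵇ p xs))) (cong (_+_ (+ 1)) ih)
... | false | ih = trans ih (sym (ℤₚ.+-identityˡ _))

∑-upTo-suc : ∀ N f → ∑ (upTo (suc N)) f ≡ ∑ (upTo N) f + f N
∑-upTo-suc N f = begin
  ∑ (upTo (suc N)) f          ≡⟨ cong (λ z → ∑ z f) (Listₚ.upTo-∷ʳ N) ⟨
  ∑ (upTo N ++ [ N ]) f       ≡⟨ ∑-++ (upTo N) [ N ] f ⟩
  ∑ (upTo N) f + (f N + + 0)  ≡⟨ cong (_+_ (∑ (upTo N) f)) (ℤₚ.+-identityʳ (f N)) ⟩
  ∑ (upTo N) f + f N ∎

∈-listsOfLength⁻ : ∀ l {vals R} → R ∈ listsOfLength l vals → length R ≡ l × All (_∈ vals) R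
∈-listsOfLength⁻ zero    (here refl) = refl , []
∈-listsOfLength⁻ (suc l) {vals} p
  with find (∈-concatMap⁻ (λ x → map (x ∷_) (listsOfLength l vals)) {xs = vals} p)
... | x , x∈ , p′ with ∈-map⁻ (x ∷_) p′
... | R , p″ , refl with ∈-listsOfLength⁻ l p″
... | len , all∈ = cong suc len , x∈ ∷ all∈

∑rows : ℕ → ℕ → (List ℕ → ℤ) → ℤ
∑rows l N g = ∑ (listsOfLength l (upTo N)) (λ R → ind (strictlyIncreasing R) * g R)

∑rows-cong : ∀ l N {g g′} → (∀ R → length R ≡ l → All (_< N) R → g R ≡ g′ R) → ∑rows l N g ≡ ∑rows l N g′
∑rows-cong l N e = ∑-cong∈ (listsOfLength l (upTo N)) λ R i →
  let len , all∈ = ∈-listsOfLength⁻ l i in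
  cong (ind (strictlyIncreasing R) *_) (e R len (All.map ∈-upTo⁻ all∈))

∑rows-+ : ∀ l N g g′ → ∑rows l N (λ R → g R + g′ R) ≡ ∑rows l N g + ∑rows l N g′
∑rows-+ l N g g′ = trans
  (∑-cong (listsOfLength l (upTo N)) (λ R → ℤₚ.*-distribˡ-+ (ind (strictlyIncreasing R)) (g R) (g′ R)))
  (∑-+ (listsOfLength l (upTo N)) (λ R → ind (strictlyIncreasing R) * g R) _)

∑rows-zero : ∀ l N → ∑rows l N (λ _ → + 0) ≡ + 0
∑rows-zero l N = trans (∑-cong (listsOfLength l (upTo N)) (λ R → ℤₚ.*-zeroʳ (ind (strictlyIncreasing R))))
                       (∑-zero (listsOfLength l (upTo N)))

∑rows-∑ : {A : Set} (l N : ℕ) (xs : List A) (g : A → List ℕ → ℤ) →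
          ∑rows l N (λ R → ∑ xs (λ x → g x R)) ≡ ∑ xs (λ x → ∑rows l N (g x))
∑rows-∑ l N []       g = ∑rows-zero l N
∑rows-∑ l N (x ∷ xs) g = trans (∑rows-+ l N (g x) _) (cong (_+_ (∑rows l N (g x))) (∑rows-∑ l N xs g))

below : ℕ → List ℕ → Bool
below x []      = true
below x (y ∷ _) = x <ᵇ y

∑rows-suc : ∀ l N g → ∑rows (suc l) N g ≡ ∑ (upTo N) (λ x → ∑rows l N (λ R → ind (below x R) * g (x ∷ R)))
∑rows-suc l N g = trans (∑-concatMap (λ x → map (x ∷_) (listsOfLength l (upTo N))) (upTo N) _)
  (∑-cong (upTo N) λ x → trans (∑-map (x ∷_) (listsOfLength l (upTo N)) _)
    (∑-cong (listsOfLength l (upTo N)) (λ R → trans (cong (_* g (x ∷ R)) (split x R))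
      (lem (ind (below x R)) (ind (strictlyIncreasing R)) (g (x ∷ R))))))
  where
  split : ∀ x R → ind (strictlyIncreasing (x ∷ R)) ≡ ind (below x R) * ind (strictlyIncreasing R)
  split x []      = refl
  split x (y ∷ R) = ind-∧ (x <ᵇ y) _
  lem : ∀ a b c → a * b * c ≡ b * (a * c)
  lem = solve-∀

<ᵇ-false : ∀ {x y} → y ≤ x → (x <ᵇ y) ≡ false
<ᵇ-false {x} {y} y≤x = ¬T⇒false (λ h → ℕₚ.<⇒≱ (ℕₚ.<ᵇ⇒< x y h) y≤x)

<ᵇ-true : ∀ {x y} → x < y → (x <ᵇ y) ≡ true
<ᵇ-true {x} {y} x<y = T-ext (λ _ → tt) (λ _ → ℕₚ.<⇒<ᵇ x<y)

-- In a strictly increasing row with entries at most N, the value N can only come last.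
∑rows-max : ∀ l N g → ∑rows (suc l) (suc N) g ≡ ∑rows (suc l) N g + ∑rows l N (λ R → g (R ∷ʳ N))
∑rows-max zero N g = begin
  ∑rows 1 (suc N) g                      ≡⟨ ∑rows-suc zero (suc N) g ⟩
  ∑ (upTo (suc N)) f                     ≡⟨ ∑-upTo-suc N f ⟩
  ∑ (upTo N) f + f N                     ≡⟨ cong₂ _+_ (sym (∑rows-suc zero N g))
                                              (cong (λ z → + 1 * z + + 0) (ℤₚ.*-identityˡ (g [ N ]))) ⟩
  ∑rows 1 N g + (+ 1 * g [ N ] + + 0) ∎
  where
  f : ℕ → ℤ
  f x = ∑rows 0 N (λ R → ind (below x R) * g (x ∷ R))
∑rows-max (suc l) N g = begin
  ∑rows (suc (suc l)) (suc N) g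
    ≡⟨ ∑rows-suc (suc l) (suc N) g ⟩
  ∑ (upTo (suc N)) (λ x → ∑rows (suc l) (suc N) (gˣ x))
    ≡⟨ ∑-cong (upTo (suc N)) (λ x → ∑rows-max l N (gˣ x)) ⟩
  ∑ (upTo (suc N)) (λ x → ∑rows (suc l) N (gˣ x) + ∑rows l N (λ R → gˣ x (R ∷ʳ N)))
    ≡⟨ ∑-upTo-suc N _ ⟩
  ∑ (upTo N) (λ x → ∑rows (suc l) N (gˣ x) + ∑rows l N (λ R → gˣ x (R ∷ʳ N)))
    + (∑rows (suc l) N (gˣ N) + ∑rows l N (λ R → gˣ N (R ∷ʳ N)))
    ≡⟨ cong₂ _+_ (∑-+ (upTo N) (λ x → ∑rows (suc l) N (gˣ x)) _) (cong₂ _+_ top₁ top₂) ⟩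
  ∑ (upTo N) (λ x → ∑rows (suc l) N (gˣ x)) + ∑ (upTo N) (λ x → ∑rows l N (λ R → gˣ x (R ∷ʳ N))) + (+ 0 + + 0)
    ≡⟨ ℤₚ.+-identityʳ _ ⟩
  ∑ (upTo N) (λ x → ∑rows (suc l) N (gˣ x)) + ∑ (upTo N) (λ x → ∑rows l N (λ R → gˣ x (R ∷ʳ N)))
    ≡⟨ cong₂ _+_ (sym (∑rows-suc (suc l) N g))
         (trans (∑-cong∈ (upTo N) (λ x x∈ → ∑rows-cong l N (λ R _ _ →
                   cong (λ z → ind z * g (x ∷ R ∷ʳ N)) (below-∷ʳ R (∈-upTo⁻ x∈)))))
                (sym (∑rows-suc l N (λ R → g (R ∷ʳ N))))) ⟩
  ∑rows (suc (suc l)) N g + ∑rows (suc l) N (λ R → g (R ∷ʳ N)) ∎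
  where
  gˣ : ℕ → List ℕ → ℤ
  gˣ x R = ind (below x R) * g (x ∷ R)
  below-∷ʳ : ∀ {x} R → x < N → below x (R ∷ʳ N) ≡ below x R
  below-∷ʳ []      x<N = <ᵇ-true x<N
  below-∷ʳ (y ∷ R) x<N = refl
  top₁ : ∑rows (suc l) N (gˣ N) ≡ + 0
  top₁ = trans (∑rows-cong (suc l) N
    (λ { (y ∷ R) _ (y<N ∷ _) → cong (λ z → ind z * g (N ∷ y ∷ R)) (<ᵇ-false (ℕₚ.<⇒≤ y<N)) }))
    (∑rows-zero (suc l) N)
  top₂ : ∑rows l N (λ R → gˣ N (R ∷ʳ N)) ≡ + 0
  top₂ = trans (∑rows-cong l N
    (λ { []      _ _         → cong (λ z → ind z * g (N ∷ N ∷ [])) (<ᵇ-false {N} ℕₚ.≤-refl)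
       ; (y ∷ R) _ (y<N ∷ _) → cong (λ z → ind z * g (N ∷ y ∷ R ∷ʳ N)) (<ᵇ-false (ℕₚ.<⇒≤ y<N)) }))
    (∑rows-zero l N)

disj : List ℕ → List ℕ → Bool
disj U F = all (λ u → not (any (u ≡ᵇ_) F)) U

colpair : List ℕ → List ℕ → Bool
colpair R R′ = all (λ p → proj₁ p <ᵇ proj₂ p) (zip R R′)

-- Entries U are already used, and R is the row above.
fits : List ℕ → List ℕ → List ℕ → Bool
fits U R R′ = disj U R′ ∧ noDuplicates R′ ∧ colpair R R′

std : List ℕ → List ℕ → List (List ℕ) → Bool
std U R []       = true
std U R (R′ ∷ F) = strictlyIncreasing R′ ∧ fits U R R′ ∧ std (R′ ++ U) R′ F

all-++ : {A : Set} (p : A → Bool) (xs ys : List A) → all p (xs ++ ys) ≡ all p xs ∧ all p ys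
all-++ p []       ys = refl
all-++ p (x ∷ xs) ys with p x
... | true  = all-++ p xs ys
... | false = refl

any-++ : (u : ℕ) (xs ys : List ℕ) → not (any (u ≡ᵇ_) (xs ++ ys)) ≡ not (any (u ≡ᵇ_) xs) ∧ not (any (u ≡ᵇ_) ys)
any-++ u []       ys = refl
any-++ u (x ∷ xs) ys with u ≡ᵇ x
... | true  = refl
... | false = any-++ u xs ys

interchange-∧ : ∀ a b c d → (a ∧ b) ∧ (c ∧ d) ≡ (a ∧ c) ∧ (b ∧ d)
interchange-∧ true  true  c d = refl
interchange-∧ true  false true  d = refl
interchange-∧ true  false false d = refl
interchange-∧ false b c d = refl

disj-++ʳ : ∀ U F G → disj U (F ++ G) ≡ disj U F ∧ disj U G
disj-++ʳ []      F G = refl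
disj-++ʳ (u ∷ U) F G = trans (cong₂ _∧_ (any-++ u F G) (disj-++ʳ U F G))
  (interchange-∧ (not (any (u ≡ᵇ_) F)) _ (disj U F) _)

disj-[] : ∀ U → disj U [] ≡ true
disj-[] []      = refl
disj-[] (u ∷ U) = disj-[] U

noDuplicates-++ : ∀ F G → noDuplicates (F ++ G) ≡ noDuplicates F ∧ (disj F G ∧ noDuplicates G)
noDuplicates-++ []      G = refl
noDuplicates-++ (x ∷ F) G = trans (cong₂ _∧_ (any-++ x F G) (noDuplicates-++ F G))
  (lem (not (any (x ≡ᵇ_) F)) (not (any (x ≡ᵇ_) G)) (noDuplicates F) (disj F G) (noDuplicates G))
  where
  lem : ∀ a b c d e → (a ∧ b) ∧ (c ∧ (d ∧ e)) ≡ (a ∧ c) ∧ ((b ∧ d) ∧ e)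
  lem false b c d e = refl
  lem true true true d e = refl
  lem true true false d e = refl
  lem true false true d e = refl
  lem true false false d e = refl

-- Disjointness of each row from the entries used before it adds up to the absence of duplicates in
-- the whole filling.
std-spec : ∀ U R F → std U R F ≡
           disj U (concat F) ∧ noDuplicates (concat F) ∧ all strictlyIncreasing F ∧ columnsIncreasing (R ∷ F)
std-spec U R []       = sym (cong (_∧ true) (disj-[] U))
std-spec U R (R′ ∷ F) = begin
  strictlyIncreasing R′ ∧ fits U R R′ ∧ std (R′ ++ U) R′ F
    ≡⟨ cong (λ z → strictlyIncreasing R′ ∧ fits U R R′ ∧ z) (std-spec (R′ ++ U) R′ F) ⟩
  strictlyIncreasing R′ ∧ fits U R R′ ∧
    (disj (R′ ++ U) C ∧ noDuplicates C ∧ all strictlyIncreasing F ∧ columnsIncreasing (R′ ∷ F))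
    ≡⟨ cong (λ z → strictlyIncreasing R′ ∧ fits U R R′ ∧
         (z ∧ noDuplicates C ∧ all strictlyIncreasing F ∧ columnsIncreasing (R′ ∷ F))) (all-++ _ R′ U) ⟩
  strictlyIncreasing R′ ∧ fits U R R′ ∧
    ((disj R′ C ∧ disj U C) ∧ noDuplicates C ∧ all strictlyIncreasing F ∧ columnsIncreasing (R′ ∷ F))
    ≡⟨ lem (strictlyIncreasing R′) (disj U R′) (noDuplicates R′) (colpair R R′) (disj R′ C) (disj U C)
           (noDuplicates C) (all strictlyIncreasing F) (columnsIncreasing (R′ ∷ F)) ⟩
  (disj U R′ ∧ disj U C) ∧ (noDuplicates R′ ∧ (disj R′ C ∧ noDuplicates C)) ∧
    (strictlyIncreasing R′ ∧ all strictlyIncreasing F) ∧ (colpair R R′ ∧ columnsIncreasing (R′ ∷ F))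
    ≡⟨ cong₂ (λ u v → u ∧ v ∧ (strictlyIncreasing R′ ∧ all strictlyIncreasing F) ∧
                        (colpair R R′ ∧ columnsIncreasing (R′ ∷ F)))
         (sym (disj-++ʳ U R′ C)) (sym (noDuplicates-++ R′ C)) ⟩
  _ ∎
  where
  C = concat F
  lem : ∀ i d n c r u e f g →
        i ∧ (d ∧ n ∧ c) ∧ ((r ∧ u) ∧ e ∧ f ∧ g) ≡ (d ∧ u) ∧ (n ∧ (r ∧ e)) ∧ (i ∧ f) ∧ (c ∧ g)
  lem i d n c r u e f g = T-ext
    (λ h → let hi , h₁ = T-∧⁻ {i} h
               h₂ , h₃ = T-∧⁻ {d ∧ n ∧ c} h₁
               hd , h₄ = T-∧⁻ {d} h₂
               hn , hc = T-∧⁻ {n} h₄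
               h₅ , h₆ = T-∧⁻ {r ∧ u} h₃
               hr , hu = T-∧⁻ {r} h₅
               he , h₇ = T-∧⁻ {e} h₆
               hf , hg = T-∧⁻ {f} h₇
           in T-∧⁺ (T-∧⁺ hd hu) (T-∧⁺ (T-∧⁺ hn (T-∧⁺ hr he)) (T-∧⁺ (T-∧⁺ hi hf) (T-∧⁺ hc hg))))
    (λ h → let h₁ , h₂ = T-∧⁻ {d ∧ u} h
               hd , hu = T-∧⁻ {d} h₁
               h₃ , h₄ = T-∧⁻ {n ∧ (r ∧ e)} h₂
               hn , h₅ = T-∧⁻ {n} h₃
               hr , he = T-∧⁻ {r} h₅
               h₆ , h₇ = T-∧⁻ {i ∧ f} h₄
               hi , hf = T-∧⁻ {i} h₆
               hc , hg = T-∧⁻ {c} h₇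
           in T-∧⁺ hi (T-∧⁺ (T-∧⁺ hd (T-∧⁺ hn hc)) (T-∧⁺ (T-∧⁺ hr hu) (T-∧⁺ he (T-∧⁺ hf hg)))))

std≡isStandard : ∀ F → std [] [] F ≡ isStandard F
std≡isStandard F = trans (std-spec [] [] F)
  (cong (λ z → noDuplicates (concat F) ∧ all strictlyIncreasing F ∧ z) (lem F))
  where
  lem : ∀ F → columnsIncreasing ([] ∷ F) ≡ columnsIncreasing F
  lem []      = refl
  lem (R ∷ F) = refl

-- The bound on the entries is independent of the number of cells, since the rows below a given one
-- are counted as a shape of their own with the same supply of values.
numStd : List ℕ → ℕ → List ℕ → List ℕ → ℤ
numStd μ N U R = ∑ (fillings μ N) (ind ∘ std U R)

numStd-∷ : ∀ l μ N U R → numStd (l ∷ μ) N U R ≡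
           ∑rows l N (λ R′ → ind (fits U R R′) * numStd μ N (R′ ++ U) R′)
numStd-∷ l μ N U R = trans (∑-concatMap (λ R′ → map (R′ ∷_) (fillings μ N)) (listsOfLength l (upTo N)) _)
  (∑-cong (listsOfLength l (upTo N)) λ R′ → trans (∑-map (R′ ∷_) (fillings μ N) _)
    (trans (∑-cong (fillings μ N) (λ F → trans
              (ind-∧ (strictlyIncreasing R′) (fits U R R′ ∧ std (R′ ++ U) R′ F))
              (cong (ind (strictlyIncreasing R′) *_) (ind-∧ (fits U R R′) (std (R′ ++ U) R′ F)))))
      (trans (∑-* (ind (strictlyIncreasing R′)) (fillings μ N) _)
             (cong (ind (strictlyIncreasing R′) *_) (∑-* (ind (fits U R R′)) (fillings μ N) _)))))

numSYT≡numStd : ∀ μ → + numSYT μ ≡ numStd μ (sum μ) [] []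
numSYT≡numStd μ = trans (length-filterᵇ isStandard (fillings μ (sum μ)))
  (∑-cong (fillings μ (sum μ)) (λ F → cong ind (sym (std≡isStandard F))))

any-false : ∀ {N} R → All (_< N) R → ∀ {u} → N ≤ u → any (u ≡ᵇ_) R ≡ false
any-false []      []          N≤u = refl
any-false (x ∷ R) (x<N ∷ R<) {u} N≤u
  rewrite ¬T⇒false {u ≡ᵇ x} (λ h → ℕₚ.<⇒≢ (ℕₚ.<-≤-trans x<N N≤u) (sym (ℕₚ.≡ᵇ⇒≡ u x h))) = any-false R R< N≤u

≡ᵇ-refl : ∀ x → (x ≡ᵇ x) ≡ true
≡ᵇ-refl x = T-ext (λ _ → tt) (λ _ → ℕₚ.≡⇒≡ᵇ x x refl)

any-∷ʳ : ∀ u R N → u < N → any (u ≡ᵇ_) (R ∷ʳ N) ≡ any (u ≡ᵇ_) R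
any-∷ʳ u []      N u<N rewrite ¬T⇒false {u ≡ᵇ N} (λ h → ℕₚ.<⇒≢ u<N (ℕₚ.≡ᵇ⇒≡ u N h)) = refl
any-∷ʳ u (x ∷ R) N u<N with u ≡ᵇ x
... | true  = refl
... | false = any-∷ʳ u R N u<N

any-last : ∀ R N → any (N ≡ᵇ_) (R ∷ʳ N) ≡ true
any-last []      N rewrite ≡ᵇ-refl N = refl
any-last (x ∷ R) N with N ≡ᵇ x
... | true  = refl
... | false = any-last R N

disj-used : ∀ {U N} R → N ∈ U → disj U (R ∷ʳ N) ≡ false
disj-used {u ∷ U} {N} R (here refl) rewrite any-last R N = refl
disj-used {u ∷ U} {N} R (there p) with not (any (u ≡ᵇ_) (R ∷ʳ N))
... | true  = disj-used R p
... | false = refl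

-- Every row that ends in N fails the disjointness test, so admitting this value gains nothing.
numStd-used : ∀ μ N U R → N ∈ U → numStd μ (suc N) U R ≡ numStd μ N U R
numStd-used []          N U R N∈U = refl
numStd-used (zero ∷ μ)  N U R N∈U = trans (numStd-∷ 0 μ (suc N) U R)
  (trans (cong (λ z → + 1 * (ind (fits U R []) * z) + + 0) (numStd-used μ N U [] N∈U)) (sym (numStd-∷ 0 μ N U R)))
numStd-used (suc l ∷ μ) N U R N∈U = begin
  numStd (suc l ∷ μ) (suc N) U R
    ≡⟨ numStd-∷ (suc l) μ (suc N) U R ⟩
  ∑rows (suc l) (suc N) g
    ≡⟨ ∑rows-max l N g ⟩
  ∑rows (suc l) N g + ∑rows l N (λ R′ → g (R′ ∷ʳ N))
    ≡⟨ cong₂ _+_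
         (∑rows-cong (suc l) N (λ R′ _ _ → cong (ind (fits U R R′) *_)
            (numStd-used μ N (R′ ++ U) R′ (∈-++⁺ʳ R′ N∈U))))
         (trans (∑rows-cong l N (λ R′ _ _ → cong (λ z → ind (z ∧ noDuplicates (R′ ∷ʳ N) ∧ colpair R (R′ ∷ʳ N))
                   * numStd μ (suc N) ((R′ ∷ʳ N) ++ U) (R′ ∷ʳ N)) (disj-used R′ N∈U)))
                (∑rows-zero l N)) ⟩
  ∑rows (suc l) N (λ R′ → ind (fits U R R′) * numStd μ N (R′ ++ U) R′) + + 0
    ≡⟨ ℤₚ.+-identityʳ _ ⟩
  ∑rows (suc l) N (λ R′ → ind (fits U R R′) * numStd μ N (R′ ++ U) R′)
    ≡⟨ numStd-∷ (suc l) μ N U R ⟨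
  numStd (suc l ∷ μ) N U R ∎
  where
  g : List ℕ → ℤ
  g R′ = ind (fits U R R′) * numStd μ (suc N) (R′ ++ U) R′

numStd-cong : ∀ μ N {U U′ R R′} →
  (∀ {Q} → All (_< N) Q → disj U Q ≡ disj U′ Q) →
  (∀ {l ls Q} → μ ≡ l ∷ ls → length Q ≡ l → All (_< N) Q → colpair R Q ≡ colpair R′ Q) →
  numStd μ N U R ≡ numStd μ N U′ R′
numStd-cong []      N eU eR = refl
numStd-cong (l ∷ μ) N {U} {U′} {R} {R′} eU eR = begin
  numStd (l ∷ μ) N U R   ≡⟨ numStd-∷ l μ N U R ⟩
  ∑rows l N (λ Q → ind (fits U R Q) * numStd μ N (Q ++ U) Q)
    ≡⟨ ∑rows-cong l N (λ Q len Q< → cong₂ _*_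
         (cong₂ (λ a b → ind (a ∧ noDuplicates Q ∧ b)) (eU Q<) (eR refl len Q<))
         (numStd-cong μ N (λ {Q′} Q′< → trans (all-++ _ Q U)
            (trans (cong (disj Q Q′ ∧_) (eU Q′<)) (sym (all-++ _ Q U′))))
            (λ _ _ _ → refl))) ⟩
  ∑rows l N (λ Q → ind (fits U′ R′ Q) * numStd μ N (Q ++ U′) Q)
    ≡⟨ numStd-∷ l μ N U′ R′ ⟨
  numStd (l ∷ μ) N U′ R′ ∎

disj-∷ʳ : ∀ {N} U R → All (_< N) U → disj U (R ∷ʳ N) ≡ disj U R
disj-∷ʳ []      R []         = refl
disj-∷ʳ {N} (u ∷ U) R (u< ∷ U<) = cong₂ (λ a b → not a ∧ b) (any-∷ʳ u R N u<) (disj-∷ʳ U R U<)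

noDuplicates-∷ʳ : ∀ {N} R → All (_< N) R → noDuplicates (R ∷ʳ N) ≡ noDuplicates R
noDuplicates-∷ʳ []      []         = refl
noDuplicates-∷ʳ {N} (x ∷ R) (x< ∷ R<) = cong₂ (λ a b → not a ∧ b) (any-∷ʳ x R N x<) (noDuplicates-∷ʳ R R<)

colpair-∷ʳ-below : ∀ {N} R R′ → All (_< N) R → length R′ < length R → colpair R (R′ ∷ʳ N) ≡ colpair R R′
colpair-∷ʳ-below {N} (x ∷ R) []       (x< ∷ R<) len rewrite <ᵇ-true x< = lem R
  where
  lem : ∀ R → colpair R [] ≡ true
  lem []      = refl
  lem (x ∷ R) = refl
colpair-∷ʳ-below (x ∷ R) (y ∷ R′) (x< ∷ R<) (s≤s len) = cong ((x <ᵇ y) ∧_) (colpair-∷ʳ-below R R′ R< len)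

colpair-∷ʳ-above : ∀ {N} R Q → length Q ≤ length R → colpair (R ∷ʳ N) Q ≡ colpair R Q
colpair-∷ʳ-above []      []      len = refl
colpair-∷ʳ-above (x ∷ R) []      len = refl
colpair-∷ʳ-above (x ∷ R) (y ∷ Q) (s≤s len) = cong ((x <ᵇ y) ∧_) (colpair-∷ʳ-above R Q len)

-- The last entry of Q stands under N and would have to exceed it.
colpair-∷ʳ-same : ∀ {N} R Q → All (_< N) Q → length Q ≡ suc (length R) → colpair (R ∷ʳ N) Q ≡ false
colpair-∷ʳ-same []      (y ∷ [])    (y< ∷ []) len = cong (_∧ true) (<ᵇ-false (ℕₚ.<⇒≤ y<))
colpair-∷ʳ-same (x ∷ R) (y ∷ Q) (_ ∷ Q<) len with x <ᵇ y
... | true  = colpair-∷ʳ-same R Q Q< (ℕₚ.suc-injective len)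
... | false = refl

disj-append : ∀ {N U} R′ {Q} → All (_< N) Q → disj ((R′ ∷ʳ N) ++ U) Q ≡ disj (R′ ++ U) Q
disj-append []       {Q} Q< rewrite any-false Q Q< ℕₚ.≤-refl = refl
disj-append {N} (x ∷ R′) {Q} Q< = cong (not (any (x ≡ᵇ_) Q) ∧_) (disj-append R′ Q<)

-- The empty list stands for the missing row above the first one; `zip` compares nothing with it.
Admissible : List ℕ → List ℕ → Set
Admissible R []      = ⊤
Admissible R (l ∷ _) = R ≡ [] ⊎ l ≤ length R

fits-∷ʳ : ∀ {N U R x} R′ → All (_< N) U → All (_< N) R → R ≡ [] ⊎ suc x ≤ length R →
          length R′ ≡ x → All (_< N) R′ → fits U R (R′ ∷ʳ N) ≡ fits U R R′
fits-∷ʳ {U = U} R′ U< R< adm len R′< =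
  cong₂ _∧_ (disj-∷ʳ U R′ U<) (cong₂ _∧_ (noDuplicates-∷ʳ R′ R′<) (col adm R<))
  where
  col : ∀ {R} → R ≡ [] ⊎ _ → All _ R → colpair R (R′ ∷ʳ _) ≡ colpair R R′
  col (inj₁ refl) _ = refl
  col (inj₂ h) R<   = colpair-∷ʳ-below _ R′ R< (subst (_< _) (sym len) h)

-- The value N is absent or ends exactly one row. The entry above it is smaller in any case, and an
-- entry under it would have to be larger, so N occupies a corner. Its deletion leaves a filling of
-- one of the shapes in `rem`.
numStd-max : ∀ a μ N U R → Part μ → All (_< N) U → All (_< N) R → Admissible R μ →
             numStd μ (suc N) U R ≡ numStd μ N U R + ∑ (rem a μ) (λ (_ , l) → numStd l N U R)
numStd-max a []         N U R pt U< R< adm = refl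
numStd-max a (zero ∷ μ) N U R (_ , () ∷ _) U< R< adm
numStd-max a (suc x ∷ []) N U R pt U< R< adm = begin
  numStd (suc x ∷ []) (suc N) U R
    ≡⟨ numStd-∷ (suc x) [] (suc N) U R ⟩
  ∑rows (suc x) (suc N) g
    ≡⟨ ∑rows-max x N g ⟩
  ∑rows (suc x) N g + ∑rows x N (λ R′ → g (R′ ∷ʳ N))
    ≡⟨ cong₂ _+_ (sym (numStd-∷ (suc x) [] N U R))
         (trans (∑rows-cong x N (λ R′ len R′< → cong (λ z → ind z * + 1) (fits-∷ʳ R′ U< R< adm len R′<)))
                (sym (numStd-∷ x [] N U R))) ⟩
  numStd (suc x ∷ []) N U R + numStd (x ∷ []) N U R
    ≡⟨ cong (_+_ (numStd (suc x ∷ []) N U R)) (last x) ⟩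
  numStd (suc x ∷ []) N U R + ∑ (rem a (suc x ∷ [])) (λ (_ , l) → numStd l N U R) ∎
  where
  g : List ℕ → ℤ
  g R′ = ind (fits U R R′) * + 1
  colpair-[] : ∀ R → colpair R [] ≡ true
  colpair-[] []      = refl
  colpair-[] (x ∷ R) = refl
  last : ∀ x → numStd (x ∷ []) N U R ≡ ∑ (rem a (suc x ∷ [])) (λ (_ , l) → numStd l N U R)
  last zero    = trans (numStd-∷ 0 [] N U R)
    (cong (λ z → + 1 * (ind z * + 1) + + 0) (cong₂ (λ u v → u ∧ true ∧ v) (disj-[] U) (colpair-[] R)))
  last (suc x) = sym (ℤₚ.+-identityʳ _)
numStd-max a (suc x ∷ μ@(y ∷ ys)) N U R pt@(wd , _) U< R< adm = begin
  numStd (suc x ∷ μ) (suc N) U R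
    ≡⟨ numStd-∷ (suc x) μ (suc N) U R ⟩
  ∑rows (suc x) (suc N) g
    ≡⟨ ∑rows-max x N g ⟩
  ∑rows (suc x) N g + ∑rows x N (λ R′ → g (R′ ∷ʳ N))
    ≡⟨ cong₂ _+_ (part₁ (λ U R → numStd-max (suc a) μ N U R)) part₂ ⟩
  numStd (suc x ∷ μ) N U R + ∑ (map (consStep (suc x)) (rem (suc a) μ)) f + ∑ (corner a x y ys) f
    ≡⟨ lem (numStd (suc x ∷ μ) N U R) (∑ (map (consStep (suc x)) (rem (suc a) μ)) f) (∑ (corner a x y ys) f) ⟩
  numStd (suc x ∷ μ) N U R + (∑ (corner a x y ys) f + ∑ (map (consStep (suc x)) (rem (suc a) μ)) f)
    ≡⟨ cong (_+_ (numStd (suc x ∷ μ) N U R)) (∑-++ (corner a x y ys) _ f) ⟨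
  numStd (suc x ∷ μ) N U R + ∑ (rem a (suc x ∷ μ)) f ∎
  where
  f : Step → ℤ
  f (_ , l) = numStd l N U R
  g : List ℕ → ℤ
  g R′ = ind (fits U R R′) * numStd μ (suc N) (R′ ++ U) R′
  lem : ∀ a b c → a + b + c ≡ a + (c + b)
  lem = solve-∀

  part₁ : (∀ U R → Part μ → All (_< N) U → All (_< N) R → Admissible R μ →
             numStd μ (suc N) U R ≡ numStd μ N U R + ∑ (rem (suc a) μ) (λ (_ , l) → numStd l N U R)) →
          ∑rows (suc x) N g ≡ numStd (suc x ∷ μ) N U R + ∑ (map (consStep (suc x)) (rem (suc a) μ)) f
  part₁ ih = begin
    ∑rows (suc x) N g
      ≡⟨ ∑rows-cong (suc x) N (λ R′ len R′< → trans
           (cong (ind (fits U R R′) *_) (ih (R′ ++ U) R′ (part-tail pt)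
              (Allₚ.++⁺ R′< U<) R′< (inj₂ (subst (y ≤_) (sym len) (wd-head ys wd)))))
           (trans (ℤₚ.*-distribˡ-+ (ind (fits U R R′)) (numStd μ N (R′ ++ U) R′) _)
             (cong (_+_ (ind (fits U R R′) * numStd μ N (R′ ++ U) R′))
               (sym (∑-* (ind (fits U R R′)) (rem (suc a) μ) _))))) ⟩
    ∑rows (suc x) N (λ R′ → ind (fits U R R′) * numStd μ N (R′ ++ U) R′
      + ∑ (rem (suc a) μ) (λ (_ , l) → ind (fits U R R′) * numStd l N (R′ ++ U) R′))
      ≡⟨ ∑rows-+ (suc x) N (λ R′ → ind (fits U R R′) * numStd μ N (R′ ++ U) R′) _ ⟩
    _ ≡⟨ cong₂ _+_ (sym (numStd-∷ (suc x) μ N U R))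
          (trans (∑rows-∑ (suc x) N (rem (suc a) μ) (λ (_ , l) R′ → ind (fits U R R′) * numStd l N (R′ ++ U) R′))
            (trans (∑-cong (rem (suc a) μ) (λ (_ , l) → sym (numStd-∷ (suc x) l N U R)))
                   (sym (∑-map (consStep (suc x)) (rem (suc a) μ) f)))) ⟩
    numStd (suc x ∷ μ) N U R + ∑ (map (consStep (suc x)) (rem (suc a) μ)) f ∎

  part₂ : ∑rows x N (λ R′ → g (R′ ∷ʳ N)) ≡ ∑ (corner a x y ys) f
  part₂ = trans (∑rows-cong x N (λ R′ len R′< → cong₂ (λ u v → ind u * v) (fits-∷ʳ R′ U< R< adm len R′<)
                   (numStd-used μ N ((R′ ∷ʳ N) ++ U) (R′ ∷ʳ N) (∈-++⁺ˡ (∈-++⁺ʳ R′ (here refl))))))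
                corner-case
    where
    corner-case : ∑rows x N (λ R′ → ind (fits U R R′) * numStd μ N ((R′ ∷ʳ N) ++ U) (R′ ∷ʳ N)) ≡ ∑ (corner a x y ys) f
    corner-case with y ≤ᵇ x in eq
    ... | true = trans (trans
        (∑rows-cong x N (λ R′ len R′< → cong (ind (fits U R R′) *_)
          (numStd-cong μ N (disj-append R′)
            (λ { {Q = Q} refl lenQ Q< → colpair-∷ʳ-above R′ Q
               (subst₂ _≤_ (sym lenQ) (sym len) (ℕₚ.≤ᵇ⇒≤ y x (subst T (sym eq) tt))) }))))
        (sym (numStd-∷ x μ N U R)))
        (sym (ℤₚ.+-identityʳ _))
    -- The next row has length x + 1, which puts an entry under N.
    ... | false = trans (∑rows-cong x N (λ R′ len R′< →
        trans (cong (ind (fits U R R′) *_) (begin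
          numStd μ N ((R′ ∷ʳ N) ++ U) (R′ ∷ʳ N)
            ≡⟨ numStd-∷ y ys N ((R′ ∷ʳ N) ++ U) (R′ ∷ʳ N) ⟩
          ∑rows y N (λ Q → ind (fits ((R′ ∷ʳ N) ++ U) (R′ ∷ʳ N) Q) * numStd ys N (Q ++ (R′ ∷ʳ N) ++ U) Q)
            ≡⟨ ∑rows-cong y N (λ Q lenQ Q< → cong (_* numStd ys N (Q ++ (R′ ∷ʳ N) ++ U) Q) (cong ind
                 (trans (cong (λ z → disj ((R′ ∷ʳ N) ++ U) Q ∧ noDuplicates Q ∧ z)
                    (colpair-∷ʳ-same R′ Q Q< (trans lenQ (trans y≡ (cong suc (sym len))))))
                   (∧-false (disj ((R′ ∷ʳ N) ++ U) Q) (noDuplicates Q))))) ⟩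
          ∑rows y N (λ Q → + 0)
            ≡⟨ ∑rows-zero y N ⟩
          + 0 ∎))
        (ℤₚ.*-zeroʳ (ind (fits U R R′)))))
        (∑rows-zero x N)
      where
      y≡ : y ≡ suc x
      y≡ = ℕₚ.≤-antisym (wd-head ys wd) (ℕₚ.≰⇒> (λ y≤x → subst T eq (ℕₚ.≤⇒≤ᵇ y≤x)))
      ∧-false : ∀ a b → a ∧ b ∧ false ≡ false
      ∧-false true  true  = refl
      ∧-false true  false = refl
      ∧-false false b     = refl

admissible-[] : ∀ μ → Admissible [] μ
admissible-[] []      = tt
admissible-[] (l ∷ _) = inj₁ refl

-- The recursion on the largest value replaces a pigeonhole argument: a term keeps all cells or
-- loses one, while one value is lost, until no value is left.
numStd-small : ∀ N μ → Part μ → N < sum μ → numStd μ N [] [] ≡ + 0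
numStd-small N [] pt ()
numStd-small zero    (suc l ∷ μ) pt N<  = numStd-∷ (suc l) μ 0 [] []
numStd-small zero    (zero ∷ μ) (_ , () ∷ _) N<
numStd-small (suc N) μ pt N< = begin
  numStd μ (suc N) [] []
    ≡⟨ numStd-max 0 μ N [] [] pt [] [] (admissible-[] μ) ⟩
  numStd μ N [] [] + ∑ (rem 0 μ) (λ (_ , l) → numStd l N [] [])
    ≡⟨ cong₂ _+_ (numStd-small N μ pt (ℕₚ.<-trans (ℕₚ.n<1+n N) N<))
         (trans (∑-cong∈ (rem 0 μ) (λ (c , l) i → let cov , ptl = rem⇒cov 0 μ pt i in
                   numStd-small N l ptl (ℕₚ.≤-pred (subst (suc N <_) (cov-sum cov) N<))))
                (∑-zero (rem 0 μ))) ⟩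
  + 0 ∎

-- The branching rule of standard tableaux: there are just enough values, so fillings without the
-- largest one do not exist.
numSYT-rem : ∀ n μ → Part μ → sum μ ≡ suc n → + numSYT μ ≡ ∑ (rem 0 μ) (λ (_ , l) → + numSYT l)
numSYT-rem n μ pt s = begin
  + numSYT μ
    ≡⟨ numSYT≡numStd μ ⟩
  numStd μ (sum μ) [] []
    ≡⟨ cong (λ z → numStd μ z [] []) s ⟩
  numStd μ (suc n) [] []
    ≡⟨ numStd-max 0 μ n [] [] pt [] [] (admissible-[] μ) ⟩
  numStd μ n [] [] + ∑ (rem 0 μ) (λ (_ , l) → numStd l n [] [])
    ≡⟨ cong₂ _+_ (numStd-small n μ pt (ℕₚ.≤-reflexive (sym s)))
         (∑-cong∈ (rem 0 μ) (λ (c , l) i → let cov , ptl = rem⇒cov 0 μ pt i in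
            trans (cong (λ z → numStd l z [] []) (ℕₚ.suc-injective (trans (sym s) (cov-sum cov))))
                  (sym (numSYT≡numStd l)))) ⟩
  + 0 + ∑ (rem 0 μ) (λ (_ , l) → + numSYT l)
    ≡⟨ ℤₚ.+-identityˡ _ ⟩
  ∑ (rem 0 μ) (λ (_ , l) → + numSYT l) ∎

-- Enumeration of partitions and of the covering pairs in Young's lattice

∑-↭ : {A : Set} {xs ys : List A} (f : A → ℤ) → xs Bag.↭ ys → ∑ xs f ≡ ∑ ys f
∑-↭ f Bag.refl         = refl
∑-↭ f (Bag.prep x p)   = cong (_+_ (f x)) (∑-↭ f p)
∑-↭ f (Bag.swap x y p) = trans (cong (λ z → f x + (f y + z)) (∑-↭ f p)) (lem (f x) (f y) _)
  where
  lem : ∀ a b c → a + (b + c) ≡ b + (a + c)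
  lem = solve-∀
∑-↭ f (Bag.trans p p′) = trans (∑-↭ f p) (∑-↭ f p′)

∑-set : {A : Set} {xs ys : List A} (f : A → ℤ) → Unique xs → Unique ys →
        (∀ {x} → x ∈ xs → x ∈ ys) → (∀ {x} → x ∈ ys → x ∈ xs) → ∑ xs f ≡ ∑ ys f
∑-set f u v h h′ = ∑-↭ f (∼bag⇒↭ (unique∧set⇒bag u v (mk⇔ h h′)))

concatMap-unique : {A B : Set} (f : A → List B) {xs : List A} → Unique xs → (∀ x → x ∈ xs → Unique (f x)) →
                   (∀ {x y z} → z ∈ f x → z ∈ f y → x ≡ y) → Unique (concatMap f xs)
concatMap-unique f []            uf key = []
concatMap-unique f {x ∷ xs} (x∉ ∷ u) uf key =
  Uniqueₚ.++⁺ (uf x (here refl)) (concatMap-unique f u (λ y → uf y ∘ there) key)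
    (λ (z∈x , z∈xs) → let y , y∈ , z∈y = find (∈-concatMap⁻ f {xs = xs} z∈xs) in
       All.lookup x∉ y∈ (key z∈x z∈y))

∈-filterᵇ⁻ : {A : Set} (p : A → Bool) (xs : List A) {x : A} → x ∈ filterᵇ p xs → x ∈ xs × T (p x)
∈-filterᵇ⁻ p xs = ∈-filter⁻ (T? ∘ p) {xs = xs}

∈-filterᵇ⁺ : {A : Set} (p : A → Bool) {xs : List A} {x : A} → x ∈ xs → T (p x) → x ∈ filterᵇ p xs
∈-filterᵇ⁺ p = ∈-filter⁺ (T? ∘ p)

filterᵇ-unique : {A : Set} (p : A → Bool) {xs : List A} → Unique xs → Unique (filterᵇ p xs)
filterᵇ-unique p = Uniqueₚ.filter⁺ (T? ∘ p)

candidates : ℕ → List (List ℕ)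
candidates n = concatMap (λ L → listsOfLength L (map suc (upTo n))) (upTo (suc n))

listsOfLength-unique : ∀ l {vals} → Unique vals → Unique (listsOfLength l vals)
listsOfLength-unique zero    u = [] ∷ []
listsOfLength-unique (suc l) {vals} u = concatMap-unique (λ x → map (x ∷_) (listsOfLength l vals)) u
  (λ x _ → Uniqueₚ.map⁺ Listₚ.∷-injectiveʳ (listsOfLength-unique l u))
  (λ {x} {y} p q → let _ , _ , e = ∈-map⁻ (x ∷_) p ; _ , _ , e′ = ∈-map⁻ (y ∷_) q in
     Listₚ.∷-injectiveˡ (trans (sym e) e′))

∈-listsOfLength⁺ : ∀ {vals} R → All (_∈ vals) R → R ∈ listsOfLength (length R) vals
∈-listsOfLength⁺ []      []         = here refl
∈-listsOfLength⁺ {vals} (x ∷ R) (x∈ ∷ R∈) = ∈-concatMap⁺ (λ x → map (x ∷_) (listsOfLength (length R) vals))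
  (lose x∈ (∈-map⁺ (x ∷_) (∈-listsOfLength⁺ R R∈)))

partitions-unique : ∀ n → Unique (partitions n)
partitions-unique n = filterᵇ-unique (isPartitionOf n) (concatMap-unique (λ L → listsOfLength L vals) (Uniqueₚ.upTo⁺ (suc n))
  (λ L _ → listsOfLength-unique L (Uniqueₚ.map⁺ ℕₚ.suc-injective (Uniqueₚ.upTo⁺ n)))
  (λ {L} {L′} p q → trans (sym (proj₁ (∈-listsOfLength⁻ L p))) (proj₁ (∈-listsOfLength⁻ L′ q))))
  where vals = map suc (upTo n)

∈-partitions⁻ : ∀ n {μ} → μ ∈ partitions n → Part μ × sum μ ≡ n
∈-partitions⁻ n {μ} p =
  let h = proj₂ (∈-filterᵇ⁻ (isPartitionOf n) (candidates n) p)
      wd , h′ = T-∧⁻ {weaklyDecreasing μ} h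
      pos , s = T-∧⁻ {all (λ x → 0 <ᵇ x) μ} h′
  in (wd , All.map (λ {x} → ℕₚ.<ᵇ⇒< 0 x) (Allₚ.all⁺ (λ x → 0 <ᵇ x) μ pos)) , ℕₚ.≡ᵇ⇒≡ (sum μ) n s

part-≤sum : ∀ μ → All (_≤ sum μ) μ
part-≤sum []      = []
part-≤sum (x ∷ μ) = ℕₚ.m≤m+n x (sum μ) ∷ All.map (λ h → ℕₚ.≤-trans h (ℕₚ.m≤n+m (sum μ) x)) (part-≤sum μ)

length-≤sum : ∀ {μ} → All (0 <_) μ → length μ ≤ sum μ
length-≤sum []          = z≤n
length-≤sum (0<x ∷ pos) = ℕₚ.+-mono-≤ 0<x (length-≤sum pos)

∈-suc-upTo : ∀ {n x} → 0 < x → x ≤ n → x ∈ map suc (upTo n)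
∈-suc-upTo {x = suc x} _ x<n = ∈-map⁺ suc (∈-upTo⁺ x<n)

∈-partitions⁺ : ∀ {n μ} → Part μ → sum μ ≡ n → μ ∈ partitions n
∈-partitions⁺ {n} {μ} (wd , pos) refl = ∈-filterᵇ⁺ (isPartitionOf n)
  (∈-concatMap⁺ (λ L → listsOfLength L (map suc (upTo n)))
    (lose (∈-upTo⁺ (s≤s (length-≤sum pos)))
          (∈-listsOfLength⁺ μ (All.zipWith (λ (p , q) → ∈-suc-upTo p q) (pos , part-≤sum μ)))))
  (T-∧⁺ wd (T-∧⁺ (Allₚ.all⁻ (λ x → 0 <ᵇ x) (All.map ℕₚ.<⇒<ᵇ pos)) (ℕₚ.≡⇒≡ᵇ (sum μ) n refl)))

ups-unique : ∀ a l → Unique (ups a l)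
ups-unique a []       = [] ∷ []
ups-unique a (x ∷ xs) = Allₚ.map⁺ (All.universal (λ _ e → ℕₚ.1+n≢n (Listₚ.∷-injectiveˡ (cong proj₂ e))) (ups (suc a) xs))
  ∷ Uniqueₚ.map⁺ (λ e → cong₂ _,_ (cong proj₁ e) (Listₚ.∷-injectiveʳ (cong proj₂ e))) (ups-unique (suc a) xs)

rem-unique : ∀ a μ → Unique (rem a μ)
rem-unique a []                 = []
rem-unique a (zero ∷ xs)        = []
rem-unique a (suc x ∷ y ∷ ys)   = Uniqueₚ.++⁺ corner-unique
  (Uniqueₚ.map⁺ (λ e → cong₂ _,_ (cong proj₁ e) (Listₚ.∷-injectiveʳ (cong proj₂ e))) (rem-unique (suc a) (y ∷ ys)))
  (λ (p , q) → let e , _ = ∈-corner a x y ys p ; _ , _ , e′ = ∈-map⁻ (consStep (suc x)) q in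
     ℕₚ.1+n≢n (Listₚ.∷-injectiveˡ (cong proj₂ (trans (sym e′) e))))
  where
  corner-unique : Unique (corner a x y ys)
  corner-unique with y ≤ᵇ x
  ... | true  = [] ∷ []
  ... | false = []
rem-unique a (1 ∷ [])           = [] ∷ []
rem-unique a (suc (suc x) ∷ []) = [] ∷ []

Cover : Set
Cover = List ℕ × Step

-- Both sides run through the covering pairs between sizes n and n + 1, once from below and once
-- from above. Listed as triples (l, c, μ) they have no repetitions on either side, so equality of
-- the underlying sets is enough.
∑-exchange : ∀ n (H : List ℕ → ℤ → List ℕ → ℤ) →
  ∑ (partitions n) (λ l → ∑ (addable l) (λ (c , μ) → H l c μ)) ≡
  ∑ (partitions (suc n)) (λ μ → ∑ (rem 0 μ) (λ (c , l) → H l c μ))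
∑-exchange n H = begin
  ∑ (partitions n) (λ l → ∑ (addable l) (λ (c , μ) → H l c μ))
    ≡⟨ ∑-cong (partitions n) (λ l → ∑-map (l ,_) (addable l) H′) ⟨
  ∑ (partitions n) (λ l → ∑ (above l) H′)
    ≡⟨ ∑-concatMap above (partitions n) H′ ⟨
  ∑ (concatMap above (partitions n)) H′
    ≡⟨ ∑-set H′
         (concatMap-unique above (partitions-unique n)
           (λ l _ → Uniqueₚ.map⁺ (cong proj₂) (filterᵇ-unique (weaklyDecreasing ∘ proj₂) (ups-unique 0 l)))
           (λ {x} {y} p q → let _ , _ , e = ∈-map⁻ (x ,_) p ; _ , _ , e′ = ∈-map⁻ (y ,_) q in
              cong proj₁ (trans (sym e) e′)))
         (concatMap-unique below′ (partitions-unique (suc n))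
           (λ μ _ → Uniqueₚ.map⁺ (λ e → cong₂ _,_ (cong (proj₁ ∘ proj₂) e) (cong proj₁ e)) (rem-unique 0 μ))
           (λ {x} {y} p q → let _ , _ , e = ∈-map⁻ (flip x) p ; _ , _ , e′ = ∈-map⁻ (flip y) q in
              cong (proj₂ ∘ proj₂) (trans (sym e) e′)))
         up⇒down down⇒up ⟩
  ∑ (concatMap below′ (partitions (suc n))) H′
    ≡⟨ ∑-concatMap below′ (partitions (suc n)) H′ ⟩
  ∑ (partitions (suc n)) (λ μ → ∑ (below′ μ) H′)
    ≡⟨ ∑-cong (partitions (suc n)) (λ μ → ∑-map (flip μ) (rem 0 μ) H′) ⟩
  ∑ (partitions (suc n)) (λ μ → ∑ (rem 0 μ) (λ (c , l) → H l c μ)) ∎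
  where
  H′ : Cover → ℤ
  H′ (l , c , μ) = H l c μ
  flip : List ℕ → Step → Cover
  flip μ (c , l) = (l , c , μ)
  above : List ℕ → List Cover
  above l = map (l ,_) (addable l)
  below′ : List ℕ → List Cover
  below′ μ = map (flip μ) (rem 0 μ)
  up⇒down : ∀ {t} → t ∈ concatMap above (partitions n) → t ∈ concatMap below′ (partitions (suc n))
  up⇒down t∈ with find (∈-concatMap⁻ above {xs = partitions n} t∈)
  ... | l , l∈ , t∈′ with ∈-map⁻ (l ,_) t∈′
  ... | (c , μ) , s∈ , refl with ∈-filterᵇ⁻ (weaklyDecreasing ∘ proj₂) (ups 0 l) s∈ | ∈-partitions⁻ n l∈
  ... | up , wd | ptl@(_ , pos) , s =
    let cov = ups⇒cov 0 l up
        ptμ = wd , cov-pos cov pos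
    in ∈-concatMap⁺ below′ (lose (∈-partitions⁺ ptμ (trans (cov-sum cov) (cong suc s)))
         (∈-map⁺ (flip μ) (cov⇒rem cov ptl ptμ)))
  down⇒up : ∀ {t} → t ∈ concatMap below′ (partitions (suc n)) → t ∈ concatMap above (partitions n)
  down⇒up t∈ with find (∈-concatMap⁻ below′ {xs = partitions (suc n)} t∈)
  ... | μ , μ∈ , t∈′ with ∈-map⁻ (flip μ) t∈′
  ... | (c , l) , s∈ , refl with ∈-partitions⁻ (suc n) μ∈
  ... | ptμ@(wd , _) , s with rem⇒cov 0 μ ptμ s∈
  ... | cov , ptl =
    ∈-concatMap⁺ above (lose (∈-partitions⁺ ptl (ℕₚ.suc-injective (trans (sym (cov-sum cov)) s)))
      (∈-map⁺ (l ,_) (∈-filterᵇ⁺ (weaklyDecreasing ∘ proj₂) (cov⇒ups cov) wd)))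

-- The number of paths to a diagram obeys the branching rule: the exchange of summations turns
-- additions into removals, to which `numSYT-rem` applies.
∑-paths : ∀ n (h : List ℕ → ℤ) → ∑ (paths n) (λ (_ , l) → h l) ≡ ∑ (partitions n) (λ l → + numSYT l * h l)
∑-paths zero    h = cong (_+ + 0) (sym (ℤₚ.*-identityˡ (h [])))
∑-paths (suc n) h = begin
  ∑ (paths (suc n)) (λ (_ , l) → h l)
    ≡⟨ ∑-concatMap (extend n) (paths n) _ ⟩
  ∑ (paths n) (λ s → ∑ (extend n s) (λ (_ , l) → h l))
    ≡⟨ ∑-cong (paths n) (λ (c , l) → ∑-map (λ (k , μ) → (set c n k , μ)) (addable l) _) ⟩
  ∑ (paths n) (λ (_ , l) → ∑ (addable l) (λ (_ , μ) → h μ))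
    ≡⟨ ∑-paths n (λ l → ∑ (addable l) (λ (_ , μ) → h μ)) ⟩
  ∑ (partitions n) (λ l → + numSYT l * ∑ (addable l) (λ (_ , μ) → h μ))
    ≡⟨ ∑-cong (partitions n) (λ l → ∑-* (+ numSYT l) (addable l) _) ⟨
  ∑ (partitions n) (λ l → ∑ (addable l) (λ (_ , μ) → + numSYT l * h μ))
    ≡⟨ ∑-exchange n (λ l _ μ → + numSYT l * h μ) ⟩
  ∑ (partitions (suc n)) (λ μ → ∑ (rem 0 μ) (λ (_ , l) → + numSYT l * h μ))
    ≡⟨ ∑-cong∈ (partitions (suc n)) (λ μ i → let pt , s = ∈-partitions⁻ (suc n) i in begin
         ∑ (rem 0 μ) (λ (_ , l) → + numSYT l * h μ)
           ≡⟨ ∑-cong (rem 0 μ) (λ (_ , l) → ℤₚ.*-comm (+ numSYT l) (h μ)) ⟩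
         ∑ (rem 0 μ) (λ (_ , l) → h μ * + numSYT l)
           ≡⟨ ∑-* (h μ) (rem 0 μ) _ ⟩
         h μ * ∑ (rem 0 μ) (λ (_ , l) → + numSYT l)
           ≡⟨ cong (h μ *_) (numSYT-rem n μ pt s) ⟨
         h μ * + numSYT μ
           ≡⟨ ℤₚ.*-comm (h μ) (+ numSYT μ) ⟩
         + numSYT μ * h μ ∎) ⟩
  ∑ (partitions (suc n)) (λ μ → + numSYT μ * h μ) ∎

-- The number of semistandard tableaux with entries at most N, cleared of denominators.
Δ-numSYT : ∀ N n μ → Part μ → sum μ ≡ n → length μ ≤ N →
           + (n !) * Δ (bvec N 0 μ) ≡ Δ (bvec N 0 []) * (+ numSYT μ * contentProduct (+ N) (contents μ))
Δ-numSYT N zero    []      pt s len = lem (Δ (bvec N 0 []))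
  where
  lem : ∀ a → + 1 * a ≡ a * (+ 1 * + 1)
  lem = solve-∀
Δ-numSYT N zero    (zero ∷ μ) (_ , () ∷ _) s len
Δ-numSYT N zero    (suc x ∷ μ) pt () len
Δ-numSYT N (suc n) μ       pt s len = begin
  + (suc n ℕ.* n !) * D μ
    ≡⟨ cong (_* D μ) (ℤₚ.pos-* (suc n) (n !)) ⟩
  + suc n * + (n !) * D μ
    ≡⟨ lem₁ (+ suc n) (+ (n !)) (D μ) ⟩
  + (n !) * (+ suc n * D μ)
    ≡⟨ cong (+ (n !) *_) (trans (cong (λ z → + z * D μ) (sym s)) (sym (Δ-rem N μ len pt))) ⟩
  + (n !) * ∑ (rem 0 μ) (λ (c , l) → (+ N + c) * D l)
    ≡⟨ ∑-* (+ (n !)) (rem 0 μ) _ ⟨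
  ∑ (rem 0 μ) (λ (c , l) → + (n !) * ((+ N + c) * D l))
    ≡⟨ ∑-cong∈ (rem 0 μ) (λ (c , l) i → let cov , ptl = rem⇒cov 0 μ pt i in begin
         + (n !) * ((+ N + c) * D l)
           ≡⟨ lem₂ (+ (n !)) (+ N + c) (D l) ⟩
         (+ N + c) * (+ (n !) * D l)
           ≡⟨ cong ((+ N + c) *_) (Δ-numSYT N n l ptl (ℕₚ.suc-injective (trans (sym (cov-sum cov)) s))
                (ℕₚ.≤-trans (cov-length cov) len)) ⟩
         (+ N + c) * (D [] * (+ numSYT l * C l))
           ≡⟨ lem₃ (+ N + c) (D []) (+ numSYT l) (C l) ⟩
         D [] * ((+ N + c) * C l) * + numSYT l
           ≡⟨ cong (λ z → D [] * z * + numSYT l) (cov-contentProduct (+ N) cov) ⟨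
         D [] * C μ * + numSYT l ∎) ⟩
  ∑ (rem 0 μ) (λ (c , l) → D [] * C μ * + numSYT l)
    ≡⟨ ∑-* (D [] * C μ) (rem 0 μ) _ ⟩
  D [] * C μ * ∑ (rem 0 μ) (λ (c , l) → + numSYT l)
    ≡⟨ cong (D [] * C μ *_) (numSYT-rem n μ pt s) ⟨
  D [] * C μ * + numSYT μ
    ≡⟨ lem₄ (D []) (C μ) (+ numSYT μ) ⟩
  D [] * (+ numSYT μ * C μ) ∎
  where
  D C : List ℕ → ℤ
  D l = Δ (bvec N 0 l)
  C l = contentProduct (+ N) (contents l)
  lem₁ : ∀ a b c → a * b * c ≡ b * (a * c)
  lem₁ = solve-∀
  lem₂ : ∀ a b c → a * (b * c) ≡ b * (a * c)
  lem₂ = solve-∀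
  lem₃ : ∀ a b c d → a * (b * (c * d)) ≡ b * (a * d) * c
  lem₃ = solve-∀
  lem₄ : ∀ a b c → a * b * c ≡ a * (c * b)
  lem₄ = solve-∀

-- Distinct parts correspond to corners

-- Each value is taken at its last occurrence, which is the row whose last cell is removable and the
-- one that `jMinus` shortens.
cornerParts : List ℕ → List ℕ
cornerParts []          = []
cornerParts (x ∷ [])    = [ x ]
cornerParts (x ∷ y ∷ ys) = (if y <ᵇ x then [ x ] else []) ++ cornerParts (y ∷ ys)

cornerParts-≤ : ∀ {x j} xs → T (weaklyDecreasing (x ∷ xs)) → j ∈ cornerParts (x ∷ xs) → j ≤ x
cornerParts-≤ []       wd (here refl) = ℕₚ.≤-refl
cornerParts-≤ {x} (y ∷ ys) wd p with y <ᵇ x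
... | false = ℕₚ.≤-trans (cornerParts-≤ ys (wd-tail (y ∷ ys) wd) p) (wd-head ys wd)
cornerParts-≤ {x} (y ∷ ys) wd (here refl) | true = ℕₚ.≤-refl
cornerParts-≤ {x} (y ∷ ys) wd (there p) | true =
  ℕₚ.≤-trans (cornerParts-≤ ys (wd-tail (y ∷ ys) wd) p) (wd-head ys wd)

cornerParts-unique : ∀ μ → T (weaklyDecreasing μ) → Unique (cornerParts μ)
cornerParts-unique []           wd = []
cornerParts-unique (x ∷ [])     wd = [] ∷ []
cornerParts-unique (x ∷ y ∷ ys) wd with y <ᵇ x in eq | cornerParts-unique (y ∷ ys) (wd-tail (y ∷ ys) wd)
... | false | ih = ih
... | true  | ih = All.tabulate (λ j∈ e → ℕₚ.<⇒≱ (ℕₚ.<ᵇ⇒< y x (subst T (sym eq) tt))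
                     (ℕₚ.≤-trans (ℕₚ.≤-reflexive e) (cornerParts-≤ ys (wd-tail (y ∷ ys) wd) j∈))) ∷ ih

∈-cornerParts⁻ : ∀ μ {j} → j ∈ cornerParts μ → j ∈ μ
∈-cornerParts⁻ (x ∷ [])     p = p
∈-cornerParts⁻ (x ∷ y ∷ ys) {j} p with y <ᵇ x | ∈-cornerParts⁻ (y ∷ ys) {j}
∈-cornerParts⁻ (x ∷ y ∷ ys) p           | false | ih = there (ih p)
∈-cornerParts⁻ (x ∷ y ∷ ys) (here refl) | true  | ih = here refl
∈-cornerParts⁻ (x ∷ y ∷ ys) (there p)   | true  | ih = there (ih p)

∈-cornerParts⁺ : ∀ μ {j} → T (weaklyDecreasing μ) → j ∈ μ → j ∈ cornerParts μ
∈-cornerParts⁺ (x ∷ [])     wd p = p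
∈-cornerParts⁺ (x ∷ y ∷ ys) {j} wd p with y <ᵇ x in eq | ∈-cornerParts⁺ (y ∷ ys) {j} (wd-tail (y ∷ ys) wd)
∈-cornerParts⁺ (x ∷ y ∷ ys) wd (here refl) | true  | ih = here refl
∈-cornerParts⁺ (x ∷ y ∷ ys) wd (there p)   | true  | ih = there (ih p)
∈-cornerParts⁺ (x ∷ y ∷ ys) wd (there p)   | false | ih = ih p
∈-cornerParts⁺ (x ∷ y ∷ ys) wd (here refl) | false | ih =
  ih (here (ℕₚ.≤-antisym (ℕₚ.≮⇒≥ (λ y<x → subst T eq (ℕₚ.<⇒<ᵇ y<x))) (wd-head ys wd)))

∑-distinctParts : ∀ μ → Part μ → (f : ℕ → ℤ) → ∑ (distinctParts μ) f ≡ ∑ (cornerParts μ) f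
∑-distinctParts μ (wd , pos) f = ∑-set f
  (filterᵇ-unique (λ j → any (j ≡ᵇ_) μ) (Uniqueₚ.map⁺ ℕₚ.suc-injective (Uniqueₚ.upTo⁺ (sum μ))))
  (cornerParts-unique μ wd)
  (λ {j} p → let _ , h = ∈-filterᵇ⁻ (λ j → any (j ≡ᵇ_) μ) (map suc (upTo (sum μ))) p
                 y , y∈ , e = find (Anyₚ.any⁻ (j ≡ᵇ_) μ h)
             in ∈-cornerParts⁺ μ wd (subst (_∈ μ) (sym (ℕₚ.≡ᵇ⇒≡ j y e)) y∈))
  (λ {j} p → let j∈ = ∈-cornerParts⁻ μ p in
     ∈-filterᵇ⁺ (λ j → any (j ≡ᵇ_) μ) (∈-suc-upTo (All.lookup pos j∈) (All.lookup (part-≤sum μ) j∈))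
       (Anyₚ.any⁺ (j ≡ᵇ_) (lose j∈ (ℕₚ.≡⇒≡ᵇ j j refl))))

nonzero : ℕ → Bool
nonzero x = not (x ≡ᵇ 0)

replaceFirst-∈ : ∀ {j} xs ys → j ∈ xs → replaceFirst j (xs ++ ys) ≡ replaceFirst j xs ++ ys
replaceFirst-∈ {j} (x ∷ xs) ys p with x ≡ᵇ j in eq
... | true  = refl
replaceFirst-∈ {j} (x ∷ xs) ys (here refl) | false = ⊥-elim (subst T eq (ℕₚ.≡⇒≡ᵇ j j refl))
replaceFirst-∈ {j} (x ∷ xs) ys (there p)   | false = cong (x ∷_) (replaceFirst-∈ xs ys p)

replaceFirst-∉ : ∀ {j} xs ys → ¬ (j ∈ xs) → replaceFirst j (xs ++ ys) ≡ xs ++ replaceFirst j ys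
replaceFirst-∉     []       ys p = refl
replaceFirst-∉ {j} (x ∷ xs) ys p with x ≡ᵇ j in eq
... | true  = ⊥-elim (p (here (sym (ℕₚ.≡ᵇ⇒≡ x j (subst T (sym eq) tt)))))
... | false = cong (x ∷_) (replaceFirst-∉ xs ys (p ∘ there))

replaceLast : ℕ → List ℕ → List ℕ
replaceLast j μ = reverse (replaceFirst j (reverse μ))

replaceLast-∈ : ∀ {j} x xs → j ∈ xs → replaceLast j (x ∷ xs) ≡ x ∷ replaceLast j xs
replaceLast-∈ {j} x xs p = begin
  reverse (replaceFirst j (reverse (x ∷ xs)))      ≡⟨ cong (reverse ∘ replaceFirst j) (Listₚ.unfold-reverse x xs) ⟩
  reverse (replaceFirst j (reverse xs ∷ʳ x))       ≡⟨ cong reverse (replaceFirst-∈ (reverse xs) [ x ] (Anyₚ.reverse⁺ p)) ⟩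
  reverse (replaceFirst j (reverse xs) ∷ʳ x)       ≡⟨ Listₚ.reverse-++ (replaceFirst j (reverse xs)) [ x ] ⟩
  x ∷ replaceLast j xs ∎

replaceLast-∉ : ∀ x xs → ¬ (x ∈ xs) → replaceLast x (x ∷ xs) ≡ pred x ∷ xs
replaceLast-∉ x xs p = begin
  reverse (replaceFirst x (reverse (x ∷ xs)))      ≡⟨ cong (reverse ∘ replaceFirst x) (Listₚ.unfold-reverse x xs) ⟩
  reverse (replaceFirst x (reverse xs ∷ʳ x))       ≡⟨ cong reverse (replaceFirst-∉ (reverse xs) [ x ] (p ∘ Anyₚ.reverse⁻)) ⟩
  reverse (reverse xs ++ replaceFirst x [ x ])     ≡⟨ cong (λ b → reverse (reverse xs ++ (if b then pred x ∷ [] else x ∷ []))) (≡ᵇ-refl x) ⟩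
  reverse (reverse xs ∷ʳ pred x)                   ≡⟨ Listₚ.reverse-++ (reverse xs) [ pred x ] ⟩
  pred x ∷ reverse (reverse xs)                    ≡⟨ cong (pred x ∷_) (Listₚ.reverse-involutive xs) ⟩
  pred x ∷ xs ∎

filter-nonzero : ∀ {xs} → All (0 <_) xs → filterᵇ nonzero xs ≡ xs
filter-nonzero []                   = refl
filter-nonzero {suc x ∷ xs} (_ ∷ p) = cong (suc x ∷_) (filter-nonzero p)

jMinus-∈ : ∀ {j} x xs → j ∈ xs → jMinus (suc x ∷ xs) j ≡ suc x ∷ jMinus xs j
jMinus-∈ x xs p = cong (filterᵇ nonzero) (replaceLast-∈ (suc x) xs p)

jMinus-∉ : ∀ x xs → ¬ (x ∈ xs) → jMinus (x ∷ xs) x ≡ filterᵇ nonzero (pred x ∷ xs)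
jMinus-∉ x xs p = cong (filterᵇ nonzero) (replaceLast-∉ x xs p)

numGe : ℕ → List ℕ → ℤ
numGe j μ = ∑ μ (λ x → ind (j ≤ᵇ x))

wd-bound : ∀ {x} xs → T (weaklyDecreasing (x ∷ xs)) → All (_≤ x) xs
wd-bound []       wd = []
wd-bound (y ∷ ys) wd = wd-head ys wd ∷ All.map (λ h → ℕₚ.≤-trans h (wd-head ys wd)) (wd-bound ys (wd-tail (y ∷ ys) wd))

numGe-zero : ∀ j xs → All (_< j) xs → numGe j xs ≡ + 0
numGe-zero j []       []       = refl
numGe-zero j (x ∷ xs) (p ∷ ps) = cong₂ _+_
  (cong ind (¬T⇒false (λ h → ℕₚ.<⇒≱ p (ℕₚ.≤ᵇ⇒≤ j x h)))) (numGe-zero j xs ps)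

numGe-∷ : ∀ {j x} xs → j ≤ x → numGe j (x ∷ xs) ≡ + 1 + numGe j xs
numGe-∷ {j} {x} xs j≤x = cong (λ b → ind b + numGe j xs) (T-ext (λ _ → tt) (λ _ → ℕₚ.≤⇒≤ᵇ j≤x))

-- At a corner with part j, the parts that are at least j are exactly the rows down to it. With rows
-- counted from a, a + `numGe j μ` is thus one more than the index of this row, and its difference
-- from j is the content of the removed cell.
∑-cornerParts : ∀ a μ → Part μ → (K : List ℕ → ℤ → ℤ) →
  ∑ (cornerParts μ) (λ j → K (jMinus μ j) (+ j - (+ a + numGe j μ))) ≡ ∑ (rem a μ) (λ (c , l) → K l c)
∑-cornerParts a []         pt K = refl
∑-cornerParts a (zero ∷ μ) (_ , () ∷ _) K
∑-cornerParts a (suc x ∷ []) pt K = trans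
  (cong₂ (λ l c → K l c + + 0) (jMinus-∉ (suc x) [] (λ ()))
    (trans (cong (λ z → + suc x - (+ a + z)) (numGe-∷ [] (ℕₚ.≤-refl {suc x}))) (content x)))
  (last x)
  where
  content : ∀ x → + suc x - (+ a + (+ 1 + + 0)) ≡ rowContent a x
  content x = trans (cong (_- (+ a + (+ 1 + + 0))) (ℤₚ.pos-+ 1 x)) (lem (+ x) (+ a))
    where
    lem : ∀ x a → + 1 + x - (a + (+ 1 + + 0)) ≡ x - a
    lem = solve-∀
  last : ∀ x → K (filterᵇ nonzero (x ∷ [])) (rowContent a x) + + 0 ≡ ∑ (rem a (suc x ∷ [])) (λ (c , l) → K l c)
  last zero    = refl
  last (suc x) = refl
∑-cornerParts a (suc x ∷ μ@(y ∷ ys)) pt@(wd , _ ∷ pos) K = begin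
  ∑ (hd ++ cornerParts μ) f
    ≡⟨ ∑-++ hd (cornerParts μ) f ⟩
  ∑ hd f + ∑ (cornerParts μ) f
    ≡⟨ cong₂ _+_ head (begin
         ∑ (cornerParts μ) f
           ≡⟨ ∑-cong∈ (cornerParts μ) (λ j j∈ → cong₂ K (jMinus-∈ x μ (∈-cornerParts⁻ μ j∈)) (content j
                (ℕₚ.≤-trans (cornerParts-≤ ys (wd-tail μ wd) j∈) (wd-head ys wd)))) ⟩
         ∑ (cornerParts μ) (λ j → K (suc x ∷ jMinus μ j) (+ j - (+ suc a + numGe j μ)))
           ≡⟨ ∑-cornerParts (suc a) μ (part-tail pt) (λ l c → K (suc x ∷ l) c) ⟩
         ∑ (rem (suc a) μ) (λ (c , l) → K (suc x ∷ l) c)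
           ≡⟨ ∑-map (consStep (suc x)) (rem (suc a) μ) g ⟨
         ∑ (map (consStep (suc x)) (rem (suc a) μ)) g ∎) ⟩
  ∑ (corner a x y ys) g + ∑ (map (consStep (suc x)) (rem (suc a) μ)) g
    ≡⟨ ∑-++ (corner a x y ys) _ g ⟨
  ∑ (rem a (suc x ∷ μ)) g ∎
  where
  hd = if y <ᵇ suc x then [ suc x ] else []
  f : ℕ → ℤ
  f j = K (jMinus (suc x ∷ y ∷ ys) j) (+ j - (+ a + numGe j (suc x ∷ y ∷ ys)))
  g : Step → ℤ
  g (c , l) = K l c
  content : ∀ j → j ≤ suc x → + j - (+ a + numGe j (suc x ∷ y ∷ ys)) ≡ + j - (+ suc a + numGe j (y ∷ ys))
  content j j≤ = trans (cong (λ z → + j - (+ a + z)) (numGe-∷ (y ∷ ys) j≤))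
    (trans (lem (+ j) (+ a) (numGe j (y ∷ ys))) (cong (λ z → + j - (z + numGe j (y ∷ ys))) (sym (ℤₚ.pos-+ 1 a))))
    where
    lem : ∀ j a n → j - (a + (+ 1 + n)) ≡ j - (+ 1 + a + n)
    lem = solve-∀
  tip : y ≤ x → f (suc x) ≡ K (x ∷ y ∷ ys) (rowContent a x)
  tip y≤x = cong₂ K
    (trans (jMinus-∉ (suc x) (y ∷ ys) (λ i → ℕₚ.<⇒≱ (s≤s y≤x) (top i)))
           (filter-nonzero (ℕₚ.<-≤-trans (All.head pos) y≤x ∷ pos)))
    (begin
      + suc x - (+ a + numGe (suc x) (suc x ∷ y ∷ ys))
        ≡⟨ content (suc x) ℕₚ.≤-refl ⟩
      + suc x - (+ suc a + numGe (suc x) (y ∷ ys))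
        ≡⟨ cong (λ z → + suc x - (+ suc a + z))
             (numGe-zero (suc x) (y ∷ ys) (s≤s y≤x ∷ All.map (λ h → s≤s (ℕₚ.≤-trans h y≤x)) (wd-bound ys (wd-tail (y ∷ ys) wd)))) ⟩
      + suc x - (+ suc a + + 0)
        ≡⟨ cong (λ z → + suc x - z) (ℤₚ.+-identityʳ (+ suc a)) ⟩
      rowContent (suc a) (suc x)
        ≡⟨ rowContent-diag a x ⟩
      rowContent a x ∎)
    where
    top : ∀ {j} → j ∈ y ∷ ys → j ≤ y
    top (here refl) = ℕₚ.≤-refl
    top (there i)   = All.lookup (wd-bound ys (wd-tail (y ∷ ys) wd)) i
  head : ∑ hd f ≡ ∑ (corner a x y ys) g
  head with y ℕ.≤? x
  ... | yes y≤x = trans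
    (cong (λ b → ∑ (if b then [ suc x ] else []) f) (<ᵇ-true (s≤s y≤x)))
    (trans (cong (_+ + 0) (tip y≤x))
      (cong (λ b → ∑ (if b then [ rowContent a x , x ∷ y ∷ ys ] else []) g)
        (sym (T-ext {y ≤ᵇ x} {true} (λ _ → tt) (λ _ → ℕₚ.≤⇒≤ᵇ y≤x)))))
  ... | no y≰x = trans
    (cong (λ b → ∑ (if b then [ suc x ] else []) f) (<ᵇ-false {y} (ℕₚ.≰⇒> y≰x)))
    (cong (λ b → ∑ (if b then [ rowContent a x , x ∷ y ∷ ys ] else []) g)
      (sym (¬T⇒false {y ≤ᵇ x} (λ h → y≰x (ℕₚ.≤ᵇ⇒≤ y x h)))))

+sum : {A : Set} (f : A → ℕ) (xs : List A) → + sum (map f xs) ≡ ∑ xs (λ x → + f x)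
+sum f []       = refl
+sum f (x ∷ xs) = trans (ℤₚ.pos-+ (f x) (sum (map f xs))) (cong (_+_ (+ f x)) (+sum f xs))

∑-filterᵇ-ind : {A : Set} (p : A → Bool) (xs : List A) (f : A → ℤ) →
                ∑ (filterᵇ p xs) f ≡ ∑ xs (λ x → ind (p x) * f x)
∑-filterᵇ-ind p []       f = refl
∑-filterᵇ-ind p (x ∷ xs) f with p x | ∑-filterᵇ-ind p xs f
... | true  | ih = cong₂ _+_ (sym (ℤₚ.*-identityˡ (f x))) ih
... | false | ih = trans ih (sym (ℤₚ.+-identityˡ _))

∑-upTo-kronecker : ∀ S x (g : ℕ → ℤ) → x < S → ∑ (upTo S) (λ i → g i * ind (i ≡ᵇ x)) ≡ g x
∑-upTo-kronecker (suc S) x g x<1+S with x ℕ.≟ S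
... | yes refl = begin
  ∑ (upTo (suc S)) (λ i → g i * ind (i ≡ᵇ S))        ≡⟨ ∑-upTo-suc S _ ⟩
  ∑ (upTo S) (λ i → g i * ind (i ≡ᵇ S)) + g S * ind (S ≡ᵇ S)
    ≡⟨ cong₂ _+_ (trans (∑-cong∈ (upTo S) (λ i i∈ → trans
                    (cong (λ b → g i * ind b) (¬T⇒false {i ≡ᵇ S} (λ h → ℕₚ.<⇒≢ (∈-upTo⁻ i∈) (ℕₚ.≡ᵇ⇒≡ i S h))))
                    (ℤₚ.*-zeroʳ (g i)))) (∑-zero (upTo S)))
                 (trans (cong (λ b → g S * ind b) (≡ᵇ-refl S)) (ℤₚ.*-identityʳ (g S))) ⟩
  + 0 + g S                                          ≡⟨ ℤₚ.+-identityˡ (g S) ⟩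
  g S ∎
... | no x≢S = begin
  ∑ (upTo (suc S)) (λ i → g i * ind (i ≡ᵇ x))        ≡⟨ ∑-upTo-suc S _ ⟩
  ∑ (upTo S) (λ i → g i * ind (i ≡ᵇ x)) + g S * ind (S ≡ᵇ x)
    ≡⟨ cong₂ _+_ (∑-upTo-kronecker S x g (ℕₚ.≤∧≢⇒< (ℕₚ.≤-pred x<1+S) x≢S))
                 (trans (cong (λ b → g S * ind b) (¬T⇒false {S ≡ᵇ x} (λ h → x≢S (sym (ℕₚ.≡ᵇ⇒≡ S x h)))))
                        (ℤₚ.*-zeroʳ (g S))) ⟩
  g x + + 0                                          ≡⟨ ℤₚ.+-identityʳ (g x) ⟩
  g x ∎

-- A part x ≥ j is counted once, at i = x, and the range of i reaches it because x is at most the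
-- sum of the parts.
cμj-numGe : ∀ μ j → cμj μ j ≡ + j - numGe j μ
cμj-numGe μ j = cong (λ z → + j - z) (begin
  + sum (map (λ i → mult i μ) (filterᵇ (j ≤ᵇ_) (upTo (suc S))))
    ≡⟨ +sum (λ i → mult i μ) (filterᵇ (j ≤ᵇ_) (upTo (suc S))) ⟩
  ∑ (filterᵇ (j ≤ᵇ_) (upTo (suc S))) (λ i → + mult i μ)
    ≡⟨ ∑-filterᵇ-ind (j ≤ᵇ_) (upTo (suc S)) _ ⟩
  ∑ (upTo (suc S)) (λ i → ind (j ≤ᵇ i) * + mult i μ)
    ≡⟨ ∑-cong (upTo (suc S)) (λ i → trans (cong (ind (j ≤ᵇ i) *_) (length-filterᵇ (i ≡ᵇ_) μ))
                                          (sym (∑-* (ind (j ≤ᵇ i)) μ _))) ⟩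
  ∑ (upTo (suc S)) (λ i → ∑ μ (λ x → ind (j ≤ᵇ i) * ind (i ≡ᵇ x)))
    ≡⟨ ∑-comm (upTo (suc S)) μ _ ⟩
  ∑ μ (λ x → ∑ (upTo (suc S)) (λ i → ind (j ≤ᵇ i) * ind (i ≡ᵇ x)))
    ≡⟨ ∑-cong∈ μ (λ x x∈ → ∑-upTo-kronecker (suc S) x (λ i → ind (j ≤ᵇ i)) (s≤s (All.lookup (part-≤sum μ) x∈))) ⟩
  numGe j μ ∎)
  where S = sum μ

∑-distinctParts-rem : ∀ μ → Part μ → (K : List ℕ → ℤ → ℤ) →
  ∑ (distinctParts μ) (λ j → K (jMinus μ j) (cμj μ j)) ≡ ∑ (rem 0 μ) (λ (c , l) → K l c)
∑-distinctParts-rem μ pt K = begin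
  ∑ (distinctParts μ) (λ j → K (jMinus μ j) (cμj μ j))
    ≡⟨ ∑-distinctParts μ pt _ ⟩
  ∑ (cornerParts μ) (λ j → K (jMinus μ j) (cμj μ j))
    ≡⟨ ∑-cong (cornerParts μ) (λ j → cong (K (jMinus μ j))
         (trans (cμj-numGe μ j) (cong (λ z → + j - z) (sym (ℤₚ.+-identityˡ (numGe j μ)))))) ⟩
  ∑ (cornerParts μ) (λ j → K (jMinus μ j) (+ j - (+ 0 + numGe j μ)))
    ≡⟨ ∑-cornerParts 0 μ pt K ⟩
  ∑ (rem 0 μ) (λ (c , l) → K l c) ∎

-- Star factorizations

tabulate-toℕ : {A : Set} (n : ℕ) (f : ℕ → A) → tabulate {n = n} (f ∘ toℕ) ≡ applyUpTo f n
tabulate-toℕ zero    f = refl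
tabulate-toℕ (suc n) f = cong (f 0 ∷_) (tabulate-toℕ n (f ∘ suc))

map-toℕ-allFin : ∀ n → map toℕ (allFin n) ≡ upTo n
map-toℕ-allFin n = trans (Listₚ.map-tabulate id toℕ) (tabulate-toℕ n id)

∑-upTo : ∀ n f → ∑ (upTo n) f ≡ ∑< n f
∑-upTo zero    f = refl
∑-upTo (suc n) f = trans (∑-upTo-suc n f) (cong (_+ f n) (∑-upTo n f))

∑-allFin : ∀ n (f : ℕ → ℤ) → ∑ (allFin n) (f ∘ toℕ) ≡ ∑< n f
∑-allFin n f = begin
  ∑ (allFin n) (f ∘ toℕ)        ≡⟨ ∑-map toℕ (allFin n) f ⟨
  ∑ (map toℕ (allFin n)) f      ≡⟨ cong (λ z → ∑ z f) (map-toℕ-allFin n) ⟩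
  ∑ (upTo n) f                  ≡⟨ ∑-upTo n f ⟩
  ∑< n f ∎

length-filterᵇ-map : {A B : Set} (p : B → Bool) (g : A → B) (xs : List A) →
                     length (filterᵇ p (map g xs)) ≡ length (filterᵇ (p ∘ g) xs)
length-filterᵇ-map p g []       = refl
length-filterᵇ-map p g (x ∷ xs) with p (g x)
... | true  = cong suc (length-filterᵇ-map p g xs)
... | false = length-filterᵇ-map p g xs

numCycles≡cyc : ∀ n (F : Fin n → Fin n) (f : ℕ → ℕ) → (∀ x → toℕ (F x) ≡ f (toℕ x)) → numCycles n F ≡ cyc n f
numCycles≡cyc n F f e = begin
  length (filterᵇ (isOrbitMin n F) (allFin n))
    ≡⟨ cong length (filterᵇ-cong∈ (allFin n) (λ i _ → cong and
         (Listₚ.map-cong (λ t → cong (toℕ i ≤ᵇ_) (iter-toℕ t i)) (upTo n)))) ⟩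
  length (filterᵇ (orbitMin n f ∘ toℕ) (allFin n))
    ≡⟨ length-filterᵇ-map (orbitMin n f) toℕ (allFin n) ⟨
  length (filterᵇ (orbitMin n f) (map toℕ (allFin n)))
    ≡⟨ cong (length ∘ filterᵇ (orbitMin n f)) (map-toℕ-allFin n) ⟩
  cyc n f ∎
  where
  iter-toℕ : ∀ t i → toℕ (iter F t i) ≡ iter f t (toℕ i)
  iter-toℕ zero    i = refl
  iter-toℕ (suc t) i = trans (e _) (cong f (iter-toℕ t i))

toℕ-transpose : ∀ {n} (i j k : Fin n) → toℕ (Components.transpose i j k) ≡ swap (toℕ i) (toℕ j) (toℕ k)
toℕ-transpose i j k with k Fin.≟ i
... | yes refl = sym (swap-l (toℕ i) (toℕ j))
... | no k≢i with k Fin.≟ j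
...   | yes refl = sym (swap-r (toℕ i) (toℕ j))
...   | no k≢j   = sym (swap-o (toℕ i) (toℕ j) (k≢i ∘ Finₚ.toℕ-injective) (k≢j ∘ Finₚ.toℕ-injective))

starFun : ∀ m {r} → Vec (Fin m) r → ℕ → ℕ
starFun m []      x = x
starFun m (j ∷ v) x = swap (toℕ j) m (starFun m v x)

toℕ-starProduct : ∀ m {r} (v : Vec (Fin m) r) x → toℕ (starProduct (suc m) v x) ≡ starFun m v (toℕ x)
toℕ-starProduct m []      x = refl
toℕ-starProduct m (j ∷ v) x = begin
  toℕ (Components.transpose (inject₁ j) (fromℕ m) (starProduct (suc m) v x))
    ≡⟨ toℕ-transpose (inject₁ j) (fromℕ m) (starProduct (suc m) v x) ⟩
  swap (toℕ (inject₁ j)) (toℕ (fromℕ m)) (toℕ (starProduct (suc m) v x))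
    ≡⟨ cong₂ (λ a b → swap a b (toℕ (starProduct (suc m) v x))) (Finₚ.toℕ-inject₁ j) (Finₚ.toℕ-fromℕ m) ⟩
  swap (toℕ j) m (toℕ (starProduct (suc m) v x))
    ≡⟨ cong (swap (toℕ j) m) (toℕ-starProduct m v x) ⟩
  swap (toℕ j) m (starFun m v (toℕ x)) ∎

numCycles-starProduct : ∀ m {r} (v : Vec (Fin m) r) →
                        numCycles (suc m) (starProduct (suc m) v) ≡ cyc (suc m) (starFun m v)
numCycles-starProduct m v = numCycles≡cyc (suc m) _ _ (toℕ-starProduct m v)

-- Expansion of the r-th power of the sum of the transpositions (j m). The transpositions already
-- chosen accumulate in f, which therefore has to be arbitrary.
∑-allVecs : ∀ m r (φ : Φ) f →
            ∑ (allVecs m r) (λ v → φ (λ x → f (starFun m v x))) ≡ pow (X m m) r φ f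
∑-allVecs m zero    φ f = ℤₚ.+-identityʳ _
∑-allVecs m (suc r) φ f = begin
  ∑ (allVecs m (suc r)) (λ v → φ (λ x → f (starFun m v x)))
    ≡⟨ ∑-concatMap (λ j → map (j ∷_) (allVecs m r)) (allFin m) _ ⟩
  ∑ (allFin m) (λ j → ∑ (map (j ∷_) (allVecs m r)) (λ v → φ (λ x → f (starFun m v x))))
    ≡⟨ ∑-cong (allFin m) (λ j → trans (∑-map (j ∷_) (allVecs m r) _)
         (∑-allVecs m r φ (λ x → f (swap (toℕ j) m x)))) ⟩
  ∑ (allFin m) (λ j → pow (X m m) r φ (λ x → f (swap (toℕ j) m x)))
    ≡⟨ ∑-allFin m (λ j → pow (X m m) r φ (λ x → f (swap j m x))) ⟩
  pow (X m m) (suc r) φ f ∎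

starCount-∑ : ∀ m r k → + starCount (suc m) r k ≡ ∑ (allVecs m r) (λ v → ind (cyc (suc m) (starFun m v) ≡ᵇ k))
starCount-∑ m r k = trans (length-filterᵇ _ (allVecs m r))
  (∑-cong (allVecs m r) (λ v → cong (λ z → ind (z ≡ᵇ k)) (numCycles-starProduct m v)))

≡ᵇ-sym : ∀ a b → (a ≡ᵇ b) ≡ (b ≡ᵇ a)
≡ᵇ-sym a b = T-ext (λ h → ℕₚ.≡⇒≡ᵇ b a (sym (ℕₚ.≡ᵇ⇒≡ a b h))) (λ h → ℕₚ.≡⇒≡ᵇ a b (sym (ℕₚ.≡ᵇ⇒≡ b a h)))

starCount-generating : ∀ N m r →
  ∑ (upTo (suc (suc m))) (λ k → + starCount (suc m) r k * (+ N) ^ k) ≡ pow (X m m) r (χ N (suc m)) id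
starCount-generating N m r = begin
  ∑ (upTo (suc n)) (λ k → + starCount n r k * (+ N) ^ k)
    ≡⟨ ∑-cong (upTo (suc n)) (λ k → begin
         + starCount n r k * (+ N) ^ k
           ≡⟨ ℤₚ.*-comm (+ starCount n r k) ((+ N) ^ k) ⟩
         (+ N) ^ k * + starCount n r k
           ≡⟨ cong ((+ N) ^ k *_) (starCount-∑ m r k) ⟩
         (+ N) ^ k * ∑ (allVecs m r) (λ v → ind (c v ≡ᵇ k))
           ≡⟨ ∑-* ((+ N) ^ k) (allVecs m r) _ ⟨
         ∑ (allVecs m r) (λ v → (+ N) ^ k * ind (c v ≡ᵇ k)) ∎) ⟩
  ∑ (upTo (suc n)) (λ k → ∑ (allVecs m r) (λ v → (+ N) ^ k * ind (c v ≡ᵇ k)))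
    ≡⟨ ∑-comm (upTo (suc n)) (allVecs m r) _ ⟩
  ∑ (allVecs m r) (λ v → ∑ (upTo (suc n)) (λ k → (+ N) ^ k * ind (c v ≡ᵇ k)))
    ≡⟨ ∑-cong (allVecs m r) (λ v → trans
         (∑-cong (upTo (suc n)) (λ k → cong (λ b → (+ N) ^ k * ind b) (≡ᵇ-sym (c v) k)))
         (∑-upTo-kronecker (suc n) (c v) ((+ N) ^_) (s≤s (cyc-≤ n (starFun m v))))) ⟩
  ∑ (allVecs m r) (λ v → χ N n (starFun m v))
    ≡⟨ ∑-allVecs m r (χ N n) id ⟩
  pow (X m m) r (χ N n) id ∎
  where
  n = suc m
  c : Vec (Fin m) r → ℕ
  c v = cyc n (starFun m v)

starCount-large : ∀ m r k → suc m < k → + starCount (suc m) r k ≡ + 0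
starCount-large m r k n<k = trans (starCount-∑ m r k) (trans
  (∑-cong (allVecs m r) (λ v → cong ind (¬T⇒false (λ h →
    ℕₚ.<⇒≱ n<k (subst (_≤ suc m) (ℕₚ.≡ᵇ⇒≡ _ k h) (cyc-≤ (suc m) (starFun m v)))))))
  (∑-zero (allVecs m r)))

-- Coefficients of the content polynomial

-- The coefficient of tᵏ in the product of the t + c; beyond the degree the integer index is
-- negative and gives zero.
ecoef : List ℤ → ℕ → ℤ
ecoef cs k = esymℤ (+ length cs - + k) cs

esym-zero : ∀ cs → esym 0 cs ≡ + 1
esym-zero []       = refl
esym-zero (c ∷ cs) = refl

esym-large : ∀ m cs → length cs < m → esym m cs ≡ + 0
esym-large (suc m) []       _         = refl
esym-large (suc m) (c ∷ cs) (s≤s len) = trans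
  (cong₂ (λ a b → a + c * b) (esym-large (suc m) cs (ℕₚ.m<n⇒m<1+n len)) (esym-large m cs len))
  (trans (ℤₚ.+-identityˡ (c * + 0)) (ℤₚ.*-zeroʳ c))

esymAt : ℕ → ℕ → List ℤ → ℤ
esymAt L k cs with k ℕ.≤? L
... | yes _ = esym (L ℕ.∸ k) cs
... | no  _ = + 0

ecoef≡ : ∀ L k cs → esymℤ (+ L - + k) cs ≡ esymAt L k cs
ecoef≡ L k cs with k ℕ.≤? L
... | yes k≤L = cong (λ z → esymℤ z cs) (trans (ℤₚ.m-n≡m⊖n L k) (ℤₚ.⊖-≥ k≤L))
... | no  k≰L = trans (cong (λ z → esymℤ z cs) (trans (ℤₚ.m-n≡m⊖n L k) (ℤₚ.⊖-< (ℕₚ.≰⇒> k≰L))))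
                      (neg (k ℕ.∸ L) (ℕₚ.m<n⇒0<n∸m (ℕₚ.≰⇒> k≰L)))
  where
  neg : ∀ d → 0 < d → esymℤ (- (+ d)) cs ≡ + 0
  neg (suc d) _ = refl

ecoef-≤ : ∀ {k} cs → k ≤ length cs → ecoef cs k ≡ esym (length cs ℕ.∸ k) cs
ecoef-≤ {k} cs k≤L with k ℕ.≤? length cs | ecoef≡ (length cs) k cs
... | yes _ | e = e
... | no ¬p | e = ⊥-elim (¬p k≤L)

ecoef-> : ∀ {k} cs → length cs < k → ecoef cs k ≡ + 0
ecoef-> {k} cs L<k with k ℕ.≤? length cs | ecoef≡ (length cs) k cs
... | yes p | e = ⊥-elim (ℕₚ.<⇒≱ L<k p)
... | no _  | e = e

ecoef-∷-zero : ∀ c cs → ecoef (c ∷ cs) 0 ≡ c * ecoef cs 0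
ecoef-∷-zero c cs = begin
  ecoef (c ∷ cs) 0                                    ≡⟨ ecoef-≤ (c ∷ cs) z≤n ⟩
  esym (suc (length cs)) cs + c * esym (length cs) cs ≡⟨ cong₂ (λ a b → a + c * b) (esym-large _ cs (ℕₚ.n<1+n _)) (sym (ecoef-≤ cs z≤n)) ⟩
  + 0 + c * ecoef cs 0                                ≡⟨ ℤₚ.+-identityˡ _ ⟩
  c * ecoef cs 0 ∎

-- Multiplication by t + c. The cases arise because the two terms on the right leave the range of
-- indices at different k: at k = `length cs` only the leading coefficient 1 remains.
ecoef-∷-suc : ∀ c cs k → ecoef (c ∷ cs) (suc k) ≡ ecoef cs k + c * ecoef cs (suc k)
ecoef-∷-suc c cs k with ℕₚ.<-cmp k (length cs)
... | tri< k<L _ _ = begin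
  ecoef (c ∷ cs) (suc k)            ≡⟨ ecoef-≤ (c ∷ cs) (s≤s (ℕₚ.<⇒≤ k<L)) ⟩
  esym (length cs ℕ.∸ k) (c ∷ cs)   ≡⟨ cong (λ z → esym z (c ∷ cs)) L∸k ⟩
  esym (suc (length cs ℕ.∸ suc k)) cs + c * esym (length cs ℕ.∸ suc k) cs
    ≡⟨ cong₂ (λ a b → a + c * b) (cong (λ z → esym z cs) L∸k) (ecoef-≤ cs k<L) ⟨
  esym (length cs ℕ.∸ k) cs + c * ecoef cs (suc k)
    ≡⟨ cong (_+ c * ecoef cs (suc k)) (ecoef-≤ cs (ℕₚ.<⇒≤ k<L)) ⟨
  ecoef cs k + c * ecoef cs (suc k) ∎
  where
  L∸k : length cs ℕ.∸ k ≡ suc (length cs ℕ.∸ suc k)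
  L∸k = ℕₚ.+-∸-assoc 1 k<L
... | tri≈ _ refl _ = begin
  ecoef (c ∷ cs) (suc k)            ≡⟨ ecoef-≤ (c ∷ cs) ℕₚ.≤-refl ⟩
  esym (k ℕ.∸ k) (c ∷ cs)           ≡⟨ cong (λ z → esym z (c ∷ cs)) (ℕₚ.n∸n≡0 k) ⟩
  + 1                               ≡⟨ lem c ⟩
  + 1 + c * + 0
    ≡⟨ cong₂ (λ a b → a + c * b)
         (trans (sym (esym-zero cs)) (trans (cong (λ z → esym z cs) (sym (ℕₚ.n∸n≡0 k))) (sym (ecoef-≤ cs ℕₚ.≤-refl))))
         (sym (ecoef-> cs (ℕₚ.n<1+n k))) ⟩
  ecoef cs k + c * ecoef cs (suc k) ∎
  where
  lem : ∀ c → + 1 ≡ + 1 + c * + 0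
  lem = solve-∀
... | tri> _ _ L<k = begin
  ecoef (c ∷ cs) (suc k)            ≡⟨ ecoef-> (c ∷ cs) (s≤s L<k) ⟩
  + 0                               ≡⟨ lem c ⟩
  + 0 + c * + 0                     ≡⟨ cong₂ (λ a b → a + c * b) (ecoef-> cs L<k) (ecoef-> cs (ℕₚ.m<n⇒m<1+n L<k)) ⟨
  ecoef cs k + c * ecoef cs (suc k) ∎
  where
  lem : ∀ c → + 0 ≡ + 0 + c * + 0
  lem = solve-∀

∑-upTo-head : ∀ n (f : ℕ → ℤ) → ∑ (upTo (suc n)) f ≡ f 0 + ∑ (upTo n) (f ∘ suc)
∑-upTo-head n f = cong (_+_ (f 0)) (trans (cong (λ z → ∑ z f) (sym (Listₚ.map-upTo suc n))) (∑-map suc (upTo n) f))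

contentProduct-ecoef : ∀ x cs → contentProduct x cs ≡ ∑ (upTo (suc (length cs))) (λ k → ecoef cs k * x ^ k)
contentProduct-ecoef x []       = refl
contentProduct-ecoef x (c ∷ cs) = sym (begin
  ∑ (upTo (suc (suc L))) (λ k → ecoef (c ∷ cs) k * x ^ k)
    ≡⟨ ∑-upTo-head (suc L) (λ k → ecoef (c ∷ cs) k * x ^ k) ⟩
  ecoef (c ∷ cs) 0 * + 1 + ∑ (upTo (suc L)) (λ k → ecoef (c ∷ cs) (suc k) * (x * x ^ k))
    ≡⟨ cong₂ _+_ (cong (_* + 1) (ecoef-∷-zero c cs)) (begin
         ∑ (upTo (suc L)) (λ k → ecoef (c ∷ cs) (suc k) * (x * x ^ k))
           ≡⟨ ∑-cong (upTo (suc L)) (λ k → trans (cong (_* (x * x ^ k)) (ecoef-∷-suc c cs k))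
                (lem₁ (ecoef cs k) c (ecoef cs (suc k)) x (x ^ k))) ⟩
         ∑ (upTo (suc L)) (λ k → x * (ecoef cs k * x ^ k) + c * (ecoef cs (suc k) * (x * x ^ k)))
           ≡⟨ ∑-+ (upTo (suc L)) (λ k → x * (ecoef cs k * x ^ k)) _ ⟩
         _ ≡⟨ cong₂ _+_ (∑-* x (upTo (suc L)) _) (∑-* c (upTo (suc L)) _) ⟩
         x * S + c * S′ ∎) ⟩
  c * ecoef cs 0 * + 1 + (x * S + c * S′)
    ≡⟨ lem₂ c (ecoef cs 0) (x * S) S′ ⟩
  x * S + c * (ecoef cs 0 * + 1 + S′)
    ≡⟨ cong (λ z → x * S + c * z) (begin
         ecoef cs 0 * + 1 + S′
           ≡⟨ ∑-upTo-head (suc L) (λ k → ecoef cs k * x ^ k) ⟨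
         ∑ (upTo (suc (suc L))) (λ k → ecoef cs k * x ^ k)
           ≡⟨ ∑-upTo-suc (suc L) (λ k → ecoef cs k * x ^ k) ⟩
         S + ecoef cs (suc L) * x ^ suc L
           ≡⟨ cong (λ z → S + z * x ^ suc L) (ecoef-> cs (ℕₚ.n<1+n L)) ⟩
         S + + 0
           ≡⟨ ℤₚ.+-identityʳ S ⟩
         S ∎) ⟩
  x * S + c * S
    ≡⟨ ℤₚ.*-distribʳ-+ S x c ⟨
  (x + c) * S
    ≡⟨ cong ((x + c) *_) (contentProduct-ecoef x cs) ⟨
  (x + c) * contentProduct x cs ∎)
  where
  L = length cs
  S S′ : ℤ
  S  = ∑ (upTo (suc L)) (λ k → ecoef cs k * x ^ k)
  S′ = ∑ (upTo (suc L)) (λ k → ecoef cs (suc k) * (x * x ^ k))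
  lem₁ : ∀ a c b x p → (a + c * b) * (x * p) ≡ x * (a * p) + c * (b * (x * p))
  lem₁ = solve-∀
  lem₂ : ∀ c e u s → c * e * + 1 + (u + c * s) ≡ u + c * (e * + 1 + s)
  lem₂ = solve-∀

length-contents : ∀ a μ → length (contentsFrom a μ) ≡ sum μ
length-contents a []      = refl
length-contents a (x ∷ μ) = begin
  length (map (rowContent a) (upTo x) ++ contentsFrom (suc a) μ) ≡⟨ Listₚ.length-++ (map (rowContent a) (upTo x)) ⟩
  length (map (rowContent a) (upTo x)) ℕ.+ length (contentsFrom (suc a) μ)
    ≡⟨ cong₂ ℕ._+_ (trans (Listₚ.length-map (rowContent a) (upTo x)) (Listₚ.length-upTo x)) (length-contents (suc a) μ) ⟩
  x ℕ.+ sum μ ∎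

-- Every large x divides the constant term, so it vanishes, and the other coefficients follow.
poly-zero : ∀ K X (a : ℕ → ℤ) → (∀ N → X ≤ N → ∑ (upTo K) (λ k → a k * (+ N) ^ k) ≡ + 0) →
            ∀ k → k < K → a k ≡ + 0
poly-zero (suc K) X a h = go
  where
  S : ℕ → ℤ
  S N = ∑ (upTo K) (λ k → a (suc k) * (+ N) ^ k)
  split : ∀ N → ∑ (upTo (suc K)) (λ k → a k * (+ N) ^ k) ≡ a 0 + + N * S N
  split N = trans (∑-upTo-head K (λ k → a k * (+ N) ^ k)) (cong₂ _+_ (ℤₚ.*-identityʳ (a 0))
    (trans (∑-cong (upTo K) (λ k → lem (a (suc k)) (+ N) ((+ N) ^ k))) (∑-* (+ N) (upTo K) _)))
    where
    lem : ∀ a n p → a * (n * p) ≡ n * (a * p)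
    lem = solve-∀
  a₀ : a 0 ≡ + 0
  a₀ = trans a₀≡ (trans (cong (λ z → - (+ N * z)) (ℤₚ.∣i∣≡0⇒i≡0 (small (ℤ.∣ S N ∣) bound))) (lem (+ N)))
    where
    N = suc (X ℕ.+ ℤ.∣ a 0 ∣)
    lem : ∀ n → - (n * + 0) ≡ + 0
    lem = solve-∀
    lem′ : ∀ u v → u ≡ u + v - v
    lem′ = solve-∀
    a₀≡ : a 0 ≡ - (+ N * S N)
    a₀≡ = trans (lem′ (a 0) (+ N * S N)) (trans (cong (_- + N * S N)
      (trans (sym (split N)) (h N (ℕₚ.m≤n⇒m≤1+n (ℕₚ.m≤m+n X _))))) (ℤₚ.+-identityˡ _))
    bound : N ℕ.* ℤ.∣ S N ∣ < N
    bound = subst (_< N) (trans (cong ℤ.∣_∣ a₀≡) (trans (ℤₚ.∣-i∣≡∣i∣ (+ N * S N)) (ℤₚ.abs-* (+ N) (S N))))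
              (s≤s (ℕₚ.m≤n+m ℤ.∣ a 0 ∣ X))
    small : ∀ s → N ℕ.* s < N → s ≡ 0
    small zero    _ = refl
    small (suc s) p = ⊥-elim (ℕₚ.<⇒≱ p (ℕₚ.≤-trans (ℕₚ.m≤m+n N (N ℕ.* s)) (ℕₚ.≤-reflexive (sym (ℕₚ.*-suc N s)))))
  S-zero : ∀ N → suc X ≤ N → S N ≡ + 0
  S-zero N@(suc _) X<N with ℤₚ.i*j≡0⇒i≡0∨j≡0 (+ N) {S N}
    (trans (sym (ℤₚ.+-identityˡ _)) (trans (cong (_+ + N * S N) (sym a₀)) (trans (sym (split N)) (h N (ℕₚ.<⇒≤ X<N)))))
  ... | inj₁ ()
  ... | inj₂ e = e
  go : ∀ k → k < suc K → a k ≡ + 0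
  go zero    _         = a₀
  go (suc k) (s≤s k<K) = poly-zero K (suc X) (a ∘ suc) S-zero k k<K

rowContent-injective : ∀ {a b} → rowContent a 0 ≡ rowContent b 0 → a ≡ b
rowContent-injective {a} {b} e = ℤₚ.+-injective (ℤₚ.neg-injective
  (trans (sym (ℤₚ.+-identityˡ (- (+ a)))) (trans e (ℤₚ.+-identityˡ (- (+ b))))))

-- The entries -a, -a - 1, ... are distinct. This is what permits the cancellation of Δ(b(∅)).
Δ-empty≢0 : ∀ N a → Δ (bvec N a []) ≢ + 0
Δ-empty≢0 zero    a ()
Δ-empty≢0 (suc N) a e with ℤₚ.i*j≡0⇒i≡0∨j≡0 (q (rowContent a 0) (bvec N (suc a) [])) e
... | inj₂ e′ = Δ-empty≢0 N (suc a) e′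
... | inj₁ e′ = q≢0 N (suc a) (ℕₚ.n<1+n a) e′
  where
  q≢0 : ∀ N b → a < b → q (rowContent a 0) (bvec N b []) ≢ + 0
  q≢0 zero    b a<b ()
  q≢0 (suc N) b a<b e with ℤₚ.i*j≡0⇒i≡0∨j≡0 (rowContent a 0 - rowContent b 0) e
  ... | inj₁ e′ = ℕₚ.<⇒≢ a<b (rowContent-injective (ℤₚ.i-j≡0⇒i≡j (rowContent a 0) (rowContent b 0) e′))
  ... | inj₂ e′ = q≢0 N (suc b) (ℕₚ.m<n⇒m<1+n a<b) e′

-- The formula at t = N and the comparison of coefficients

numerator : ℕ → List ℕ × ℕ → ℤ
numerator r (μ , j) = + (numSYT μ ℕ.* numSYT (jMinus μ j)) * cμj μ j ^ r

∑-pairs : ∀ n (f : List ℕ × ℕ → ℤ) →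
          ∑ (partitionPartPairs n) f ≡ ∑ (partitions n) (λ μ → ∑ (distinctParts μ) (λ j → f (μ , j)))
∑-pairs n f = trans (∑-concatMap (λ μ → map (μ ,_) (distinctParts μ)) (partitions n) f)
  (∑-cong (partitions n) (λ μ → ∑-map (μ ,_) (distinctParts μ) f))

∈-pairs⁻ : ∀ n {p} → p ∈ partitionPartPairs n → proj₁ p ∈ partitions n
∈-pairs⁻ n p∈ with find (∈-concatMap⁻ (λ μ → map (μ ,_) (distinctParts μ)) {xs = partitions n} p∈)
... | μ , μ∈ , p∈′ with ∈-map⁻ (μ ,_) p∈′
... | _ , _ , refl = μ∈

-- The sum over paths becomes one over pairs of a diagram and a corner: d of the smaller shape
-- counts the paths, and n! Δ(μ) supplies d of the larger shape with its content product. The bound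
-- on N makes `Δ-numSYT` available for all partitions of n = m + 1.
trace-formula : ∀ N m r → m < N →
  + (suc m !) * pow (X m m) r (χ N (suc m)) id ≡
  ∑ (partitionPartPairs (suc m)) (λ p → numerator r p * contentProduct (+ N) (contents (proj₁ p)))
trace-formula N m r m<N = ℤₚ.*-cancelˡ-≡ D₀ _ _ {{ℤ.≢-nonZero (Δ-empty≢0 N 0)}} (begin
  D₀ * (+ (n !) * Jʳ)
    ≡⟨ lem₁ D₀ (+ (n !)) Jʳ ⟩
  + (n !) * (D₀ * Jʳ)
    ≡⟨ cong (+ (n !) *_) (begin
         D₀ * Jʳ
           ≡⟨ J^-paths N m r m<N ⟩
         ∑ (paths m) (λ (_ , l) → ∑ (addable l) (λ (k , μ) → k ^ r * D μ))
           ≡⟨ ∑-paths m (λ l → ∑ (addable l) (λ (k , μ) → k ^ r * D μ)) ⟩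
         ∑ (partitions m) (λ l → + numSYT l * ∑ (addable l) (λ (k , μ) → k ^ r * D μ))
           ≡⟨ ∑-cong (partitions m) (λ l → ∑-* (+ numSYT l) (addable l) _) ⟨
         ∑ (partitions m) (λ l → ∑ (addable l) (λ (k , μ) → + numSYT l * (k ^ r * D μ)))
           ≡⟨ ∑-exchange m (λ l k μ → + numSYT l * (k ^ r * D μ)) ⟩
         ∑ (partitions n) (λ μ → ∑ (rem 0 μ) (λ (k , l) → + numSYT l * (k ^ r * D μ))) ∎) ⟩
  + (n !) * ∑ (partitions n) (λ μ → ∑ (rem 0 μ) (λ (k , l) → + numSYT l * (k ^ r * D μ)))
    ≡⟨ ∑-* (+ (n !)) (partitions n) _ ⟨
  ∑ (partitions n) (λ μ → + (n !) * ∑ (rem 0 μ) (λ (k , l) → + numSYT l * (k ^ r * D μ)))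
    ≡⟨ ∑-cong∈ (partitions n) (λ μ μ∈ → step μ (proj₁ (∈-partitions⁻ n μ∈)) (proj₂ (∈-partitions⁻ n μ∈))) ⟩
  ∑ (partitions n) (λ μ → D₀ * ∑ (distinctParts μ) (λ j → numerator r (μ , j) * C μ))
    ≡⟨ ∑-* D₀ (partitions n) _ ⟩
  D₀ * ∑ (partitions n) (λ μ → ∑ (distinctParts μ) (λ j → numerator r (μ , j) * C μ))
    ≡⟨ cong (D₀ *_) (∑-pairs n (λ p → numerator r p * C (proj₁ p))) ⟨
  D₀ * ∑ (partitionPartPairs n) (λ p → numerator r p * C (proj₁ p)) ∎)
  where
  n = suc m
  D C : List ℕ → ℤ
  D l = Δ (bvec N 0 l)
  C l = contentProduct (+ N) (contents l)
  D₀ = D []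
  Jʳ = pow (X m m) r (χ N (suc m)) id
  lem₁ : ∀ a b c → a * (b * c) ≡ b * (a * c)
  lem₁ = solve-∀
  lem₂ : ∀ f a p d → f * (a * (p * d)) ≡ a * p * (f * d)
  lem₂ = solve-∀
  lem₃ : ∀ a p d s c → a * p * (d * (s * c)) ≡ d * (s * a * p * c)
  lem₃ = solve-∀
  step : ∀ μ → Part μ → sum μ ≡ n →
         + (n !) * ∑ (rem 0 μ) (λ (k , l) → + numSYT l * (k ^ r * D μ)) ≡
         D₀ * ∑ (distinctParts μ) (λ j → numerator r (μ , j) * C μ)
  step μ pt s = begin
    + (n !) * ∑ (rem 0 μ) (λ (k , l) → + numSYT l * (k ^ r * D μ))
      ≡⟨ ∑-* (+ (n !)) (rem 0 μ) _ ⟨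
    ∑ (rem 0 μ) (λ (k , l) → + (n !) * (+ numSYT l * (k ^ r * D μ)))
      ≡⟨ ∑-cong (rem 0 μ) (λ (k , l) → begin
           + (n !) * (+ numSYT l * (k ^ r * D μ))
             ≡⟨ lem₂ (+ (n !)) (+ numSYT l) (k ^ r) (D μ) ⟩
           + numSYT l * k ^ r * (+ (n !) * D μ)
             ≡⟨ cong (+ numSYT l * k ^ r *_) (Δ-numSYT N n μ pt s
                  (ℕₚ.≤-trans (length-≤sum (proj₂ pt)) (subst (_≤ N) (sym s) m<N))) ⟩
           + numSYT l * k ^ r * (D₀ * (+ numSYT μ * C μ))
             ≡⟨ lem₃ (+ numSYT l) (k ^ r) D₀ (+ numSYT μ) (C μ) ⟩
           D₀ * (+ numSYT μ * + numSYT l * k ^ r * C μ)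
             ≡⟨ cong (λ z → D₀ * (z * k ^ r * C μ)) (ℤₚ.pos-* (numSYT μ) (numSYT l)) ⟨
           D₀ * (+ (numSYT μ ℕ.* numSYT l) * k ^ r * C μ) ∎) ⟩
    ∑ (rem 0 μ) (λ (k , l) → D₀ * (+ (numSYT μ ℕ.* numSYT l) * k ^ r * C μ))
      ≡⟨ ∑-* D₀ (rem 0 μ) _ ⟩
    D₀ * ∑ (rem 0 μ) (λ (k , l) → + (numSYT μ ℕ.* numSYT l) * k ^ r * C μ)
      ≡⟨ cong (D₀ *_) (∑-distinctParts-rem μ pt (λ l k → + (numSYT μ ℕ.* numSYT l) * k ^ r * C μ)) ⟨
    D₀ * ∑ (distinctParts μ) (λ j → numerator r (μ , j) * C μ) ∎

-- Beyond k = n both sides vanish. Up to n they are coefficients of polynomials of degree at most n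
-- that agree at every integer N ≥ n.
starCount-formula : ∀ m r k → + (suc m !) * + starCount (suc m) r k ≡
  ∑ (partitionPartPairs (suc m)) (λ p → numerator r p * ecoef (contents (proj₁ p)) k)
starCount-formula m r k with k ℕ.≤? suc m
... | no k≰n = trans (trans (cong (+ (suc m !) *_) (starCount-large m r k (ℕₚ.≰⇒> k≰n))) (ℤₚ.*-zeroʳ (+ (suc m !))))
  (sym (trans (∑-cong∈ (partitionPartPairs (suc m)) (λ p p∈ → trans (cong (numerator r p *_)
      (ecoef-> (contents (proj₁ p)) (subst (_< k) (sym (trans (length-contents 0 (proj₁ p))
         (proj₂ (∈-partitions⁻ (suc m) (∈-pairs⁻ (suc m) p∈))))) (ℕₚ.≰⇒> k≰n))))
      (ℤₚ.*-zeroʳ (numerator r p)))) (∑-zero (partitionPartPairs (suc m)))))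
... | yes k≤n = ℤₚ.i-j≡0⇒i≡j _ _ (poly-zero (suc n) n a vanish k (s≤s k≤n))
  where
  n = suc m
  ps = partitionPartPairs n
  R : ℕ → ℤ
  R k = ∑ ps (λ p → numerator r p * ecoef (contents (proj₁ p)) k)
  a : ℕ → ℤ
  a k = + (n !) * + starCount n r k - R k
  lem : ∀ f s r x → (f * s - r) * x ≡ f * (s * x) + - (+ 1) * (r * x)
  lem = solve-∀
  lem′ : ∀ u → u + - (+ 1) * u ≡ + 0
  lem′ = solve-∀
  lem″ : ∀ x w e → x * (w * e) ≡ w * (e * x)
  lem″ = solve-∀
  R-generating : ∀ N → ∑ (upTo (suc n)) (λ k → R k * (+ N) ^ k) ≡
                 ∑ ps (λ p → numerator r p * contentProduct (+ N) (contents (proj₁ p)))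
  R-generating N = begin
    ∑ (upTo (suc n)) (λ k → R k * (+ N) ^ k)
      ≡⟨ ∑-cong (upTo (suc n)) (λ k → begin
           R k * (+ N) ^ k
             ≡⟨ ℤₚ.*-comm (R k) ((+ N) ^ k) ⟩
           (+ N) ^ k * R k
             ≡⟨ ∑-* ((+ N) ^ k) ps _ ⟨
           ∑ ps (λ p → (+ N) ^ k * (numerator r p * ecoef (contents (proj₁ p)) k))
             ≡⟨ ∑-cong ps (λ p → lem″ ((+ N) ^ k) (numerator r p) (ecoef (contents (proj₁ p)) k)) ⟩
           ∑ ps (λ p → numerator r p * (ecoef (contents (proj₁ p)) k * (+ N) ^ k)) ∎) ⟩
    ∑ (upTo (suc n)) (λ k → ∑ ps (λ p → numerator r p * (ecoef (contents (proj₁ p)) k * (+ N) ^ k)))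
      ≡⟨ ∑-comm (upTo (suc n)) ps _ ⟩
    ∑ ps (λ p → ∑ (upTo (suc n)) (λ k → numerator r p * (ecoef (contents (proj₁ p)) k * (+ N) ^ k)))
      ≡⟨ ∑-cong∈ ps (λ p p∈ → trans (∑-* (numerator r p) (upTo (suc n)) _) (cong (numerator r p *_)
           (sym (trans (contentProduct-ecoef (+ N) (contents (proj₁ p)))
             (cong (λ z → ∑ (upTo (suc z)) (λ k → ecoef (contents (proj₁ p)) k * (+ N) ^ k))
               (trans (length-contents 0 (proj₁ p)) (proj₂ (∈-partitions⁻ n (∈-pairs⁻ n p∈))))))))) ⟩
    ∑ ps (λ p → numerator r p * contentProduct (+ N) (contents (proj₁ p))) ∎
  vanish : ∀ N → n ≤ N → ∑ (upTo (suc n)) (λ k → a k * (+ N) ^ k) ≡ + 0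
  vanish N n≤N = begin
    ∑ (upTo (suc n)) (λ k → a k * (+ N) ^ k)
      ≡⟨ ∑-cong (upTo (suc n)) (λ k → lem (+ (n !)) (+ starCount n r k) (R k) ((+ N) ^ k)) ⟩
    ∑ (upTo (suc n)) (λ k → + (n !) * (+ starCount n r k * (+ N) ^ k) + - (+ 1) * (R k * (+ N) ^ k))
      ≡⟨ ∑-+ (upTo (suc n)) (λ k → + (n !) * (+ starCount n r k * (+ N) ^ k)) (λ k → - (+ 1) * (R k * (+ N) ^ k)) ⟩
    _ ≡⟨ cong₂ _+_
           (trans (∑-* (+ (n !)) (upTo (suc n)) _)
                  (trans (cong (+ (n !) *_) (starCount-generating N m r)) (trace-formula N m r n≤N)))
           (trans (∑-* (- (+ 1)) (upTo (suc n)) (λ k → R k * (+ N) ^ k)) (cong (- (+ 1) *_) (R-generating N))) ⟩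
    T₀ + - (+ 1) * T₀
      ≡⟨ lem′ T₀ ⟩
    + 0 ∎
    where
    T₀ = ∑ ps (λ p → numerator r p * contentProduct (+ N) (contents (proj₁ p)))

-- Passage to rational numbers and to coefficient lists

/-+ : ∀ a b d .{{_ : ℕ.NonZero d}} → a / d ℚ.+ b / d ≡ (a + b) / d
/-+ a b d@(suc d′) = ℚₚ.toℚᵘ-injective
  (ℚᵘₚ.≃-trans (ℚₚ.toℚᵘ-homo-+ (a / d) (b / d))
  (ℚᵘₚ.≃-trans (ℚᵘₚ.+-cong (ℚₚ.toℚᵘ-fromℚᵘ (mkℚᵘ a d′)) (ℚₚ.toℚᵘ-fromℚᵘ (mkℚᵘ b d′)))
  (ℚᵘₚ.≃-trans (*≡* (trans (lem a b (+ d)) (cong ((a + b) *_) (sym (ℤₚ.pos-* d d)))))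
               (ℚᵘₚ.≃-sym (ℚₚ.toℚᵘ-fromℚᵘ (mkℚᵘ (a + b) d′))))))
  where
  lem : ∀ a b d → (a * d + b * d) * d ≡ (a + b) * (d * d)
  lem = solve-∀

/-* : ∀ a b d .{{_ : ℕ.NonZero d}} → a / d ℚ.* toℚ b ≡ (a * b) / d
/-* a b d@(suc d′) = ℚₚ.toℚᵘ-injective
  (ℚᵘₚ.≃-trans (ℚₚ.toℚᵘ-homo-* (a / d) (toℚ b))
  (ℚᵘₚ.≃-trans (ℚᵘₚ.*-cong (ℚₚ.toℚᵘ-fromℚᵘ (mkℚᵘ a d′)) (ℚₚ.toℚᵘ-fromℚᵘ (mkℚᵘ b 0)))
  (ℚᵘₚ.≃-trans (*≡* (cong (λ z → a * b * + z) (sym (ℕₚ.*-identityʳ d))))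
               (ℚᵘₚ.≃-sym (ℚₚ.toℚᵘ-fromℚᵘ (mkℚᵘ (a * b) d′))))))

/-cancel : ∀ a d .{{_ : ℕ.NonZero d}} → (+ d * a) / d ≡ a / 1
/-cancel a d@(suc d′) = ℚₚ.fromℚᵘ-cong {mkℚᵘ (+ d * a) d′} {mkℚᵘ a 0} (*≡* (lem (+ d) a))
  where
  lem : ∀ d a → d * a * + 1 ≡ a * d
  lem = solve-∀

0/ : ∀ d .{{_ : ℕ.NonZero d}} → + 0 / d ≡ 0ℚ
0/ d@(suc d′) = ℚₚ.fromℚᵘ-cong {mkℚᵘ (+ 0) d′} {mkℚᵘ (+ 0) 0} (*≡* refl)

sumℚ-/ : {A : Set} (xs : List A) (f : A → ℚ) (z : A → ℤ) (d : ℕ) .{{_ : ℕ.NonZero d}} →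
         (∀ x → x ∈ xs → f x ≡ z x / d) → sumℚ (map f xs) ≡ ∑ xs z / d
sumℚ-/ []       f z d e = sym (0/ d)
sumℚ-/ (x ∷ xs) f z d e =
  trans (cong₂ ℚ._+_ (e x (here refl)) (sumℚ-/ xs f z d (λ y → e y ∘ there))) (/-+ (z x) (∑ xs z) d)

toℚ-+ : ∀ a b → toℚ a ℚ.+ toℚ b ≡ toℚ (a + b)
toℚ-+ a b = /-+ a b 1

toℚ-* : ∀ a b → toℚ a ℚ.* toℚ b ≡ toℚ (a * b)
toℚ-* a b = /-* a b 1

coeff-addP : ∀ k p s → coeff k (addP p s) ≡ coeff k p ℚ.+ coeff k s
coeff-addP k       []      s       = sym (ℚₚ.+-identityˡ (coeff k s))
coeff-addP zero    (a ∷ p) []      = sym (ℚₚ.+-identityʳ a)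
coeff-addP (suc k) (a ∷ p) []      = sym (ℚₚ.+-identityʳ (coeff k p))
coeff-addP zero    (a ∷ p) (b ∷ s) = refl
coeff-addP (suc k) (a ∷ p) (b ∷ s) = coeff-addP k p s

coeff-scaleP : ∀ k c p → coeff k (scaleP c p) ≡ c ℚ.* coeff k p
coeff-scaleP k       c []      = sym (ℚₚ.*-zeroʳ c)
coeff-scaleP zero    c (a ∷ p) = refl
coeff-scaleP (suc k) c (a ∷ p) = coeff-scaleP k c p

coeff-contents : ∀ cs k → coeff k (foldr (λ c p → mulLinear (toℚ c) p) [ 1ℚ ] cs) ≡ toℚ (ecoef cs k)
coeff-contents []       zero    = refl
coeff-contents []       (suc k) = refl
coeff-contents (c ∷ cs) k = trans (coeff-addP k (0ℚ ∷ p) (scaleP (toℚ c) p)) (case k)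
  where
  p = foldr (λ c p → mulLinear (toℚ c) p) [ 1ℚ ] cs
  scaled : ∀ k → coeff k (scaleP (toℚ c) p) ≡ toℚ (c * ecoef cs k)
  scaled k = trans (coeff-scaleP k (toℚ c) p)
    (trans (cong (toℚ c ℚ.*_) (coeff-contents cs k)) (toℚ-* c (ecoef cs k)))
  case : ∀ k → coeff k (0ℚ ∷ p) ℚ.+ coeff k (scaleP (toℚ c) p) ≡ toℚ (ecoef (c ∷ cs) k)
  case zero    = trans (ℚₚ.+-identityˡ (coeff 0 (scaleP (toℚ c) p)))
    (trans (scaled 0) (cong toℚ (sym (ecoef-∷-zero c cs))))
  case (suc k) = trans (cong₂ ℚ._+_ (coeff-contents cs k) (scaled (suc k)))
    (trans (toℚ-+ (ecoef cs k) (c * ecoef cs (suc k))) (cong toℚ (sym (ecoef-∷-suc c cs k))))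

coeff-sum : {A : Set} (k : ℕ) (xs : List A) (w : A → ℚ) (p : A → Poly) →
            coeff k (foldr addP [] (map (λ x → scaleP (w x) (p x)) xs)) ≡
            sumℚ (map (λ x → w x ℚ.* coeff k (p x)) xs)
coeff-sum k []       w p = refl
coeff-sum k (x ∷ xs) w p =
  trans (coeff-addP k (scaleP (w x) (p x)) (foldr addP [] (map (λ x → scaleP (w x) (p x)) xs)))
        (cong₂ ℚ._+_ (coeff-scaleP k (w x) (p x)) (coeff-sum k xs w p))

-- The summand is left open so that the elementary symmetric form and the content polynomial form
-- are both instances.
sum-formula : ∀ m r k (f : List ℕ × ℕ → ℚ) →
  (∀ p → p ∈ partitionPartPairs (suc m) → f p ≡ weight (suc m) r p ℚ.* toℚ (ecoef (contents (proj₁ p)) k)) →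
  (+ starCount (suc m) r k) / 1 ≡ sumℚ (map f (partitionPartPairs (suc m)))
sum-formula m r k f e = begin
  (+ starCount n r k) / 1
    ≡⟨ /-cancel (+ starCount n r k) (n !) {{ℕₚ._!≢0 n}} ⟨
  ((+ (n !) * + starCount n r k) / (n !)) {{ℕₚ._!≢0 n}}
    ≡⟨ cong (λ z → (z / (n !)) {{ℕₚ._!≢0 n}}) (starCount-formula m r k) ⟩
  (∑ (partitionPartPairs n) (λ p → numerator r p * ecoef (contents (proj₁ p)) k) / (n !)) {{ℕₚ._!≢0 n}}
    ≡⟨ sumℚ-/ (partitionPartPairs n) f _ (n !) {{ℕₚ._!≢0 n}}
         (λ p p∈ → trans (e p p∈) (/-* (numerator r p) (ecoef (contents (proj₁ p)) k) (n !) {{ℕₚ._!≢0 n}})) ⟨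
  sumℚ (map f (partitionPartPairs n)) ∎
  where n = suc m

theorem4p4 : (n r k : ℕ) → 1 ≤ r → 1 ≤ k →
    ((+ starCount n r k) / 1 ≡ sumElementary n r k)
      × ((+ starCount n r k) / 1 ≡ sumContentPoly n r k)
-- For n = 0 there is no star transposition to fill r ≥ 1 places, and the empty partition has no
-- part, so all three sums are empty.
theorem4p4 zero    (suc r) k _ _ = refl , refl
theorem4p4 (suc m) r       k _ _ =
  -- A partition of n has n contents, so the index n - k is the one in `ecoef`.
  sum-formula m r k _ (λ (μ , j) p∈ → cong (λ L → weight (suc m) r (μ , j) ℚ.* toℚ (esymℤ (+ L - + k) (contents μ)))
    (sym (trans (length-contents 0 μ) (proj₂ (∈-partitions⁻ (suc m) (∈-pairs⁻ (suc m) p∈)))))) ,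
  trans
    (sum-formula m r k _ (λ (μ , j) _ → cong (weight (suc m) r (μ , j) ℚ.*_) (coeff-contents (contents μ) k)))
    (sym (coeff-sum k (partitionPartPairs (suc m)) (weight (suc m) r) (contentPoly ∘ proj₁)))
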